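{- For $n\ge 1$, the perfect matching complex $\mathcal{M}_p(\mathcal{G}_{2\times n})$ of the $(2\times n)$-grid graph is contractible if $n$ is odd, and is homotopy equivalent to the sphere $\mathbb{S}^k$ if $n$ is even and $n=2k+2$. -}

module Defs where

open import Data.Bool using (Bool; T)
open import Data.Fin using (Fin; zero; suc; inject₁)
open import Data.Fin.Properties using (+↔⊎; *↔×)
open import Data.Nat as ℕ using (ℕ; suc; pred)
import Data.Nat.Properties as ℕ
open import Data.Product using (Σ; ∃; _×_; _,_; proj₁; proj₂)
open import Data.Product.Function.NonDependent.Propositional using (_×-↔_)
open import Data.Rational as ℚ using (ℚ; 0ℚ; 1ℚ; ½; 1/_)
import Data.Rational.Properties as ℚ
open import Data.Rational.Solver using (module +-*-Solver)
open import Data.Sum using (_⊎_; inj₁; inj₂; [_,_]′)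
open import Data.Sum.Function.Propositional using (_⊎-↔_)
open import Data.Unit using (⊤)
open import Data.Vec.Functional using (foldr)
open import Function using (_∘_; id; const)
open import Function.Bundles using (_↔_; Inverse)
open import Function.Construct.Composition using (_↔-∘_)
open import Function.Construct.Identity using (↔-id)
open import Function.Construct.Symmetry using (↔-sym)
open import Relation.Binary.PropositionalEquality
  using (_≡_; refl; sym; trans; cong; subst)
open import Relation.Nullary using (¬_)

-- Real numbers are Cauchy sequences of rationals under the setoid equality _≈_.

Eventually : (ℕ → Set) → Set
Eventually P = ∃ λ N → ∀ n → N ℕ.≤ n → P n

IsCauchy : (ℕ → ℚ) → Set
IsCauchy x = ∀ ε → 0ℚ ℚ.< ε →
  ∃ λ N → ∀ m n → N ℕ.≤ m → N ℕ.≤ n → ℚ.∣ x m ℚ.- x n ∣ ℚ.< ε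

record ℝ : Set where
  constructor mkℝ
  field
    seq    : ℕ → ℚ
    cauchy : IsCauchy seq

open ℝ public

infix  4 _≈_ _<_ _≤_
infixl 6 _+_ _-_
infixl 7 _*_

_≈_ : ℝ → ℝ → Set
x ≈ y = ∀ ε → 0ℚ ℚ.< ε → Eventually λ n → ℚ.∣ seq x n ℚ.- seq y n ∣ ℚ.< ε

_<_ : ℝ → ℝ → Set
x < y = ∃ λ ε → 0ℚ ℚ.< ε × Eventually λ n → seq x n ℚ.+ ε ℚ.< seq y n

_≤_ : ℝ → ℝ → Set
x ≤ y = ¬ (y < x)

module Bounds where
  half-pos : ∀ {ε} → 0ℚ ℚ.< ε → 0ℚ ℚ.< ½ ℚ.* ε
  half-pos {ε} 0<ε = ℚ.positive⁻¹ (½ ℚ.* ε)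
    {{ℚ.pos*pos⇒pos ½ ε {{ℚ.positive 0<ε}}}}

  half+half : ∀ ε → ½ ℚ.* ε ℚ.+ ½ ℚ.* ε ≡ ε
  half+half ε = trans (sym (ℚ.*-distribʳ-+ ε ½ ½)) (ℚ.*-identityˡ ε)

  +-rearrange : ∀ a b c d → (a ℚ.+ b) ℚ.- (c ℚ.+ d) ≡ (a ℚ.- c) ℚ.+ (b ℚ.- d)
  +-rearrange = solve 4 (λ a b c d →
    (a :+ b) :- (c :+ d) := (a :- c) :+ (b :- d)) refl
    where open +-*-Solver

  neg-rearrange : ∀ a b → (ℚ.- a) ℚ.- (ℚ.- b) ≡ ℚ.- (a ℚ.- b)
  neg-rearrange = solve 2 (λ a b → (:- a) :- (:- b) := :- (a :- b)) refl
    where open +-*-Solver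

  *-rearrange : ∀ a b c d →
    a ℚ.* b ℚ.- c ℚ.* d ≡ a ℚ.* (b ℚ.- d) ℚ.+ d ℚ.* (a ℚ.- c)
  *-rearrange = solve 4 (λ a b c d →
    a :* b :- c :* d := a :* (b :- d) :+ d :* (a :- c)) refl
    where open +-*-Solver

  sub-add : ∀ a b → a ≡ (a ℚ.- b) ℚ.+ b
  sub-add = solve 2 (λ a b → a := (a :- b) :+ b) refl
    where open +-*-Solver

  ∣a∣≤∣a-b∣+∣b∣ : ∀ a b → ℚ.∣ a ∣ ℚ.≤ ℚ.∣ a ℚ.- b ∣ ℚ.+ ℚ.∣ b ∣
  ∣a∣≤∣a-b∣+∣b∣ a b = subst (λ z → ℚ.∣ z ∣ ℚ.≤ ℚ.∣ a ℚ.- b ∣ ℚ.+ ℚ.∣ b ∣)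
    (sym (sub-add a b)) (ℚ.∣p+q∣≤∣p∣+∣q∣ (a ℚ.- b) b)

  ∣a∣-∣b∣≤∣a-b∣ : ∀ a b → ℚ.∣ a ∣ ℚ.- ℚ.∣ b ∣ ℚ.≤ ℚ.∣ a ℚ.- b ∣
  ∣a∣-∣b∣≤∣a-b∣ a b = begin
    ℚ.∣ a ∣ ℚ.- ℚ.∣ b ∣
      ≤⟨ ℚ.+-monoˡ-≤ (ℚ.- ℚ.∣ b ∣) (∣a∣≤∣a-b∣+∣b∣ a b) ⟩
    (ℚ.∣ a ℚ.- b ∣ ℚ.+ ℚ.∣ b ∣) ℚ.- ℚ.∣ b ∣
      ≡⟨ ℚ.+-assoc ℚ.∣ a ℚ.- b ∣ ℚ.∣ b ∣ (ℚ.- ℚ.∣ b ∣) ⟩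
    ℚ.∣ a ℚ.- b ∣ ℚ.+ (ℚ.∣ b ∣ ℚ.- ℚ.∣ b ∣)
      ≡⟨ cong (ℚ.∣ a ℚ.- b ∣ ℚ.+_) (ℚ.+-inverseʳ ℚ.∣ b ∣) ⟩
    ℚ.∣ a ℚ.- b ∣ ℚ.+ 0ℚ
      ≡⟨ ℚ.+-identityʳ ℚ.∣ a ℚ.- b ∣ ⟩
    ℚ.∣ a ℚ.- b ∣ ∎
    where open ℚ.≤-Reasoning

  neg-sub : ∀ a b → ℚ.- (a ℚ.- b) ≡ b ℚ.- a
  neg-sub = solve 2 (λ a b → :- (a :- b) := b :- a) refl
    where open +-*-Solver

  ∣-∣-sym : ∀ a b → ℚ.∣ a ℚ.- b ∣ ≡ ℚ.∣ b ℚ.- a ∣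
  ∣-∣-sym a b = trans (sym (ℚ.∣-p∣≡∣p∣ (a ℚ.- b))) (cong ℚ.∣_∣ (neg-sub a b))

  ∣∣a∣-∣b∣∣≤∣a-b∣ : ∀ a b → ℚ.∣ ℚ.∣ a ∣ ℚ.- ℚ.∣ b ∣ ∣ ℚ.≤ ℚ.∣ a ℚ.- b ∣
  ∣∣a∣-∣b∣∣≤∣a-b∣ a b with ℚ.∣p∣≡p∨∣p∣≡-p (ℚ.∣ a ∣ ℚ.- ℚ.∣ b ∣)
  ... | inj₁ eq = subst (ℚ._≤ ℚ.∣ a ℚ.- b ∣) (sym eq) (∣a∣-∣b∣≤∣a-b∣ a b)
  ... | inj₂ eq = subst (ℚ._≤ ℚ.∣ a ℚ.- b ∣)
    (sym (trans eq (neg-sub ℚ.∣ a ∣ ℚ.∣ b ∣)))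
    (subst (ℚ.∣ b ∣ ℚ.- ℚ.∣ a ∣ ℚ.≤_) (∣-∣-sym b a) (∣a∣-∣b∣≤∣a-b∣ b a))

  ⊔-≤ˡ : ∀ {M N n} → M ℕ.⊔ N ℕ.≤ n → M ℕ.≤ n
  ⊔-≤ˡ {M} {N} = ℕ.≤-trans (ℕ.m≤m⊔n M N)

  ⊔-≤ʳ : ∀ {M N n} → M ℕ.⊔ N ℕ.≤ n → N ℕ.≤ n
  ⊔-≤ʳ {M} {N} = ℕ.≤-trans (ℕ.m≤n⊔m M N)

  tail-bound : ∀ x → IsCauchy x →
    ∃ λ B → 0ℚ ℚ.< B × Eventually λ n → ℚ.∣ x n ∣ ℚ.< B
  tail-bound x cx with cx 1ℚ (ℚ.positive⁻¹ 1ℚ)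
  ... | N , close = B , 0<B , N , bound
    where
    B = 1ℚ ℚ.+ ℚ.∣ x N ∣
    0<B : 0ℚ ℚ.< B
    0<B = ℚ.+-mono-<-≤ (ℚ.positive⁻¹ 1ℚ) (ℚ.0≤∣p∣ (x N))
    bound : ∀ n → N ℕ.≤ n → ℚ.∣ x n ∣ ℚ.< B
    bound n N≤n = ℚ.≤-<-trans (∣a∣≤∣a-b∣+∣b∣ (x n) (x N))
      (ℚ.+-monoˡ-< ℚ.∣ x N ∣ (close n N N≤n ℕ.≤-refl))

  module Scale (B ε : ℚ) (0<B : 0ℚ ℚ.< B) (0<ε : 0ℚ ℚ.< ε) where
    instance
      B-pos : ℚ.Positive B
      B-pos = ℚ.positive 0<B
      B-nonZero : ℚ.NonZero B
      B-nonZero = ℚ.pos⇒nonZero B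
      B-nonNeg : ℚ.NonNegative B
      B-nonNeg = ℚ.pos⇒nonNeg B

    δ : ℚ
    δ = 1/ B ℚ.* ε

    δ-pos : 0ℚ ℚ.< δ
    δ-pos = ℚ.positive⁻¹ δ
      {{ℚ.pos*pos⇒pos (1/ B) {{ℚ.1/pos⇒pos B}} ε {{ℚ.positive 0<ε}}}}

    B*δ : B ℚ.* δ ≡ ε
    B*δ = trans (sym (ℚ.*-assoc B (1/ B) ε))
      (trans (cong (ℚ._* ε) (ℚ.*-inverseʳ B)) (ℚ.*-identityˡ ε))

    small : ∀ p q → ℚ.∣ p ∣ ℚ.< B → ℚ.∣ q ∣ ℚ.< δ → ℚ.∣ p ℚ.* q ∣ ℚ.< ε
    small p q p<B q<δ = begin-strict
      ℚ.∣ p ℚ.* q ∣       ≡⟨ ℚ.∣p*q∣≡∣p∣*∣q∣ p q ⟩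
      ℚ.∣ p ∣ ℚ.* ℚ.∣ q ∣ ≤⟨ ℚ.*-monoʳ-≤-nonNeg ℚ.∣ q ∣ {{ℚ.∣-∣-nonNeg q}} (ℚ.<⇒≤ p<B) ⟩
      B ℚ.* ℚ.∣ q ∣       <⟨ ℚ.*-monoʳ-<-pos B q<δ ⟩
      B ℚ.* δ             ≡⟨ B*δ ⟩
      ε                   ∎
      where open ℚ.≤-Reasoning

  sum-small : ∀ ε p q → ℚ.∣ p ∣ ℚ.< ½ ℚ.* ε → ℚ.∣ q ∣ ℚ.< ½ ℚ.* ε →
    ℚ.∣ p ℚ.+ q ∣ ℚ.< ε
  sum-small ε p q p< q< = subst (ℚ.∣ p ℚ.+ q ∣ ℚ.<_) (half+half ε)
    (ℚ.≤-<-trans (ℚ.∣p+q∣≤∣p∣+∣q∣ p q) (ℚ.+-mono-< p< q<))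

open Bounds

fromℚ : ℚ → ℝ
fromℚ q = mkℝ (const q) λ ε 0<ε → 0 , λ _ _ _ _ →
  subst (λ z → ℚ.∣ z ∣ ℚ.< ε) (sym (ℚ.+-inverseʳ q)) 0<ε

0ℝ 1ℝ : ℝ
0ℝ = fromℚ 0ℚ
1ℝ = fromℚ 1ℚ

_+_ : ℝ → ℝ → ℝ
seq (x + y) n = seq x n ℚ.+ seq y n
cauchy (x + y) ε 0<ε
  with cauchy x (½ ℚ.* ε) (half-pos 0<ε) | cauchy y (½ ℚ.* ε) (half-pos 0<ε)
... | M , cx | N , cy = M ℕ.⊔ N , λ m n m≥ n≥ →
  subst (λ z → ℚ.∣ z ∣ ℚ.< ε)
    (sym (+-rearrange (seq x m) (seq y m) (seq x n) (seq y n)))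
    (sum-small ε _ _ (cx m n (⊔-≤ˡ {M} {N} m≥) (⊔-≤ˡ {M} {N} n≥))
                     (cy m n (⊔-≤ʳ {M} {N} m≥) (⊔-≤ʳ {M} {N} n≥)))

-_ : ℝ → ℝ
seq (- x) n = ℚ.- seq x n
cauchy (- x) ε 0<ε with cauchy x ε 0<ε
... | N , cx = N , λ m n m≥ n≥ →
  subst (ℚ._< ε)
    (sym (trans (cong ℚ.∣_∣ (neg-rearrange (seq x m) (seq x n)))
                (ℚ.∣-p∣≡∣p∣ (seq x m ℚ.- seq x n))))
    (cx m n m≥ n≥)

_-_ : ℝ → ℝ → ℝ
x - y = x + (- y)

∣_∣ : ℝ → ℝ
seq ∣ x ∣ n = ℚ.∣ seq x n ∣
cauchy ∣ x ∣ ε 0<ε with cauchy x ε 0<ε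
... | N , cx = N , λ m n m≥ n≥ →
  ℚ.≤-<-trans (∣∣a∣-∣b∣∣≤∣a-b∣ (seq x m) (seq x n)) (cx m n m≥ n≥)

private
  product-close : ∀ A B ε (0<A : 0ℚ ℚ.< A) (0<B : 0ℚ ℚ.< B) (0<ε : 0ℚ ℚ.< ε) →
    ∀ a b c d → ℚ.∣ a ∣ ℚ.< A → ℚ.∣ d ∣ ℚ.< B →
    ℚ.∣ b ℚ.- d ∣ ℚ.< Scale.δ A ε 0<A 0<ε → ℚ.∣ a ℚ.- c ∣ ℚ.< Scale.δ B ε 0<B 0<ε →
    ℚ.∣ a ℚ.* b ℚ.- c ℚ.* d ∣ ℚ.< ε ℚ.+ ε
  product-close A B ε 0<A 0<B 0<ε a b c d a<A d<B b-d a-c =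
    subst (λ z → ℚ.∣ z ∣ ℚ.< ε ℚ.+ ε) (sym (*-rearrange a b c d))
      (ℚ.≤-<-trans (ℚ.∣p+q∣≤∣p∣+∣q∣ (a ℚ.* (b ℚ.- d)) (d ℚ.* (a ℚ.- c)))
        (ℚ.+-mono-< (Scale.small A ε 0<A 0<ε a (b ℚ.- d) a<A b-d)
                    (Scale.small B ε 0<B 0<ε d (a ℚ.- c) d<B a-c)))

  *-cauchy : ∀ x y → IsCauchy x → IsCauchy y → IsCauchy (λ n → x n ℚ.* y n)
  *-cauchy x y cx cy ε 0<ε =
    let ε/2 = ½ ℚ.* ε
        0<ε/2 = half-pos 0<ε
        A , 0<A , K , x<A = tail-bound x cx
        B , 0<B , L , y<B = tail-bound y cy
        M , y-close = cy (Scale.δ A ε/2 0<A 0<ε/2) (Scale.δ-pos A ε/2 0<A 0<ε/2)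
        N , x-close = cx (Scale.δ B ε/2 0<B 0<ε/2) (Scale.δ-pos B ε/2 0<B 0<ε/2)
        KL≤ = λ {n} → ⊔-≤ˡ {K ℕ.⊔ L} {M ℕ.⊔ N} {n}
        MN≤ = λ {n} → ⊔-≤ʳ {K ℕ.⊔ L} {M ℕ.⊔ N} {n}
    in (K ℕ.⊔ L) ℕ.⊔ (M ℕ.⊔ N) , λ m n m≥ n≥ →
      subst (ℚ.∣ x m ℚ.* y m ℚ.- x n ℚ.* y n ∣ ℚ.<_) (half+half ε)
        (product-close A B ε/2 0<A 0<B 0<ε/2 (x m) (y m) (x n) (y n)
          (x<A m (⊔-≤ˡ {K} {L} (KL≤ m≥)))
          (y<B n (⊔-≤ʳ {K} {L} (KL≤ n≥)))
          (y-close m n (⊔-≤ˡ {M} {N} (MN≤ m≥)) (⊔-≤ˡ {M} {N} (MN≤ n≥)))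
          (x-close m n (⊔-≤ʳ {M} {N} (MN≤ m≥)) (⊔-≤ʳ {M} {N} (MN≤ n≥))))

_*_ : ℝ → ℝ → ℝ
x * y = mkℝ (λ n → seq x n ℚ.* seq y n)
            (*-cauchy (seq x) (seq y) (cauchy x) (cauchy y))

∑ : ∀ {n} → (Fin n → ℝ) → ℝ
∑ = foldr _+_ 0ℝ

Finite : Set → Set
Finite A = ∃ λ n → A ↔ Fin n

∑[_] : ∀ {A} → Finite A → (A → ℝ) → ℝ
∑[ n , A↔Fin ] x = ∑ (x ∘ Inverse.from A↔Fin)

-- The subspace of ℝ^Index cut out by Member.  As Index is finite, the
-- sup-norm balls used in Continuous generate the Euclidean topology.
record Space : Set₁ where
  field
    Index  : Set
    finite : Finite Index
    Member : (Index → ℝ) → Set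

  Point : Set
  Point = Σ (Index → ℝ) Member

open Space public using (Point)

coord : ∀ {X} → Point X → Space.Index X → ℝ
coord = proj₁

_≋_ : ∀ {X} → Point X → Point X → Set
_≋_ {X} p q = ∀ i → coord {X} p i ≈ coord {X} q i

_≋[_]_ : ∀ {X} → Point X → ℝ → Point X → Set
_≋[_]_ {X} p ε q = ∀ i → ∣ coord {X} p i - coord {X} q i ∣ < ε

-- Continuity in particular forces f to respect the equality _≋_ of points.
Continuous : ∀ {X Y} → (Point X → Point Y) → Set
Continuous {X} {Y} f = ∀ p ε → 0ℝ < ε →
  ∃ λ δ → 0ℝ < δ × (∀ q → _≋[_]_ {X} p δ q → _≋[_]_ {Y} (f p) ε (f q))

Map : Space → Space → Set
Map X Y = Σ (Point X → Point Y) (Continuous {X} {Y})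

_⟨$⟩_ : ∀ {X Y} → Map X Y → Point X → Point Y
_⟨$⟩_ = proj₁

_×ₛ_ : Space → Space → Space
X ×ₛ Y = record
  { Index  = Space.Index X ⊎ Space.Index Y
  ; finite = _ , (↔-sym +↔⊎ ↔-∘ (proj₂ (Space.finite X) ⊎-↔ proj₂ (Space.finite Y)))
  ; Member = λ p → Space.Member X (p ∘ inj₁) × Space.Member Y (p ∘ inj₂)
  }

pair : ∀ {X Y} → Point X → Point Y → Point (X ×ₛ Y)
pair (p , p∈X) (q , q∈Y) = [ p , q ]′ , p∈X , q∈Y

Interval : Space
Interval = record
  { Index  = Fin 1
  ; finite = 1 , ↔-id _
  ; Member = λ t → 0ℝ ≤ t zero × t zero ≤ 1ℝ
  }

private
  0≤1 : 0ℝ ≤ 1ℝ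
  0≤1 (ε , 0<ε , N , lt) = ℚ.<-asym (lt N ℕ.≤-refl)
    (ℚ.+-mono-< (ℚ.positive⁻¹ 1ℚ) 0<ε)

  ≤-refl : ∀ q → fromℚ q ≤ fromℚ q
  ≤-refl q (ε , 0<ε , N , lt) = ℚ.<-irrefl refl
    (ℚ.<-trans (subst (ℚ._< q ℚ.+ ε) (ℚ.+-identityʳ q) (ℚ.+-monoʳ-< q 0<ε))
               (lt N ℕ.≤-refl))

start end : Point Interval
start = const 0ℝ , ≤-refl 0ℚ , 0≤1
end   = const 1ℝ , 0≤1 , ≤-refl 1ℚ

Homotopic : ∀ {X Y} → (f g : Point X → Point Y) → Set
Homotopic {X} {Y} f g = Σ (Map (X ×ₛ Interval) Y) λ (H , _) →
  ∀ p → _≋_ {Y} (H (pair {X} {Interval} p start)) (f p)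
      × _≋_ {Y} (H (pair {X} {Interval} p end)) (g p)

infix 4 _≃_

_≃_ : Space → Space → Set
X ≃ Y = Σ (Map X Y) λ (f , _) → Σ (Map Y X) λ (g , _) →
  Homotopic {X} {X} (g ∘ f) id × Homotopic {Y} {Y} (f ∘ g) id

OnePoint : Space
OnePoint = record { Index = Fin 0 ; finite = 0 , ↔-id _ ; Member = λ _ → ⊤ }

Contractible : Space → Set
Contractible X = X ≃ OnePoint

Sphere : ℕ → Space
Sphere k = record
  { Index  = Fin (suc k)
  ; finite = suc k , ↔-id _
  ; Member = λ y → ∑ (λ i → y i * y i) ≈ 1ℝ
  }

-- Subsets of finite sets are taken decidable, as every classical one is.
Subset : Set → Set
Subset A = A → Bool

infix 4 _∈_ _⊆_

_∈_ : ∀ {A} → A → Subset A → Set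
a ∈ σ = T (σ a)

_⊆_ : ∀ {A} → Subset A → Subset A → Set
σ ⊆ τ = ∀ a → a ∈ σ → a ∈ τ

record SimplicialComplex : Set₁ where
  field
    Vertex : Set
    finite : Finite Vertex
    Face   : Subset Vertex → Set
    down   : ∀ {σ τ} → σ ⊆ τ → Face τ → Face σ

-- Barycentric coordinates x whose support { v | x v > 0 } is a face.  The sign
-- of a real being undecidable, the support is not itself a Subset, so the
-- condition is put on all Subsets contained in it.
realization : SimplicialComplex → Space
realization K = record
  { Index  = Vertex
  ; finite = finite
  ; Member = λ x → (∀ v → 0ℝ ≤ x v)
                 × ∑[ finite ] x ≈ 1ℝ
                 × (∀ σ → (∀ v → v ∈ σ → 0ℝ < x v) → Face σ)
  }
  where open SimplicialComplex K

record Graph : Set₁ where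
  field
    Vertex        : Set
    Edge          : Set
    finite-vertex : Finite Vertex
    finite-edge   : Finite Edge
    ends          : Edge → Vertex × Vertex

  Incident : Vertex → Edge → Set
  Incident v e = v ≡ proj₁ (ends e) ⊎ v ≡ proj₂ (ends e)

Path : ℕ → Graph
Path n = record
  { Vertex        = Fin n
  ; Edge          = Fin (pred n)
  ; finite-vertex = n , ↔-id _
  ; finite-edge   = pred n , ↔-id _
  ; ends          = consecutive n
  }
  where
  consecutive : ∀ n → Fin (pred n) → Fin n × Fin n
  consecutive (suc n) i = inject₁ i , suc i

_□_ : Graph → Graph → Graph
G □ H = record
  { Vertex        = G.Vertex × H.Vertex
  ; Edge          = (G.Edge × H.Vertex) ⊎ (G.Vertex × H.Edge)
  ; finite-vertex = finite-× G.finite-vertex H.finite-vertex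
  ; finite-edge   = finite-⊎ (finite-× G.finite-edge H.finite-vertex)
                             (finite-× G.finite-vertex H.finite-edge)
  ; ends          = λ where
      (inj₁ (e , w)) → (proj₁ (G.ends e) , w) , (proj₂ (G.ends e) , w)
      (inj₂ (v , e)) → (v , proj₁ (H.ends e)) , (v , proj₂ (H.ends e))
  }
  where
  module G = Graph G
  module H = Graph H
  finite-× : ∀ {A B} → Finite A → Finite B → Finite (A × B)
  finite-× (_ , f) (_ , g) = _ , (↔-sym *↔× ↔-∘ (f ×-↔ g))
  finite-⊎ : ∀ {A B} → Finite A → Finite B → Finite (A ⊎ B)
  finite-⊎ (_ , f) (_ , g) = _ , (↔-sym +↔⊎ ↔-∘ (f ⊎-↔ g))

Grid : ℕ → ℕ → Graph
Grid m n = Path m □ Path n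

module _ (G : Graph) where
  open Graph G

  IsMatching : Subset Edge → Set
  IsMatching M = ∀ e f v → e ∈ M → f ∈ M → Incident v e → Incident v f → e ≡ f

  IsPerfectMatching : Subset Edge → Set
  IsPerfectMatching M = IsMatching M × (∀ v → ∃ λ e → e ∈ M × Incident v e)

  -- The complex whose facets are the perfect matchings.
  perfectMatchingComplex : SimplicialComplex
  perfectMatchingComplex = record
    { Vertex = Edge
    ; finite = finite-edge
    ; Face   = λ σ → ∃ λ M → IsPerfectMatching M × σ ⊆ M
    ; down   = λ σ⊆τ (M , perfect , τ⊆M) →
        M , perfect , λ e e∈σ → τ⊆M e (σ⊆τ e e∈σ)
    }

{-# OPTIONS --safe #-}
-- A perfect matching of the 2 × n grid is a tiling by dominoes in which the two
-- horizontal edges between columns i and i + 1 occur together.  Hence the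
-- complex is flag: writing v_j for the vertical edge in column j and a_i, b_i
-- for the horizontal edges between columns i and i + 1, its minimal non-faces
-- are the overlapping pairs.  For every b the vertices v_{2b+1}, a_{2b+1} and
-- b_{2b+1} can be folded onto v_{2b}, and b_{2b} onto a_{2b}.  Folding onto
-- v_{2b} is admissible once a_{2b-1} and b_{2b-1} carry no mass, so the moves
-- are performed one block b after the other: in barycentric coordinates mass
-- flows from a vertex to its image with a weight depending on time and block
-- such that a block starts moving only after the previous ones have finished.
--
-- If n = 2k + 2, the pairs v_{2b}, a_{2b} with b ≤ k span the boundary of a
-- cross-polytope, on which the differences y_b = v_{2b} - a_{2b} satisfy
-- Σ |y_b| = 1; it is identified with the sphere by the signed square root,
-- whose inverse is z ↦ z |z|.  If n = 2k + 1, the vertex v_{2k} is left without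
-- a partner, so that all remaining mass can be moved to it.

module Submission where

open import Defs
open import Algebra.Bundles using (CommutativeSemiring)
open import Algebra.Structures using (IsCommutativeSemiring)
import Algebra.Properties.CommutativeMonoid.Sum as CommutativeMonoidSum
import Algebra.Properties.CommutativeSemigroup as CommutativeSemigroupProperties
open import Data.Bool using (Bool; true; false; T; not; _∨_)
import Data.Bool.Properties as Bool
open import Data.Bool.Properties using (T-∨; T?)
open import Data.Empty using (⊥; ⊥-elim)
import Data.Integer as ℤ
import Data.Integer.Properties as ℤ
open import Data.Fin as Fin using (Fin; zero; suc; toℕ; fromℕ<; inject₁)
import Data.Fin.Properties as Fin
open import Data.Nat as ℕ using (ℕ; zero; suc; ⌊_/2⌋)
open import Data.Nat.Divisibility using (_∣_; divides)
import Data.Nat.Properties as ℕ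
open import Data.Product using (∃; _×_; _,_; proj₁; proj₂)
open import Data.Rational as ℚ using (ℚ; 0ℚ; 1ℚ; ½)
import Data.Rational.Properties as ℚ
import Data.Rational.Unnormalised as ℚᵘ
import Data.Rational.Unnormalised.Properties as ℚᵘ
open import Data.Rational.Solver using (module +-*-Solver)
open import Data.Sum using (_⊎_; inj₁; inj₂)
open import Data.Sum.Properties using (inj₂-injective)
open import Data.Product.Properties using (,-injectiveˡ; ,-injectiveʳ)
open import Data.Unit using (tt)
open import Data.Vec.Functional using (foldr)
open import Function using (_∘_; id)
open import Function.Bundles using (Inverse; Equivalence)
open import Function.Construct.Identity using (↔-id)
open import Level using (0ℓ)
open import Relation.Binary using (IsEquivalence)
import Relation.Binary.Reasoning.Setoid as SetoidReasoning
open import Relation.Binary.PropositionalEquality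
  using (_≡_; _≢_; refl; sym; trans; cong; cong₂; subst; subst₂)
open import Relation.Binary.Definitions using (DecidableEquality)
open import Relation.Nullary using (¬_; Dec; yes; no)
open import Relation.Nullary.Decidable using (map′; ¬?; _×-dec_; _⊎-dec_; isYes; toWitness; fromWitness)

open Bounds using (half-pos; sub-add; half+half; sum-small; +-rearrange; neg-rearrange; *-rearrange;
                   ∣-∣-sym; ∣∣a∣-∣b∣∣≤∣a-b∣; ∣a∣≤∣a-b∣+∣b∣; tail-bound; ⊔-≤ˡ; ⊔-≤ʳ; module Scale)

-- Whether a real is positive cannot be decided, so no step may ask for the support of a point.
-- Being a face is therefore turned into equations: as the complex is flag, it means x e * x f ≅ 0
-- for all clashing edges e and f. The passage from strict positivity to equations rests on
-- `≅-stable`. Such equations survive sums and products, so a move need only be checked on products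
-- of its terms. Such a product vanishes because the two edges clashed already, or because the
-- product of their weights is 0 at all times; the second case is why the blocks must be ordered.
-- For the same reason every map is a formula on all of ℝ^Index, built from sums, products, absolute
-- values and the signed root, without a case distinction on the sign of a real. Its continuity
-- follows by composition. Homotopies lead from the composite map at time 0 to the identity at time
-- 1, so the moves are written in 1 - t and seen in reverse. The composite on the sphere is the
-- identity up to `_≅_`; only the one on the complex needs a genuine homotopy.

-- Rational inequalities and closeness of Cauchy sequences

b+[c-a]≡d : ∀ a b c d → b ℚ.- a ≡ d ℚ.- c → b ℚ.+ (c ℚ.- a) ≡ d
b+[c-a]≡d a b c d eq = trans (solve 3 (λ b a c → b :+ (c :- a) := (b :- a) :+ c) refl b a c)
  (trans (cong (ℚ._+ c) eq) (sym (sub-add d c)))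
  where open +-*-Solver

a+[c-a]≡c : ∀ a c → a ℚ.+ (c ℚ.- a) ≡ c
a+[c-a]≡c a c = b+[c-a]≡d a a c c (trans (ℚ.+-inverseʳ a) (sym (ℚ.+-inverseʳ c)))

-- Adding c - a to both sides of the hypothesis gives the conclusion. This reduces linear arithmetic
-- on inequalities to a ring identity between differences, which the solver can prove.
<-shift : ∀ {a b c d} → b ℚ.- a ≡ d ℚ.- c → a ℚ.< b → c ℚ.< d
<-shift {a} {b} {c} {d} eq a<b =
  subst₂ ℚ._<_ (a+[c-a]≡c a c) (b+[c-a]≡d a b c d eq) (ℚ.+-monoˡ-< (c ℚ.- a) a<b)

≤-shift : ∀ {a b c d} → b ℚ.- a ≡ d ℚ.- c → a ℚ.≤ b → c ℚ.≤ d
≤-shift {a} {b} {c} {d} eq a≤b =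
  subst₂ ℚ._≤_ (a+[c-a]≡c a c) (b+[c-a]≡d a b c d eq) (ℚ.+-monoˡ-≤ (c ℚ.- a) a≤b)

p≤∣p∣ : ∀ p → p ℚ.≤ ℚ.∣ p ∣
p≤∣p∣ p with ℚ.≤-total 0ℚ p
... | inj₁ 0≤p = ℚ.≤-reflexive (sym (ℚ.0≤p⇒∣p∣≡p 0≤p))
... | inj₂ p≤0 = ℚ.≤-trans p≤0 (ℚ.0≤∣p∣ p)

-p≤∣p∣ : ∀ p → ℚ.- p ℚ.≤ ℚ.∣ p ∣
-p≤∣p∣ p = subst (ℚ.- p ℚ.≤_) (ℚ.∣-p∣≡∣p∣ p) (p≤∣p∣ (ℚ.- p))

p≤0⇒∣p∣≡-p : ∀ {p} → p ℚ.≤ 0ℚ → ℚ.∣ p ∣ ≡ ℚ.- p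
p≤0⇒∣p∣≡-p {p} p≤0 = trans (sym (ℚ.∣-p∣≡∣p∣ p)) (ℚ.0≤p⇒∣p∣≡p (ℚ.neg-antimono-≤ p≤0))

∣a-a∣<ε : ∀ a {ε} → 0ℚ ℚ.< ε → ℚ.∣ a ℚ.- a ∣ ℚ.< ε
∣a-a∣<ε a {ε} 0<ε = subst (λ z → ℚ.∣ z ∣ ℚ.< ε) (sym (ℚ.+-inverseʳ a)) 0<ε

Eventually-× : ∀ {P Q : ℕ → Set} → Eventually P → Eventually Q → Eventually (λ n → P n × Q n)
Eventually-× (M , p) (N , q) =
  M ℕ.⊔ N , λ n n≥ → p n (⊔-≤ˡ {M} {N} n≥) , q n (⊔-≤ʳ {M} {N} n≥)

Eventually-map : ∀ {P Q : ℕ → Set} → (∀ n → P n → Q n) → Eventually P → Eventually Q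
Eventually-map f (N , p) = N , λ n n≥ → f n (p n n≥)

Eventually-∃ : ∀ {P : ℕ → Set} → Eventually P → ∃ P
Eventually-∃ (N , p) = N , p N ℕ.≤-refl

-- The instance of `_≈_` at a single ε. Congruence and continuity of an operation are then both read
-- off the same estimate.
Close : ℚ → ℝ → ℝ → Set
Close ε x y = Eventually λ n → ℚ.∣ seq x n ℚ.- seq y n ∣ ℚ.< ε

Close-mono : ∀ {ε δ x y} → ε ℚ.≤ δ → Close ε x y → Close δ x y
Close-mono ε≤δ = Eventually-map λ _ lt → ℚ.<-≤-trans lt ε≤δ

a-c≡[a-b]+[b-c] : ∀ a b c → a ℚ.- c ≡ (a ℚ.- b) ℚ.+ (b ℚ.- c)
a-c≡[a-b]+[b-c] = solve 3 (λ a b c → a :- c := (a :- b) :+ (b :- c)) refl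
  where open +-*-Solver

close-trans : ∀ {ε x y z} → Close (½ ℚ.* ε) x y → Close (½ ℚ.* ε) y z → Close ε x z
close-trans {ε} {x} {y} {z} p q = Eventually-map
  (λ n (p , q) → subst (λ w → ℚ.∣ w ∣ ℚ.< ε)
    (sym (a-c≡[a-b]+[b-c] (seq x n) (seq y n) (seq z n))) (sum-small ε _ _ p q))
  (Eventually-× p q)

close-+ : ∀ {ε} → 0ℚ ℚ.< ε → ∀ {x y u v} → Close (½ ℚ.* ε) x y → Close (½ ℚ.* ε) u v → Close ε (x + u) (y + v)
close-+ {ε} 0<ε {x} {y} {u} {v} p q = Eventually-map
  (λ n (p , q) → subst (λ w → ℚ.∣ w ∣ ℚ.< ε)
    (sym (+-rearrange (seq x n) (seq u n) (seq y n) (seq v n))) (sum-small ε _ _ p q))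
  (Eventually-× p q)

close-neg : ∀ {ε x y} → Close ε x y → Close ε (- x) (- y)
close-neg {ε} {x} {y} = Eventually-map λ n → subst (ℚ._< ε)
  (sym (trans (cong ℚ.∣_∣ (neg-rearrange (seq x n) (seq y n))) (ℚ.∣-p∣≡∣p∣ _)))

close-abs : ∀ {ε x y} → Close ε x y → Close ε ∣ x ∣ ∣ y ∣
close-abs {x = x} {y} = Eventually-map λ n → ℚ.≤-<-trans (∣∣a∣-∣b∣∣≤∣a-b∣ (seq x n) (seq y n))

common-bound : ∀ {p q} → 0ℚ ℚ.< p → 0ℚ ℚ.< q → ∃ λ δ → 0ℚ ℚ.< δ × δ ℚ.≤ p × δ ℚ.≤ q
common-bound {p} {q} 0<p 0<q with ℚ.≤-total p q
... | inj₁ p≤q = p , 0<p , ℚ.≤-refl , p≤q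
... | inj₂ q≤p = q , 0<q , q≤p , ℚ.≤-refl

product-close : ∀ A B ε (0<A : 0ℚ ℚ.< A) (0<B : 0ℚ ℚ.< B) (0<ε : 0ℚ ℚ.< ε) →
  ∀ a b c d → ℚ.∣ a ∣ ℚ.< A → ℚ.∣ d ∣ ℚ.< B →
  ℚ.∣ b ℚ.- d ∣ ℚ.< Scale.δ A (½ ℚ.* ε) 0<A (half-pos 0<ε) →
  ℚ.∣ a ℚ.- c ∣ ℚ.< Scale.δ B (½ ℚ.* ε) 0<B (half-pos 0<ε) →
  ℚ.∣ a ℚ.* b ℚ.- c ℚ.* d ∣ ℚ.< ε
product-close A B ε 0<A 0<B 0<ε a b c d a<A d<B b-d a-c =
  subst (λ w → ℚ.∣ w ∣ ℚ.< ε) (sym (*-rearrange a b c d))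
    (sum-small ε (a ℚ.* (b ℚ.- d)) (d ℚ.* (a ℚ.- c))
      (Scale.small A (½ ℚ.* ε) 0<A (half-pos 0<ε) a (b ℚ.- d) a<A b-d)
      (Scale.small B (½ ℚ.* ε) 0<B (half-pos 0<ε) d (a ℚ.- c) d<B a-c))

close-bounded : ∀ {B δ} a b → ℚ.∣ a ∣ ℚ.< B → δ ℚ.≤ 1ℚ → ℚ.∣ a ℚ.- b ∣ ℚ.< δ → ℚ.∣ b ∣ ℚ.< B ℚ.+ 1ℚ
close-bounded {B} {δ} a b a<B δ≤1 a-b<δ = ℚ.≤-<-trans (∣a∣≤∣a-b∣+∣b∣ b a)
  (subst (ℚ._< B ℚ.+ 1ℚ) (ℚ.+-comm ℚ.∣ a ∣ ℚ.∣ b ℚ.- a ∣)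
    (ℚ.+-mono-< a<B (subst (ℚ._< 1ℚ) (∣-∣-sym a b) (ℚ.<-≤-trans a-b<δ δ≤1))))

-- To serve as a modulus of continuity, δ may depend on x and u only. The bound needed for v is
-- therefore taken from that of u: since δ ≤ 1, v stays below B + 1.
close-* : ∀ {ε} → 0ℚ ℚ.< ε → ∀ x u → ∃ λ δ → 0ℚ ℚ.< δ ×
  (∀ y v → Close δ x y → Close δ u v → Close ε (x * u) (y * v))
close-* {ε} 0<ε x u =
  let A , 0<A , x<A = tail-bound (seq x) (cauchy x)
      B , 0<B , u<B = tail-bound (seq u) (cauchy u)
      0<B+1 = ℚ.<-trans 0<B (subst (ℚ._< B ℚ.+ 1ℚ) (ℚ.+-identityʳ B) (ℚ.+-monoʳ-< B (ℚ.positive⁻¹ 1ℚ)))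
      γ , 0<γ , γ≤A , γ≤B = common-bound (Scale.δ-pos A (½ ℚ.* ε) 0<A (half-pos 0<ε))
                                         (Scale.δ-pos (B ℚ.+ 1ℚ) (½ ℚ.* ε) 0<B+1 (half-pos 0<ε))
      δ , 0<δ , δ≤1 , δ≤γ = common-bound (ℚ.positive⁻¹ 1ℚ) 0<γ
  in δ , 0<δ , λ y v p q → Eventually-map
    (λ n ((a , b) , (p , q)) → product-close A (B ℚ.+ 1ℚ) ε 0<A 0<B+1 0<ε
      (seq x n) (seq u n) (seq y n) (seq v n) a (close-bounded (seq u n) (seq v n) b δ≤1 q)
      (ℚ.<-≤-trans q (ℚ.≤-trans δ≤γ γ≤A)) (ℚ.<-≤-trans p (ℚ.≤-trans δ≤γ γ≤B)))
    (Eventually-× (Eventually-× x<A u<B) (Eventually-× p q))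

-- _≈_ unfolds to a function type from which its arguments cannot be inferred.
infix 4 _≅_
record _≅_ (x y : ℝ) : Set where
  constructor ≈⇒≅
  field ≅⇒≈ : x ≈ y
open _≅_ public

-- The commutative semiring of real numbers

pointwise : ∀ {x y} → (∀ n → seq x n ≡ seq y n) → x ≅ y
pointwise {x} {y} eq = ≈⇒≅ λ ε 0<ε → 0 , λ n _ →
  subst (λ z → ℚ.∣ seq x n ℚ.- z ∣ ℚ.< ε) (eq n) (∣a-a∣<ε (seq x n) 0<ε)

≅-refl : ∀ {x} → x ≅ x
≅-refl = pointwise λ _ → refl

≅-sym : ∀ {x y} → x ≅ y → y ≅ x
≅-sym {x} {y} x≅y = ≈⇒≅ λ ε 0<ε → Eventually-map
  (λ n → subst (ℚ._< ε) (∣-∣-sym (seq x n) (seq y n))) (≅⇒≈ x≅y ε 0<ε)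

≅-trans : ∀ {x y z} → x ≅ y → y ≅ z → x ≅ z
≅-trans {x} {y} {z} x≅y y≅z = ≈⇒≅ λ ε 0<ε →
  close-trans {ε} {x} {y} {z} (≅⇒≈ x≅y _ (half-pos 0<ε)) (≅⇒≈ y≅z _ (half-pos 0<ε))

≅-isEquivalence : IsEquivalence _≅_
≅-isEquivalence = record { refl = ≅-refl ; sym = ≅-sym ; trans = ≅-trans }

+-cong : ∀ {x y u v} → x ≅ y → u ≅ v → x + u ≅ y + v
+-cong {x} {y} {u} {v} p q = ≈⇒≅ λ ε 0<ε →
  close-+ 0<ε {x} {y} {u} {v} (≅⇒≈ p _ (half-pos 0<ε)) (≅⇒≈ q _ (half-pos 0<ε))

neg-cong : ∀ {x y} → x ≅ y → - x ≅ - y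
neg-cong {x} {y} p = ≈⇒≅ λ ε 0<ε → close-neg {ε} {x} {y} (≅⇒≈ p ε 0<ε)

minus-cong : ∀ {x y u v} → x ≅ y → u ≅ v → x - u ≅ y - v
minus-cong p q = +-cong p (neg-cong q)

abs-cong : ∀ {x y} → x ≅ y → ∣ x ∣ ≅ ∣ y ∣
abs-cong {x} {y} p = ≈⇒≅ λ ε 0<ε → close-abs {ε} {x} {y} (≅⇒≈ p ε 0<ε)

*-cong : ∀ {x y u v} → x ≅ y → u ≅ v → x * u ≅ y * v
*-cong {x} {y} {u} {v} p q = ≈⇒≅ λ ε 0<ε →
  let δ , 0<δ , close = close-* 0<ε x u
  in close y v (≅⇒≈ p δ 0<δ) (≅⇒≈ q δ 0<δ)

*-identityˡ : ∀ x → 1ℝ * x ≅ x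
*-identityˡ x = pointwise λ n → ℚ.*-identityˡ (seq x n)

*-identityʳ : ∀ x → x * 1ℝ ≅ x
*-identityʳ x = pointwise λ n → ℚ.*-identityʳ (seq x n)

*-zeroˡ : ∀ x → 0ℝ * x ≅ 0ℝ
*-zeroˡ x = pointwise λ n → ℚ.*-zeroˡ (seq x n)

*-zeroʳ : ∀ x → x * 0ℝ ≅ 0ℝ
*-zeroʳ x = pointwise λ n → ℚ.*-zeroʳ (seq x n)

+-identityˡ : ∀ x → 0ℝ + x ≅ x
+-identityˡ x = pointwise λ n → ℚ.+-identityˡ (seq x n)

+-identityʳ : ∀ x → x + 0ℝ ≅ x
+-identityʳ x = pointwise λ n → ℚ.+-identityʳ (seq x n)

*-comm : ∀ x y → x * y ≅ y * x
*-comm x y = pointwise λ n → ℚ.*-comm (seq x n) (seq y n)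

ℝ-isCommutativeSemiring : IsCommutativeSemiring _≅_ _+_ _*_ 0ℝ 1ℝ
ℝ-isCommutativeSemiring = record
    { isSemiring = record
      { isSemiringWithoutAnnihilatingZero = record
        { +-isCommutativeMonoid = record
          { isMonoid = record
            { isSemigroup = record
              { isMagma = record { isEquivalence = ≅-isEquivalence ; ∙-cong = +-cong }
              ; assoc = λ x y z → pointwise λ n → ℚ.+-assoc (seq x n) (seq y n) (seq z n) }
            ; identity = +-identityˡ , +-identityʳ }
          ; comm = λ x y → pointwise λ n → ℚ.+-comm (seq x n) (seq y n) }
        ; *-cong = *-cong
        ; *-assoc = λ x y z → pointwise λ n → ℚ.*-assoc (seq x n) (seq y n) (seq z n)
        ; *-identity = *-identityˡ , *-identityʳ
        ; distrib = (λ x y z → pointwise λ n → ℚ.*-distribˡ-+ (seq x n) (seq y n) (seq z n))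
                  , (λ x y z → pointwise λ n → ℚ.*-distribʳ-+ (seq x n) (seq y n) (seq z n)) }
      ; zero = *-zeroˡ , *-zeroʳ }
    ; *-comm = *-comm }

-- Order on the reals

-- Take a tail on which |x - y| varies by less than ε/4 and compare its rational value at N with
-- ε/2. A smaller value keeps the whole tail below ε; otherwise the tail stays above ε/4, and x and
-- y are apart.
≅-stable : ∀ x y → ¬ (0ℝ < ∣ x - y ∣) → x ≅ y
≅-stable x y ¬apart = ≈⇒≅ close
  where
  close : ∀ ε → 0ℚ ℚ.< ε → Eventually λ n → ℚ.∣ seq x n ℚ.- seq y n ∣ ℚ.< ε
  close ε 0<ε = decide (cauchy ∣ x - y ∣ (½ ℚ.* δ) (half-pos 0<δ))
    where
    δ : ℚ
    δ = ½ ℚ.* ε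
    0<δ : 0ℚ ℚ.< δ
    0<δ = half-pos 0<ε
    z : ℕ → ℚ
    z n = ℚ.∣ seq x n ℚ.- seq y n ∣
    ½δ<δ : ½ ℚ.* δ ℚ.< δ
    ½δ<δ = subst₂ ℚ._<_ (ℚ.+-identityʳ _) (half+half δ) (ℚ.+-monoʳ-< (½ ℚ.* δ) (half-pos 0<δ))
    decide : (∃ λ N → ∀ m n → N ℕ.≤ m → N ℕ.≤ n → ℚ.∣ z m ℚ.- z n ∣ ℚ.< ½ ℚ.* δ) →
             Eventually λ n → z n ℚ.< ε
    decide (N , near) with z N ℚ.<? δ
    ... | yes zN<δ = N , λ n N≤n →
      subst₂ ℚ._<_ (sym (sub-add (z n) (z N))) (half+half ε)
        (ℚ.+-mono-< (ℚ.<-trans (ℚ.≤-<-trans (p≤∣p∣ _) (near n N N≤n ℕ.≤-refl)) ½δ<δ) zN<δ)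
    ... | no zN≮δ = ⊥-elim (¬apart (½ ℚ.* δ , half-pos 0<δ , N , λ n N≤n →
      <-shift (solve-lem (z N) (z n) δ)
        (ℚ.+-mono-<-≤ (ℚ.≤-<-trans (p≤∣p∣ _) (near N n ℕ.≤-refl N≤n)) (ℚ.≮⇒≥ zN≮δ))))
      where
      open +-*-Solver
      solve-lem : ∀ a b d → ((½ ℚ.* d) ℚ.+ a) ℚ.- ((a ℚ.- b) ℚ.+ d) ≡ b ℚ.- (0ℚ ℚ.+ ½ ℚ.* d)
      solve-lem = solve 3 (λ a b d → ((con ½ :* d) :+ a) :- ((a :- b) :+ d) := b :- (con 0ℚ :+ con ½ :* d)) refl

0<-resp-≅ : ∀ {x y} → x ≅ y → 0ℝ < x → 0ℝ < y
0<-resp-≅ {x} {y} x≅y (ε , 0<ε , ε<x) = ½ ℚ.* ε , half-pos 0<ε ,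
  Eventually-map (λ n (p , q) → <-shift (lem (seq x n) (seq y n) ε) (ℚ.+-mono-< p (ℚ.≤-<-trans (p≤∣p∣ _) q)))
    (Eventually-× ε<x (≅⇒≈ x≅y _ (half-pos 0<ε)))
  where
  open +-*-Solver
  lem : ∀ a b d → (a ℚ.+ ½ ℚ.* d) ℚ.- ((0ℚ ℚ.+ d) ℚ.+ (a ℚ.- b)) ≡ b ℚ.- (0ℚ ℚ.+ ½ ℚ.* d) 
  lem = solve 3 (λ a b d → (a :+ con ½ :* d) :- ((con 0ℚ :+ d) :+ (a :- b)) := b :- (con 0ℚ :+ con ½ :* d)) refl

0≮0 : ¬ (0ℝ < 0ℝ)
0≮0 (ε , 0<ε , N , lt) = ℚ.<-asym 0<ε (subst (ℚ._< 0ℚ) (ℚ.+-identityˡ ε) (lt N ℕ.≤-refl))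

-- An equational substitute for 0ℝ ≤ x, which is a negation. Closure under sums and products becomes
-- a matter of congruence.
NonNeg : ℝ → Set
NonNeg x = ∣ x ∣ ≅ x

-- By stability it is enough to refute that | |x| - x | exceeds some ε. At a negative rational a
-- this distance is -2a, so x would lie below -ε/2.
0≤⇒nonNeg : ∀ {x} → 0ℝ ≤ x → NonNeg x
0≤⇒nonNeg {x} 0≤x = ≅-stable ∣ x ∣ x λ (ε , 0<ε , ev) → 0≤x (½ ℚ.* ε , half-pos 0<ε ,
  Eventually-map (λ n → negative ε 0<ε (seq x n)) ev)
  where
  open +-*-Solver
  negative : ∀ ε → 0ℚ ℚ.< ε → ∀ a → 0ℚ ℚ.+ ε ℚ.< ℚ.∣ ℚ.∣ a ∣ ℚ.- a ∣ → a ℚ.+ ½ ℚ.* ε ℚ.< 0ℚ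
  negative ε 0<ε a lt with ℚ.≤-total 0ℚ a
  ... | inj₁ 0≤a = ⊥-elim (ℚ.<-asym 0<ε (subst₂ ℚ._<_ (ℚ.+-identityˡ ε)
          (cong ℚ.∣_∣ (trans (cong (ℚ._- a) (ℚ.0≤p⇒∣p∣≡p 0≤a)) (ℚ.+-inverseʳ a))) lt))
  ... | inj₂ a≤0 = ≤.begin-strict
          a ℚ.+ ½ ℚ.* ε ≤.≡⟨ solve 2 (λ a e → a :+ con ½ :* e := con ½ :* (e :+ (a :+ a))) refl a ε ⟩
          ½ ℚ.* (ε ℚ.+ (a ℚ.+ a)) ≤.<⟨ ℚ.*-monoʳ-<-pos ½ {ε ℚ.+ (a ℚ.+ a)} {0ℚ} (<-shift (lem ε a) lt′) ⟩
          ½ ℚ.* 0ℚ ≤.≡⟨⟩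
          0ℚ ≤.∎
    where
    module ≤ = ℚ.≤-Reasoning
    b = ℚ.- a ℚ.- a
    lt′ : 0ℚ ℚ.+ ε ℚ.< b
    lt′ = subst (0ℚ ℚ.+ ε ℚ.<_) (trans (cong (λ z → ℚ.∣ z ℚ.- a ∣) (p≤0⇒∣p∣≡-p a≤0))
           (ℚ.0≤p⇒∣p∣≡p (ℚ.+-mono-≤ (ℚ.neg-antimono-≤ a≤0) (ℚ.neg-antimono-≤ a≤0)))) lt
    lem : ∀ e a → (ℚ.- a ℚ.- a) ℚ.- (0ℚ ℚ.+ e) ≡ 0ℚ ℚ.- (e ℚ.+ (a ℚ.+ a))
    lem = solve 2 (λ e a → (:- a :- a) :- (con 0ℚ :+ e) := con 0ℚ :- (e :+ (a :+ a))) refl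

nonNeg⇒0≤ : ∀ {x} → NonNeg x → 0ℝ ≤ x
nonNeg⇒0≤ {x} ∣x∣≅x (ε , 0<ε , ev) =
  let n , x+ε<0 , close = Eventually-∃ (Eventually-× ev (≅⇒≈ ∣x∣≅x ε 0<ε))
  in absurd (seq x n) x+ε<0 close
  where
  open +-*-Solver
  absurd : ∀ a → a ℚ.+ ε ℚ.< 0ℚ → ℚ.∣ ℚ.∣ a ∣ ℚ.- a ∣ ℚ.< ε → ⊥
  absurd a a+ε<0 close = ℚ.<-asym a<0 (<-shift (lem a ε)
      (ℚ.+-mono-≤-< (-p≤∣p∣ a) (ℚ.+-mono-< a+ε<0 (ℚ.≤-<-trans (p≤∣p∣ _) close))))
    where
    a<0 : a ℚ.< 0ℚ
    a<0 = ℚ.<-trans (subst (ℚ._< a ℚ.+ ε) (ℚ.+-identityʳ a) (ℚ.+-monoʳ-< a 0<ε)) a+ε<0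
    lem : ∀ a e → (ℚ.∣ a ∣ ℚ.+ (0ℚ ℚ.+ e)) ℚ.- (ℚ.- a ℚ.+ ((a ℚ.+ e) ℚ.+ (ℚ.∣ a ∣ ℚ.- a))) ≡ a ℚ.- 0ℚ
    lem a e = solve 3 (λ a e m → (m :+ (con 0ℚ :+ e)) :- (:- a :+ ((a :+ e) :+ (m :- a))) := a :- con 0ℚ) refl a e ℚ.∣ a ∣

nonNeg-resp-≅ : ∀ {x y} → x ≅ y → NonNeg x → NonNeg y
nonNeg-resp-≅ x≅y p = ≅-trans (abs-cong (≅-sym x≅y)) (≅-trans p x≅y)

nonNeg-pointwise : ∀ {x} → (∀ n → 0ℚ ℚ.≤ seq x n) → NonNeg x
nonNeg-pointwise 0≤x = pointwise λ n → ℚ.0≤p⇒∣p∣≡p (0≤x n)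

nonNeg-+ : ∀ {x y} → NonNeg x → NonNeg y → NonNeg (x + y)
nonNeg-+ {x} {y} p q = nonNeg-resp-≅ {∣ x ∣ + ∣ y ∣} (+-cong p q)
  (nonNeg-pointwise λ n → ℚ.+-mono-≤ (ℚ.0≤∣p∣ (seq x n)) (ℚ.0≤∣p∣ (seq y n)))

nonNeg-* : ∀ {x y} → NonNeg x → NonNeg y → NonNeg (x * y)
nonNeg-* {x} {y} p q = ≅-trans {∣ x * y ∣} {∣ x ∣ * ∣ y ∣}
  (pointwise λ n → ℚ.∣p*q∣≡∣p∣*∣q∣ (seq x n) (seq y n)) (*-cong {∣ x ∣} {x} {∣ y ∣} {y} p q)

0<-* : ∀ {x y} → 0ℝ < x → 0ℝ < y → 0ℝ < x * y
0<-* {x} {y} (ε , 0<ε , ε<x) (δ , 0<δ , δ<y) =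
  ε ℚ.* δ , ℚ.positive⁻¹ (ε ℚ.* δ) {{ℚ.pos*pos⇒pos ε {{ℚ.positive 0<ε}} δ {{ℚ.positive 0<δ}}}} ,
  Eventually-map (λ n (p , q) → bound (seq x n) (seq y n) p q) (Eventually-× ε<x δ<y)
  where
  bound : ∀ a b → 0ℚ ℚ.+ ε ℚ.< a → 0ℚ ℚ.+ δ ℚ.< b → 0ℚ ℚ.+ ε ℚ.* δ ℚ.< a ℚ.* b
  bound a b p q = ≤.begin-strict
    0ℚ ℚ.+ ε ℚ.* δ ≤.≡⟨ ℚ.+-identityˡ _ ⟩
    ε ℚ.* δ ≤.<⟨ ℚ.*-monoʳ-<-pos ε {{ℚ.positive 0<ε}} δ<b ⟩
    ε ℚ.* b ≤.<⟨ ℚ.*-monoˡ-<-pos b {{ℚ.positive (ℚ.<-trans 0<δ δ<b)}} ε<a ⟩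
    a ℚ.* b ≤.∎
    where
    module ≤ = ℚ.≤-Reasoning
    ε<a = subst (ℚ._< a) (ℚ.+-identityˡ ε) p
    δ<b = subst (ℚ._< b) (ℚ.+-identityˡ δ) q

-- If |y| < B, then x * y > ε forces |x| ≥ ε/B. Half of this is the strict lower bound, and `NonNeg`
-- replaces |x| by x.
0<-*⁻ˡ : ∀ {x y} → NonNeg x → 0ℝ < x * y → 0ℝ < x
0<-*⁻ˡ {x} {y} ∣x∣≅x (ε , 0<ε , ε<xy) =
  let B , 0<B , y<B = tail-bound (seq y) (cauchy y)
      δ = Scale.δ B ε 0<B 0<ε
      0<δ = Scale.δ-pos B ε 0<B 0<ε
  in 0<-resp-≅ ∣x∣≅x (½ ℚ.* δ , half-pos 0<δ ,
    Eventually-map (λ n (p , q) → bound B 0<B (seq x n) (seq y n) p q) (Eventually-× ε<xy y<B))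
  where
  bound : ∀ B (0<B : 0ℚ ℚ.< B) a b → 0ℚ ℚ.+ ε ℚ.< a ℚ.* b → ℚ.∣ b ∣ ℚ.< B →
    0ℚ ℚ.+ ½ ℚ.* Scale.δ B ε 0<B 0<ε ℚ.< ℚ.∣ a ∣
  bound B 0<B a b ε<ab b<B = ℚ.<-≤-trans
    (subst₂ ℚ._<_ (trans (ℚ.+-identityʳ (½ ℚ.* δ)) (sym (ℚ.+-identityˡ (½ ℚ.* δ)))) (half+half δ)
      (ℚ.+-monoʳ-< (½ ℚ.* δ) (half-pos 0<δ)))
    (ℚ.≮⇒≥ λ a<δ → ℚ.<-asym (subst (ℚ._< a ℚ.* b) (ℚ.+-identityˡ ε) ε<ab)
      (ℚ.≤-<-trans (p≤∣p∣ _) (subst (λ z → ℚ.∣ z ∣ ℚ.< ε) (ℚ.*-comm b a) (Scale.small B ε 0<B 0<ε b a b<B a<δ))))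
    where
    δ = Scale.δ B ε 0<B 0<ε
    0<δ = Scale.δ-pos B ε 0<B 0<ε

-- This is where the face condition becomes an equation. By stability it suffices to refute that the
-- product is positive, and a positive product would make both factors positive.
nonNeg-disjoint⇒*≅0 : ∀ {x y} → NonNeg x → NonNeg y → ¬ (0ℝ < x × 0ℝ < y) → x * y ≅ 0ℝ
nonNeg-disjoint⇒*≅0 {x} {y} p q disjoint = ≅-stable (x * y) 0ℝ λ pos →
  let 0<xy = 0<-resp-≅ (≅-trans (abs-cong (pointwise {x * y - 0ℝ} {x * y} λ n → ℚ.+-identityʳ (seq x n ℚ.* seq y n))) (nonNeg-* p q)) pos
  in disjoint (0<-*⁻ˡ {x} {y} p 0<xy , 0<-*⁻ˡ {y} {x} q (0<-resp-≅ {x * y} {y * x} (*-comm x y) 0<xy))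

*≅0⇒disjoint : ∀ {x y} → x * y ≅ 0ℝ → ¬ (0ℝ < x × 0ℝ < y)
*≅0⇒disjoint {x} {y} xy≅0 (0<x , 0<y) = 0≮0 (0<-resp-≅ {x * y} {0ℝ} xy≅0 (0<-* {x} {y} 0<x 0<y))

-- Positive part, negative part and clamping

positivePart negativePart : ℝ → ℝ
positivePart x = fromℚ ½ * (∣ x ∣ + x)
negativePart x = fromℚ ½ * (∣ x ∣ - x)

positivePart-cong : ∀ {x y} → x ≅ y → positivePart x ≅ positivePart y
positivePart-cong {x} {y} p =
  *-cong {fromℚ ½} {fromℚ ½} {∣ x ∣ + x} {∣ y ∣ + y} ≅-refl (+-cong {∣ x ∣} {∣ y ∣} {x} {y} (abs-cong p) p)

negativePart-cong : ∀ {x y} → x ≅ y → negativePart x ≅ negativePart y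
negativePart-cong {x} {y} p =
  *-cong {fromℚ ½} {fromℚ ½} {∣ x ∣ - x} {∣ y ∣ - y} ≅-refl (minus-cong {∣ x ∣} {∣ y ∣} {x} {y} (abs-cong p) p)

0≤½*[∣a∣+a] : ∀ a → 0ℚ ℚ.≤ ½ ℚ.* (ℚ.∣ a ∣ ℚ.+ a)
0≤½*[∣a∣+a] a = ℚ.*-monoˡ-≤-nonNeg ½ {0ℚ} {ℚ.∣ a ∣ ℚ.+ a} (≤-shift (lem ℚ.∣ a ∣ a) (-p≤∣p∣ a))
  where
  open +-*-Solver
  lem : ∀ m a → m ℚ.- (ℚ.- a) ≡ (m ℚ.+ a) ℚ.- 0ℚ
  lem = solve 2 (λ m a → m :- (:- a) := (m :+ a) :- con 0ℚ) refl

positivePart-nonNeg : ∀ x → NonNeg (positivePart x)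
positivePart-nonNeg x = nonNeg-pointwise λ n → 0≤½*[∣a∣+a] (seq x n)

negativePart-nonNeg : ∀ x → NonNeg (negativePart x)
negativePart-nonNeg x = nonNeg-pointwise λ n →
  subst (λ m → 0ℚ ℚ.≤ ½ ℚ.* (m ℚ.- seq x n)) (ℚ.∣-p∣≡∣p∣ (seq x n)) (0≤½*[∣a∣+a] (ℚ.- seq x n))

∣a∣*∣a∣≡a*a : ∀ a → ℚ.∣ a ∣ ℚ.* ℚ.∣ a ∣ ≡ a ℚ.* a
∣a∣*∣a∣≡a*a a with ℚ.∣p∣≡p∨∣p∣≡-p a
... | inj₁ eq = cong₂ ℚ._*_ eq eq
... | inj₂ eq = trans (cong₂ ℚ._*_ eq eq) (solve 1 (λ a → (:- a) :* (:- a) := a :* a) refl a)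
  where open +-*-Solver

positivePart*negativePart : ∀ x → positivePart x * negativePart x ≅ 0ℝ
positivePart*negativePart x = pointwise λ n → trans (lem ℚ.∣ seq x n ∣ (seq x n))
  (trans (cong (λ s → (½ ℚ.* ½) ℚ.* (s ℚ.- seq x n ℚ.* seq x n)) (∣a∣*∣a∣≡a*a (seq x n)))
         (trans (cong ((½ ℚ.* ½) ℚ.*_) (ℚ.+-inverseʳ (seq x n ℚ.* seq x n))) (ℚ.*-zeroʳ (½ ℚ.* ½))))
  where
  open +-*-Solver
  lem : ∀ m a → (½ ℚ.* (m ℚ.+ a)) ℚ.* (½ ℚ.* (m ℚ.- a)) ≡ (½ ℚ.* ½) ℚ.* (m ℚ.* m ℚ.- a ℚ.* a)
  lem = solve 2 (λ m a → (con ½ :* (m :+ a)) :* (con ½ :* (m :- a)) := (con ½ :* con ½) :* (m :* m :- a :* a)) refl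

positivePart+negativePart : ∀ x → positivePart x + negativePart x ≅ ∣ x ∣
positivePart+negativePart x = pointwise λ n → lem ℚ.∣ seq x n ∣ (seq x n)
  where
  open +-*-Solver
  lem : ∀ m a → ½ ℚ.* (m ℚ.+ a) ℚ.+ ½ ℚ.* (m ℚ.- a) ≡ m
  lem = solve 2 (λ m a → con ½ :* (m :+ a) :+ con ½ :* (m :- a) := m) refl

positivePart-negativePart : ∀ x → positivePart x - negativePart x ≅ x
positivePart-negativePart x = pointwise λ n → lem ℚ.∣ seq x n ∣ (seq x n)
  where
  open +-*-Solver
  lem : ∀ m a → ½ ℚ.* (m ℚ.+ a) ℚ.- ½ ℚ.* (m ℚ.- a) ≡ a
  lem = solve 2 (λ m a → con ½ :* (m :+ a) :- con ½ :* (m :- a) := a) refl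

-- The truncation min (max a 0) 1, expressed through absolute values so that the same formula makes
-- sense for reals and inherits the continuity of `∣_∣`.
clampℚ : ℚ → ℚ
clampℚ a = ½ ℚ.* ((ℚ.∣ a ∣ ℚ.- ℚ.∣ a ℚ.- 1ℚ ∣) ℚ.+ 1ℚ)

clamp : ℝ → ℝ
clamp x = fromℚ ½ * ((∣ x ∣ - ∣ x - 1ℝ ∣) + 1ℝ)

a≤b⇒a-b≤0 : ∀ {a b} → a ℚ.≤ b → a ℚ.- b ℚ.≤ 0ℚ
a≤b⇒a-b≤0 {a} {b} = ≤-shift (solve 2 (λ a b → b :- a := con 0ℚ :- (a :- b)) refl a b)
  where open +-*-Solver

a≤b⇒0≤b-a : ∀ {a b} → a ℚ.≤ b → 0ℚ ℚ.≤ b ℚ.- a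
a≤b⇒0≤b-a {a} {b} = ≤-shift (solve 2 (λ a b → b :- a := (b :- a) :- con 0ℚ) refl a b)
  where open +-*-Solver

clampℚ-≤0 : ∀ {a} → a ℚ.≤ 0ℚ → clampℚ a ≡ 0ℚ
clampℚ-≤0 {a} a≤0 = trans
  (cong₂ (λ p q → ½ ℚ.* ((p ℚ.- q) ℚ.+ 1ℚ)) (p≤0⇒∣p∣≡-p a≤0)
    (p≤0⇒∣p∣≡-p (a≤b⇒a-b≤0 (ℚ.≤-trans a≤0 (ℚ.nonNegative⁻¹ 1ℚ)))))
  (solve 1 (λ a → con ½ :* ((:- a :- (:- (a :- con 1ℚ))) :+ con 1ℚ) := con 0ℚ) refl a)
  where open +-*-Solver

clampℚ-≥1 : ∀ {a} → 1ℚ ℚ.≤ a → clampℚ a ≡ 1ℚ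
clampℚ-≥1 {a} 1≤a = trans
  (cong₂ (λ p q → ½ ℚ.* ((p ℚ.- q) ℚ.+ 1ℚ)) (ℚ.0≤p⇒∣p∣≡p (ℚ.≤-trans (ℚ.nonNegative⁻¹ 1ℚ) 1≤a))
    (ℚ.0≤p⇒∣p∣≡p (a≤b⇒0≤b-a 1≤a)))
  (solve 1 (λ a → con ½ :* ((a :- (a :- con 1ℚ)) :+ con 1ℚ) := con 1ℚ) refl a)
  where open +-*-Solver

clampℚ-unit : ∀ {a} → 0ℚ ℚ.≤ a → a ℚ.≤ 1ℚ → clampℚ a ≡ a
clampℚ-unit {a} 0≤a a≤1 = trans
  (cong₂ (λ p q → ½ ℚ.* ((p ℚ.- q) ℚ.+ 1ℚ)) (ℚ.0≤p⇒∣p∣≡p 0≤a) (p≤0⇒∣p∣≡-p (a≤b⇒a-b≤0 a≤1)))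
  (solve 1 (λ a → con ½ :* ((a :- (:- (a :- con 1ℚ))) :+ con 1ℚ) := a) refl a)
  where open +-*-Solver

clampℚ-range : ∀ a → 0ℚ ℚ.≤ clampℚ a × clampℚ a ℚ.≤ 1ℚ
clampℚ-range a with ℚ.≤-total a 0ℚ | ℚ.≤-total a 1ℚ
... | inj₁ a≤0 | _        = subst (λ c → 0ℚ ℚ.≤ c × c ℚ.≤ 1ℚ) (sym (clampℚ-≤0 a≤0)) (ℚ.≤-refl , ℚ.nonNegative⁻¹ 1ℚ)
... | inj₂ 0≤a | inj₁ a≤1 = subst (λ c → 0ℚ ℚ.≤ c × c ℚ.≤ 1ℚ) (sym (clampℚ-unit 0≤a a≤1)) (0≤a , a≤1)
... | inj₂ 0≤a | inj₂ 1≤a = subst (λ c → 0ℚ ℚ.≤ c × c ℚ.≤ 1ℚ) (sym (clampℚ-≥1 1≤a)) (ℚ.nonNegative⁻¹ 1ℚ , ℚ.≤-refl)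

-- Either b ≤ 0 and the second factor vanishes, or a ≥ 1 and the first one does. Successive moves
-- are separated in time by this product.
[1-clampℚ]*clampℚ : ∀ a b → b ℚ.+ 1ℚ ℚ.≤ a → (1ℚ ℚ.- clampℚ a) ℚ.* clampℚ b ≡ 0ℚ
[1-clampℚ]*clampℚ a b b+1≤a with ℚ.≤-total b 0ℚ
... | inj₁ b≤0 = trans (cong ((1ℚ ℚ.- clampℚ a) ℚ.*_) (clampℚ-≤0 b≤0)) (ℚ.*-zeroʳ (1ℚ ℚ.- clampℚ a))
... | inj₂ 0≤b = trans (cong (λ c → (1ℚ ℚ.- c) ℚ.* clampℚ b)
    (clampℚ-≥1 (ℚ.≤-trans (subst (ℚ._≤ b ℚ.+ 1ℚ) (ℚ.+-identityˡ 1ℚ) (ℚ.+-monoˡ-≤ 1ℚ 0≤b)) b+1≤a)))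
  (ℚ.*-zeroˡ (clampℚ b))

clamp-nonNeg : ∀ x → NonNeg (clamp x)
clamp-nonNeg x = nonNeg-pointwise λ n → proj₁ (clampℚ-range (seq x n))

0≤1-clampℚ : ∀ a → 0ℚ ℚ.≤ 1ℚ ℚ.- clampℚ a
0≤1-clampℚ a = a≤b⇒0≤b-a {clampℚ a} {1ℚ} (proj₂ (clampℚ-range a))

1-clamp-nonNeg : ∀ x → NonNeg (1ℝ - clamp x)
1-clamp-nonNeg x = nonNeg-pointwise {1ℝ - clamp x} λ n → 0≤1-clampℚ (seq x n)

clamp-≥1 : ∀ x → (∀ n → 1ℚ ℚ.≤ seq x n) → clamp x ≅ 1ℝ
clamp-≥1 x 1≤x = pointwise {clamp x} {1ℝ} λ n → clampℚ-≥1 {seq x n} (1≤x n)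

clamp-≤0 : ∀ x → (∀ n → seq x n ℚ.≤ 0ℚ) → clamp x ≅ 0ℝ
clamp-≤0 x x≤0 = pointwise {clamp x} {0ℝ} λ n → clampℚ-≤0 {seq x n} (x≤0 n)

[1-clamp]*clamp : ∀ x y → (∀ n → seq y n ℚ.+ 1ℚ ℚ.≤ seq x n) → (1ℝ - clamp x) * clamp y ≅ 0ℝ
[1-clamp]*clamp x y y+1≤x = pointwise {(1ℝ - clamp x) * clamp y} {0ℝ} λ n →
  [1-clampℚ]*clampℚ (seq x n) (seq y n) (y+1≤x n)

-- Approximate square roots of rationals

-- Unlike the square, a |a| is strictly increasing, so its inverse is a root defined for all
-- arguments, with no sign to be decided.
signedSquareℚ : ℚ → ℚ
signedSquareℚ a = a ℚ.* ℚ.∣ a ∣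

signedSquare : ℝ → ℝ
signedSquare x = x * ∣ x ∣

0≤a*a : ∀ a → 0ℚ ℚ.≤ a ℚ.* a
0≤a*a a = subst (0ℚ ℚ.≤_) (∣a∣*∣a∣≡a*a a)
  (ℚ.nonNegative⁻¹ _ {{ℚ.nonNeg*nonNeg⇒nonNeg ℚ.∣ a ∣ {{ℚ.∣-∣-nonNeg a}} ℚ.∣ a ∣ {{ℚ.∣-∣-nonNeg a}}}})

0≤p*q : ∀ {p q} → 0ℚ ℚ.≤ p → 0ℚ ℚ.≤ q → 0ℚ ℚ.≤ p ℚ.* q
0≤p*q {p} {q} 0≤p 0≤q = ℚ.nonNegative⁻¹ (p ℚ.* q)
  {{ℚ.nonNeg*nonNeg⇒nonNeg p {{ℚ.nonNegative 0≤p}} q {{ℚ.nonNegative 0≤q}}}}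

-- (w|w| − z|z|)(w − z) exceeds half of (w − z)²(|w| + |z|) by half of
-- (|w| − |z|)²(|w| + |z|).
signedSquareℚ-expands : ∀ w z →
  (w ℚ.- z) ℚ.* (w ℚ.- z) ℚ.* (ℚ.∣ w ∣ ℚ.+ ℚ.∣ z ∣) ℚ.≤
  (signedSquareℚ w ℚ.- signedSquareℚ z) ℚ.* (w ℚ.- z) ℚ.+ (signedSquareℚ w ℚ.- signedSquareℚ z) ℚ.* (w ℚ.- z)
signedSquareℚ-expands w z = ≤-shift {0ℚ} {(a ℚ.- b) ℚ.* (a ℚ.- b) ℚ.* (a ℚ.+ b)} eq
  (0≤p*q (0≤a*a (a ℚ.- b)) (ℚ.+-mono-≤ (ℚ.0≤∣p∣ w) (ℚ.0≤∣p∣ z)))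
  where
  open +-*-Solver
  a b : ℚ
  a = ℚ.∣ w ∣
  b = ℚ.∣ z ∣
  eq₁ : ∀ a b → (a ℚ.- b) ℚ.* (a ℚ.- b) ℚ.* (a ℚ.+ b) ℚ.- 0ℚ ≡ (a ℚ.- b) ℚ.* (a ℚ.* a ℚ.- b ℚ.* b)
  eq₁ = solve 2 (λ a b → (a :- b) :* (a :- b) :* (a :+ b) :- con 0ℚ := (a :- b) :* (a :* a :- b :* b)) refl
  eq₂ : ∀ w z a b → (a ℚ.- b) ℚ.* (w ℚ.* w ℚ.- z ℚ.* z) ≡
    ((w ℚ.* a ℚ.- z ℚ.* b) ℚ.* (w ℚ.- z) ℚ.+ (w ℚ.* a ℚ.- z ℚ.* b) ℚ.* (w ℚ.- z)) ℚ.-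
    (w ℚ.- z) ℚ.* (w ℚ.- z) ℚ.* (a ℚ.+ b)
  eq₂ = solve 4 (λ w z a b → (a :- b) :* (w :* w :- z :* z) :=
    ((w :* a :- z :* b) :* (w :- z) :+ (w :* a :- z :* b) :* (w :- z)) :-
    (w :- z) :* (w :- z) :* (a :+ b)) refl
  eq = trans (eq₁ a b) (trans (cong₂ (λ p q → (a ℚ.- b) ℚ.* (p ℚ.- q)) (∣a∣*∣a∣≡a*a w) (∣a∣*∣a∣≡a*a z)) (eq₂ w z a b))

-- Let D be the distance of w and z, and S that of their signed squares. As D ≤ |w| + |z|, the
-- previous inequality gives D³ ≤ 2SD, so D ≥ ε would yield ε² ≤ D² ≤ 2S < ε². The bound does not
-- depend on the size of w and z, nor on their distance from 0; injectivity, convergence and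
-- continuity of the root all rest on it.
signedSquareℚ-modulus : ∀ {ε} → 0ℚ ℚ.< ε → ∀ w z →
  ℚ.∣ signedSquareℚ w ℚ.- signedSquareℚ z ∣ ℚ.< ½ ℚ.* (ε ℚ.* ε) → ℚ.∣ w ℚ.- z ∣ ℚ.< ε
signedSquareℚ-modulus {ε} 0<ε w z close = decide (ℚ.∣ w ℚ.- z ∣ ℚ.<? ε)
  where
  D S : ℚ
  D = ℚ.∣ w ℚ.- z ∣
  S = ℚ.∣ signedSquareℚ w ℚ.- signedSquareℚ z ∣
  module ≤ = ℚ.≤-Reasoning
  S*D : (signedSquareℚ w ℚ.- signedSquareℚ z) ℚ.* (w ℚ.- z) ℚ.≤ S ℚ.* D
  S*D = subst ((signedSquareℚ w ℚ.- signedSquareℚ z) ℚ.* (w ℚ.- z) ℚ.≤_) (ℚ.∣p*q∣≡∣p∣*∣q∣ (signedSquareℚ w ℚ.- signedSquareℚ z) (w ℚ.- z)) (p≤∣p∣ _)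
  D³≤2SD : (D ℚ.* D) ℚ.* D ℚ.≤ (S ℚ.+ S) ℚ.* D
  D³≤2SD = ≤.begin
    (D ℚ.* D) ℚ.* D ≤.≡⟨ cong (ℚ._* D) (∣a∣*∣a∣≡a*a (w ℚ.- z)) ⟩
    ((w ℚ.- z) ℚ.* (w ℚ.- z)) ℚ.* D ≤.≤⟨ ℚ.*-monoˡ-≤-nonNeg ((w ℚ.- z) ℚ.* (w ℚ.- z)) {{ℚ.nonNegative (0≤a*a (w ℚ.- z))}} (ℚ.∣p-q∣≤∣p∣+∣q∣ w z) ⟩
    ((w ℚ.- z) ℚ.* (w ℚ.- z)) ℚ.* (ℚ.∣ w ∣ ℚ.+ ℚ.∣ z ∣) ≤.≤⟨ signedSquareℚ-expands w z ⟩
    (signedSquareℚ w ℚ.- signedSquareℚ z) ℚ.* (w ℚ.- z) ℚ.+ (signedSquareℚ w ℚ.- signedSquareℚ z) ℚ.* (w ℚ.- z) ≤.≤⟨ ℚ.+-mono-≤ S*D S*D ⟩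
    S ℚ.* D ℚ.+ S ℚ.* D ≤.≡⟨ sym (ℚ.*-distribʳ-+ D S S) ⟩
    (S ℚ.+ S) ℚ.* D ≤.∎
  decide : Dec (D ℚ.< ε) → D ℚ.< ε
  decide (yes D<ε) = D<ε
  decide (no D≮ε) = ⊥-elim (ℚ.<-irrefl refl (≤.begin-strict
    ε ℚ.* ε ≤.≤⟨ ℚ.*-monoˡ-≤-nonNeg ε {{ℚ.nonNegative (ℚ.<⇒≤ 0<ε)}} ε≤D ⟩
    ε ℚ.* D ≤.≤⟨ ℚ.*-monoʳ-≤-nonNeg D {{ℚ.∣-∣-nonNeg (w ℚ.- z)}} ε≤D ⟩
    D ℚ.* D ≤.≤⟨ ℚ.*-cancelʳ-≤-pos D {{ℚ.positive (ℚ.<-≤-trans 0<ε ε≤D)}} D³≤2SD ⟩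
    S ℚ.+ S ≤.<⟨ ℚ.+-mono-< close close ⟩
    ½ ℚ.* (ε ℚ.* ε) ℚ.+ ½ ℚ.* (ε ℚ.* ε) ≤.≡⟨ half+half (ε ℚ.* ε) ⟩
    ε ℚ.* ε ≤.∎))
    where
    ε≤D : ε ℚ.≤ D
    ε≤D = ℚ.≮⇒≥ D≮ε

signedSquareℚ-lipschitz : ∀ w z → ℚ.∣ signedSquareℚ w ℚ.- signedSquareℚ z ∣ ℚ.≤ ℚ.∣ w ℚ.- z ∣ ℚ.* (ℚ.∣ w ∣ ℚ.+ ℚ.∣ z ∣)
signedSquareℚ-lipschitz w z = ≤.begin
  ℚ.∣ signedSquareℚ w ℚ.- signedSquareℚ z ∣ ≤.≡⟨ cong ℚ.∣_∣ (eq w z ℚ.∣ w ∣ ℚ.∣ z ∣) ⟩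
  ℚ.∣ w ℚ.* (ℚ.∣ w ∣ ℚ.- ℚ.∣ z ∣) ℚ.+ (w ℚ.- z) ℚ.* ℚ.∣ z ∣ ∣ ≤.≤⟨ ℚ.∣p+q∣≤∣p∣+∣q∣ (w ℚ.* (ℚ.∣ w ∣ ℚ.- ℚ.∣ z ∣)) ((w ℚ.- z) ℚ.* ℚ.∣ z ∣) ⟩
  ℚ.∣ w ℚ.* (ℚ.∣ w ∣ ℚ.- ℚ.∣ z ∣) ∣ ℚ.+ ℚ.∣ (w ℚ.- z) ℚ.* ℚ.∣ z ∣ ∣ ≤.≡⟨ cong₂ ℚ._+_ (ℚ.∣p*q∣≡∣p∣*∣q∣ w (ℚ.∣ w ∣ ℚ.- ℚ.∣ z ∣))
      (trans (ℚ.∣p*q∣≡∣p∣*∣q∣ (w ℚ.- z) ℚ.∣ z ∣) (cong (D ℚ.*_) (ℚ.∣∣p∣∣≡∣p∣ z))) ⟩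
  ℚ.∣ w ∣ ℚ.* ℚ.∣ ℚ.∣ w ∣ ℚ.- ℚ.∣ z ∣ ∣ ℚ.+ D ℚ.* ℚ.∣ z ∣ ≤.≤⟨ ℚ.+-monoˡ-≤ (D ℚ.* ℚ.∣ z ∣)
      (ℚ.*-monoˡ-≤-nonNeg ℚ.∣ w ∣ {{ℚ.∣-∣-nonNeg w}} (∣∣a∣-∣b∣∣≤∣a-b∣ w z)) ⟩
  ℚ.∣ w ∣ ℚ.* D ℚ.+ D ℚ.* ℚ.∣ z ∣ ≤.≡⟨ eq′ ℚ.∣ w ∣ D ℚ.∣ z ∣ ⟩
  D ℚ.* (ℚ.∣ w ∣ ℚ.+ ℚ.∣ z ∣) ≤.∎
  where
  open +-*-Solver
  module ≤ = ℚ.≤-Reasoning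
  D : ℚ
  D = ℚ.∣ w ℚ.- z ∣
  eq : ∀ w z a b → w ℚ.* a ℚ.- z ℚ.* b ≡ w ℚ.* (a ℚ.- b) ℚ.+ (w ℚ.- z) ℚ.* b
  eq = solve 4 (λ w z a b → w :* a :- z :* b := w :* (a :- b) :+ (w :- z) :* b) refl
  eq′ : ∀ a d b → a ℚ.* d ℚ.+ d ℚ.* b ≡ d ℚ.* (a ℚ.+ b)
  eq′ = solve 3 (λ a d b → a :* d :+ d :* b := d :* (a :+ b)) refl

signedSquare-injective : ∀ {x y} → signedSquare x ≅ signedSquare y → x ≅ y
signedSquare-injective {x} {y} eq = ≈⇒≅ λ ε 0<ε →
  Eventually-map (λ n → signedSquareℚ-modulus 0<ε (seq x n) (seq y n))
    (≅⇒≈ eq (½ ℚ.* (ε ℚ.* ε)) (half-pos (ℚ.positive⁻¹ (ε ℚ.* ε) {{ℚ.pos*pos⇒pos ε {{ℚ.positive 0<ε}} ε {{ℚ.positive 0<ε}}}})))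

-- Powers of one half and bisection

½^_ : ℕ → ℚ
½^ 0     = 1ℚ
½^ suc n = ½ ℚ.* ½^ n

0<½^ : ∀ n → 0ℚ ℚ.< ½^ n
0<½^ 0       = ℚ.positive⁻¹ 1ℚ
0<½^ (suc n) = half-pos (0<½^ n)

fromℕ : ℕ → ℚ
fromℕ 0       = 0ℚ
fromℕ (suc n) = 1ℚ ℚ.+ fromℕ n

0≤fromℕ : ∀ n → 0ℚ ℚ.≤ fromℕ n
0≤fromℕ 0       = ℚ.≤-refl
0≤fromℕ (suc n) = ℚ.+-mono-≤ (ℚ.nonNegative⁻¹ 1ℚ) (0≤fromℕ n)

fromℕ-mono-< : ∀ {m n} → m ℕ.< n → fromℕ m ℚ.+ 1ℚ ℚ.≤ fromℕ n
fromℕ-mono-< {0} {suc n} _ = ℚ.+-monoʳ-≤ 1ℚ (0≤fromℕ n)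
fromℕ-mono-< {suc m} {suc n} (ℕ.s≤s m<n) =
  subst (ℚ._≤ 1ℚ ℚ.+ fromℕ n) (sym (ℚ.+-assoc 1ℚ (fromℕ m) 1ℚ)) (ℚ.+-monoʳ-≤ 1ℚ (fromℕ-mono-< m<n))

½*p≤p : ∀ {p} → 0ℚ ℚ.≤ p → ½ ℚ.* p ℚ.≤ p
½*p≤p {p} 0≤p = subst (½ ℚ.* p ℚ.≤_) (ℚ.*-identityˡ p)
  (ℚ.*-monoʳ-≤-nonNeg p {{ℚ.nonNegative 0≤p}} {½} {1ℚ} (ℚ.<⇒≤ (ℚ.*<* (ℤ.+<+ ℕ.≤-refl))))

½^-antitone : ∀ {m n} → m ℕ.≤ n → ½^ n ℚ.≤ ½^ m
½^-antitone {m} m≤n = go (ℕ.≤⇒≤′ m≤n)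
  where
  go : ∀ {n} → m ℕ.≤′ n → ½^ n ℚ.≤ ½^ m
  go ℕ.≤′-refl = ℚ.≤-refl
  go (ℕ.≤′-step {n} m≤n) = ℚ.≤-trans (½*p≤p (ℚ.<⇒≤ (0<½^ n))) (go m≤n)

fromℕ*½^<1 : ∀ n → fromℕ n ℚ.* ½^ n ℚ.< 1ℚ
fromℕ*½^<1 0       = ℚ.*<* (ℤ.+<+ ℕ.≤-refl)
fromℕ*½^<1 (suc n) = begin-strict
  (1ℚ ℚ.+ fromℕ n) ℚ.* (½ ℚ.* ½^ n)   ≡⟨ eq (fromℕ n) (½^ n) ⟩
  ½ ℚ.* (fromℕ n ℚ.* ½^ n ℚ.+ ½^ n)   <⟨ ℚ.*-monoʳ-<-pos ½ {fromℕ n ℚ.* ½^ n ℚ.+ ½^ n} {1ℚ ℚ.+ 1ℚ}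
                                            (ℚ.+-mono-<-≤ (fromℕ*½^<1 n) (½^-antitone {0} {n} ℕ.z≤n)) ⟩
  ½ ℚ.* (1ℚ ℚ.+ 1ℚ)                   ≡⟨⟩
  1ℚ                                  ∎
  where
  open ℚ.≤-Reasoning
  open +-*-Solver
  eq : ∀ a b → (1ℚ ℚ.+ a) ℚ.* (½ ℚ.* b) ≡ ½ ℚ.* (a ℚ.* b ℚ.+ b)
  eq = solve 2 (λ a b → (con 1ℚ :+ a) :* (con ½ :* b) := con ½ :* (a :* b :+ b)) refl

toℚᵘ-fromℕ : ∀ n → ℚ.toℚᵘ (fromℕ n) ℚᵘ.≃ ℚᵘ.mkℚᵘ (ℤ.+ n) 0
toℚᵘ-fromℕ 0       = ℚᵘ.≃-refl
toℚᵘ-fromℕ (suc n) = ℚᵘ.≃-trans (ℚ.toℚᵘ-homo-+ 1ℚ (fromℕ n))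
  (ℚᵘ.≃-trans (ℚᵘ.+-congʳ ℚᵘ.1ℚᵘ (toℚᵘ-fromℕ n)) (ℚᵘ.*≡* (cong (ℤ._* (ℤ.+ 1)) (cong (ℤ._+_ (ℤ.+ 1)) (ℤ.*-identityʳ (ℤ.+ n))))))

-- The denominator of ε serves as d: the product d ε is then the numerator, a positive integer.
archimedean : ∀ {ε} → 0ℚ ℚ.< ε → ∃ λ d → 1ℚ ℚ.≤ fromℕ d ℚ.* ε
archimedean {ε@(ℚ.mkℚ (ℤ.+ suc p) d-1 _)} 0<ε = suc d-1 , ℚ.toℚᵘ-cancel-≤
  (ℚᵘ.≤-respʳ-≃ (ℚᵘ.≃-sym (ℚᵘ.≃-trans (ℚ.toℚᵘ-homo-* (fromℕ (suc d-1)) ε) (ℚᵘ.*-congʳ {ℚ.toℚᵘ ε} (toℚᵘ-fromℕ (suc d-1)))))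
    (ℚᵘ.*≤* (ℤ.+≤+ (bound p d-1))))
  where
  bound : ∀ p d → 1 ℕ.* suc (d ℕ.+ 0) ℕ.≤ suc (p ℕ.+ d ℕ.* suc p) ℕ.* 1
  bound p d = subst₂ ℕ._≤_
    (sym (trans (ℕ.*-identityˡ _) (cong suc (ℕ.+-identityʳ d)))) (sym (ℕ.*-identityʳ _))
    (ℕ.s≤s (ℕ.≤-trans (ℕ.m≤m*n d (suc p)) (ℕ.m≤n+m _ p)))
archimedean {ℚ.mkℚ (ℤ.+ 0) _ _} (ℚ.*<* (ℤ.+<+ ()))
archimedean {ℚ.mkℚ (ℤ.-[1+ _ ]) _ _} (ℚ.*<* ())

-- With d ε ≥ 1 and d times 2^-d below 1, cancelling d leaves 2^-d < ε.
½^-null : ∀ {ε} → 0ℚ ℚ.< ε → Eventually λ n → ½^ n ℚ.< ε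
½^-null {ε} 0<ε =
  let d , 1≤dε = archimedean 0<ε
  in d , λ n d≤n → ℚ.≤-<-trans (½^-antitone d≤n)
    (ℚ.*-cancelˡ-<-nonNeg (fromℕ d) {{ℚ.nonNegative (0≤fromℕ d)}} {½^ d} {ε} (ℚ.<-≤-trans (fromℕ*½^<1 d) 1≤dε))

-- The state of a bisection after n halvings of [-B, B]. The bounds on the end points are kept
-- because the Lipschitz constant of the signed square depends on them.
record Bracket (q B : ℚ) (n : ℕ) : Set where
  field
    lower upper : ℚ
    σlower≤q    : signedSquareℚ lower ℚ.≤ q
    q≤σupper    : q ℚ.≤ signedSquareℚ upper
    ∣lower∣≤B   : ℚ.∣ lower ∣ ℚ.≤ B
    ∣upper∣≤B   : ℚ.∣ upper ∣ ℚ.≤ B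
    width       : upper ℚ.- lower ≡ ½^ n ℚ.* (B ℚ.+ B)

-- The summand 1 in B = 1 + |q| ensures B ≤ B * B, hence |q| ≤ B * B, so that [-B, B] contains the
-- signed root.
initial-bracket : ∀ q → Bracket q (1ℚ ℚ.+ ℚ.∣ q ∣) 0
initial-bracket q = record
  { lower = ℚ.- B ; upper = B
  ; σlower≤q = subst (ℚ._≤ q) (sym σ-B) (subst (ℚ.- (B ℚ.* B) ℚ.≤_) (neg-neg q)
      (ℚ.neg-antimono-≤ (ℚ.≤-trans (-p≤∣p∣ q) ∣q∣≤B*B)))
  ; q≤σupper = subst (λ b → q ℚ.≤ B ℚ.* b) (sym ∣B∣≡B) (ℚ.≤-trans (p≤∣p∣ q) ∣q∣≤B*B)
  ; ∣lower∣≤B = ℚ.≤-reflexive (trans (ℚ.∣-p∣≡∣p∣ B) ∣B∣≡B)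
  ; ∣upper∣≤B = ℚ.≤-reflexive ∣B∣≡B
  ; width = solve 1 (λ b → b :- (:- b) := con 1ℚ :* (b :+ b)) refl B }
  where
  open +-*-Solver
  B : ℚ
  B = 1ℚ ℚ.+ ℚ.∣ q ∣
  1≤B : 1ℚ ℚ.≤ B
  1≤B = subst (ℚ._≤ B) (ℚ.+-identityʳ 1ℚ) (ℚ.+-monoʳ-≤ 1ℚ (ℚ.0≤∣p∣ q))
  0≤B : 0ℚ ℚ.≤ B
  0≤B = ℚ.≤-trans (ℚ.nonNegative⁻¹ 1ℚ) 1≤B
  ∣B∣≡B : ℚ.∣ B ∣ ≡ B
  ∣B∣≡B = ℚ.0≤p⇒∣p∣≡p 0≤B
  ∣q∣≤B*B : ℚ.∣ q ∣ ℚ.≤ B ℚ.* B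
  ∣q∣≤B*B = ℚ.≤-trans
    (subst (ℚ._≤ B) (ℚ.+-identityˡ ℚ.∣ q ∣) (ℚ.+-monoˡ-≤ ℚ.∣ q ∣ (ℚ.nonNegative⁻¹ 1ℚ)))
    (subst (ℚ._≤ B ℚ.* B) (ℚ.*-identityʳ B) (ℚ.*-monoˡ-≤-nonNeg B {{ℚ.nonNegative 0≤B}} {1ℚ} {B} 1≤B))
  neg-neg : ∀ a → ℚ.- (ℚ.- a) ≡ a
  neg-neg = solve 1 (λ a → :- (:- a) := a) refl
  σ-B : signedSquareℚ (ℚ.- B) ≡ ℚ.- (B ℚ.* B)
  σ-B = trans (cong ((ℚ.- B) ℚ.*_) (trans (ℚ.∣-p∣≡∣p∣ B) ∣B∣≡B)) (sym (ℚ.neg-distribˡ-* B B))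

halve : ∀ {q B n} → Bracket q B n → Bracket q B (suc n)
halve {q} {B} {n} b = decide (signedSquareℚ mid ℚ.≤? q)
  where
  open Bracket b
  open +-*-Solver
  mid : ℚ
  mid = ½ ℚ.* (lower ℚ.+ upper)
  module ≤ = ℚ.≤-Reasoning
  ∣mid∣≤B : ℚ.∣ mid ∣ ℚ.≤ B
  ∣mid∣≤B = ≤.begin
    ℚ.∣ ½ ℚ.* (lower ℚ.+ upper) ∣ ≤.≡⟨ ℚ.∣p*q∣≡∣p∣*∣q∣ ½ (lower ℚ.+ upper) ⟩
    ½ ℚ.* ℚ.∣ lower ℚ.+ upper ∣ ≤.≤⟨ ℚ.*-monoˡ-≤-nonNeg ½ {ℚ.∣ lower ℚ.+ upper ∣} {B ℚ.+ B}
       (ℚ.≤-trans (ℚ.∣p+q∣≤∣p∣+∣q∣ lower upper) (ℚ.+-mono-≤ ∣lower∣≤B ∣upper∣≤B)) ⟩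
    ½ ℚ.* (B ℚ.+ B) ≤.≡⟨ solve 1 (λ b → con ½ :* (b :+ b) := b) refl B ⟩
    B ≤.∎
  half-width : ∀ {w} → w ≡ ½ ℚ.* (upper ℚ.- lower) → w ≡ ½ ℚ.* ½^ n ℚ.* (B ℚ.+ B)
  half-width eq = trans eq (trans (cong (½ ℚ.*_) width) (sym (ℚ.*-assoc ½ (½^ n) (B ℚ.+ B))))
  decide : Dec (signedSquareℚ mid ℚ.≤ q) → Bracket q B (suc n)
  decide (yes σmid≤q) = record
    { lower = mid ; upper = upper ; σlower≤q = σmid≤q ; q≤σupper = q≤σupper
    ; ∣lower∣≤B = ∣mid∣≤B ; ∣upper∣≤B = ∣upper∣≤B
    ; width = half-width (solve 2 (λ l h → h :- con ½ :* (l :+ h) := con ½ :* (h :- l)) refl lower upper) }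
  decide (no σmid≰q) = record
    { lower = lower ; upper = mid ; σlower≤q = σlower≤q ; q≤σupper = ℚ.<⇒≤ (ℚ.≰⇒> σmid≰q)
    ; ∣lower∣≤B = ∣lower∣≤B ; ∣upper∣≤B = ∣mid∣≤B
    ; width = half-width (solve 2 (λ l h → con ½ :* (l :+ h) :- l := con ½ :* (h :- l)) refl lower upper) }

bisect : ∀ q n → Bracket q (1ℚ ℚ.+ ℚ.∣ q ∣) n
bisect q 0       = initial-bracket q
bisect q (suc n) = halve (bisect q n)

-- The error at the lower end is at most the difference of the signed squares of both ends, hence at
-- most the width 2^-N (2B) times the Lipschitz constant 2B. N is chosen to make this less than ε.
approximate-root : ∀ q {ε} → 0ℚ ℚ.< ε → ∃ λ w → ℚ.∣ signedSquareℚ w ℚ.- q ∣ ℚ.< ε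
approximate-root q {ε} 0<ε = lower , (≤.begin-strict
    ℚ.∣ signedSquareℚ lower ℚ.- q ∣ ≤.≡⟨ ∣-∣-sym (signedSquareℚ lower) q ⟩
    ℚ.∣ q ℚ.- signedSquareℚ lower ∣ ≤.≡⟨ ℚ.0≤p⇒∣p∣≡p (a≤b⇒0≤b-a σlower≤q) ⟩
    q ℚ.- signedSquareℚ lower ≤.≤⟨ ℚ.+-monoˡ-≤ (ℚ.- signedSquareℚ lower) q≤σupper ⟩
    signedSquareℚ upper ℚ.- signedSquareℚ lower ≤.≤⟨ p≤∣p∣ _ ⟩
    ℚ.∣ signedSquareℚ upper ℚ.- signedSquareℚ lower ∣ ≤.≤⟨ signedSquareℚ-lipschitz upper lower ⟩
    ℚ.∣ upper ℚ.- lower ∣ ℚ.* (ℚ.∣ upper ∣ ℚ.+ ℚ.∣ lower ∣)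
      ≤.≤⟨ ℚ.*-monoˡ-≤-nonNeg ℚ.∣ upper ℚ.- lower ∣ {{ℚ.∣-∣-nonNeg (upper ℚ.- lower)}} (ℚ.+-mono-≤ ∣upper∣≤B ∣lower∣≤B) ⟩
    ℚ.∣ upper ℚ.- lower ∣ ℚ.* 2B ≤.≡⟨ cong (λ w → ℚ.∣ w ∣ ℚ.* 2B) width ⟩
    ℚ.∣ ½^ N ℚ.* 2B ∣ ℚ.* 2B ≤.≡⟨ cong (ℚ._* 2B) (ℚ.0≤p⇒∣p∣≡p (0≤p*q (ℚ.<⇒≤ (0<½^ N)) (ℚ.<⇒≤ 0<2B))) ⟩
    (½^ N ℚ.* 2B) ℚ.* 2B ≤.≡⟨ solve 2 (λ h b → (h :* b) :* b := (b :* b) :* h) refl (½^ N) 2B ⟩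
    C ℚ.* ½^ N ≤.<⟨ ℚ.*-monoʳ-<-pos C {{ℚ.positive 0<C}} (proj₂ null N ℕ.≤-refl) ⟩
    C ℚ.* Scale.δ C ε 0<C 0<ε ≤.≡⟨ Scale.B*δ C ε 0<C 0<ε ⟩
    ε ≤.∎)
  where
  open +-*-Solver
  module ≤ = ℚ.≤-Reasoning
  B 2B C : ℚ
  B = 1ℚ ℚ.+ ℚ.∣ q ∣
  2B = B ℚ.+ B
  C = 2B ℚ.* 2B
  0<2B : 0ℚ ℚ.< 2B
  0<2B = ℚ.+-mono-< {0ℚ} {B} {0ℚ} {B} 0<B 0<B
    where
    0<B : 0ℚ ℚ.< B
    0<B = ℚ.+-mono-<-≤ (ℚ.positive⁻¹ 1ℚ) (ℚ.0≤∣p∣ q)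
  0<C : 0ℚ ℚ.< C
  0<C = ℚ.positive⁻¹ C {{ℚ.pos*pos⇒pos 2B {{ℚ.positive 0<2B}} 2B {{ℚ.positive 0<2B}}}}
  null : Eventually λ n → ½^ n ℚ.< Scale.δ C ε 0<C 0<ε
  null = ½^-null (Scale.δ-pos C ε 0<C 0<ε)
  N : ℕ
  N = proj₁ null
  open Bracket (bisect q N)

-- The signed square root

abstract
  -- The n-th term is a root of the n-th term of x up to 2^-n. Its signed squares are thus Cauchy,
  -- and `signedSquareℚ-modulus` transfers this to the roots. The distance of two signed squares
  -- splits into two approximation errors and one difference of terms of x, each below a quarter of
  -- η.
  signedRoot : ℝ → ℝ
  signedRoot x = mkℝ root λ ε 0<ε → root-cauchy ε 0<ε
    where
    root : ℕ → ℚ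
    root n = proj₁ (approximate-root (seq x n) (0<½^ n))
    root-cauchy : ∀ ε → 0ℚ ℚ.< ε → ∃ λ N → ∀ m n → N ℕ.≤ m → N ℕ.≤ n → ℚ.∣ root m ℚ.- root n ∣ ℚ.< ε
    root-cauchy ε 0<ε = M ℕ.⊔ N , λ m n m≥ n≥ → signedSquareℚ-modulus 0<ε (root m) (root n)
      (subst (λ w → ℚ.∣ w ∣ ℚ.< η)
        (sym (a-c≡[a-b]+[b-c] (σ m) (seq x m) (σ n)))
        (sum-small η (σ m ℚ.- seq x m) (seq x m ℚ.- σ n)
          (ℚ.<-≤-trans (near m m≥) (½*p≤p (ℚ.<⇒≤ (half-pos 0<η))))
          (subst (λ w → ℚ.∣ w ∣ ℚ.< ½ ℚ.* η) (sym (a-c≡[a-b]+[b-c] (seq x m) (seq x n) (σ n)))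
            (sum-small (½ ℚ.* η) (seq x m ℚ.- seq x n) (seq x n ℚ.- σ n)
              (proj₂ x-close m n (⊔-≤ʳ {M} {N} m≥) (⊔-≤ʳ {M} {N} n≥))
              (subst (ℚ._< ½ ℚ.* (½ ℚ.* η)) (∣-∣-sym (σ n) (seq x n)) (near n n≥))))))
      where
      η : ℚ
      η = ½ ℚ.* (ε ℚ.* ε)
      0<η : 0ℚ ℚ.< η
      0<η = half-pos (ℚ.positive⁻¹ (ε ℚ.* ε) {{ℚ.pos*pos⇒pos ε {{ℚ.positive 0<ε}} ε {{ℚ.positive 0<ε}}}})
      σ : ℕ → ℚ
      σ n = signedSquareℚ (root n)
      0<η/4 : 0ℚ ℚ.< ½ ℚ.* (½ ℚ.* η)
      0<η/4 = half-pos (half-pos 0<η)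
      null : Eventually λ n → ½^ n ℚ.< ½ ℚ.* (½ ℚ.* η)
      null = ½^-null 0<η/4
      x-close : ∃ λ N → ∀ m n → N ℕ.≤ m → N ℕ.≤ n → ℚ.∣ seq x m ℚ.- seq x n ∣ ℚ.< ½ ℚ.* (½ ℚ.* η)
      x-close = cauchy x (½ ℚ.* (½ ℚ.* η)) 0<η/4
      M N : ℕ
      M = proj₁ null
      N = proj₁ x-close
      near : ∀ n → M ℕ.⊔ N ℕ.≤ n → ℚ.∣ σ n ℚ.- seq x n ∣ ℚ.< ½ ℚ.* (½ ℚ.* η)
      near n n≥ = ℚ.<-trans (proj₂ (approximate-root (seq x n) (0<½^ n))) (proj₂ null n (⊔-≤ˡ {M} {N} n≥))

  signedSquare-signedRoot : ∀ x → signedSquare (signedRoot x) ≅ x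
  signedSquare-signedRoot x = ≈⇒≅ λ ε 0<ε →
    Eventually-map (λ n → ℚ.<-trans (proj₂ (approximate-root (seq x n) (0<½^ n)))) (½^-null 0<ε)

signedRoot-cong : ∀ {x y} → x ≅ y → signedRoot x ≅ signedRoot y
signedRoot-cong {x} {y} x≅y = signedSquare-injective
  (≅-trans (signedSquare-signedRoot x) (≅-trans x≅y (≅-sym (signedSquare-signedRoot y))))

signedSquare-cong : ∀ {x y} → x ≅ y → signedSquare x ≅ signedSquare y
signedSquare-cong {x} {y} x≅y = *-cong {x} {y} {∣ x ∣} {∣ y ∣} x≅y (abs-cong x≅y)

signedRoot-signedSquare : ∀ x → signedRoot (signedSquare x) ≅ x
signedRoot-signedSquare x = signedSquare-injective (signedSquare-signedRoot (signedSquare x))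

∣signedSquare∣ : ∀ x → ∣ signedSquare x ∣ ≅ x * x
∣signedSquare∣ x = pointwise {∣ signedSquare x ∣} {x * x} λ n → eq (seq x n)
  where
  eq : ∀ a → ℚ.∣ a ℚ.* ℚ.∣ a ∣ ∣ ≡ a ℚ.* a
  eq a = trans (ℚ.∣p*q∣≡∣p∣*∣q∣ a ℚ.∣ a ∣) (trans (cong (ℚ.∣ a ∣ ℚ.*_) (ℚ.∣∣p∣∣≡∣p∣ a)) (∣a∣*∣a∣≡a*a a))

-- Both sides have square a² + b².
∣a-b∣≅a+b : ∀ {a b} → NonNeg a → NonNeg b → a * b ≅ 0ℝ → ∣ a - b ∣ ≅ a + b
∣a-b∣≅a+b {a} {b} 0≤a 0≤b ab≅0 = signedSquare-injective {∣ a - b ∣} {s}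
  (≅-trans {signedSquare ∣ a - b ∣} {s * s} {signedSquare s} square
    (*-cong {s} {s} {s} {∣ s ∣} ≅-refl (≅-sym (nonNeg-+ {a} {b} 0≤a 0≤b))))
  where
  open +-*-Solver
  s : ℝ
  s = a + b
  four : ℚ
  four = 1ℚ ℚ.+ 1ℚ ℚ.+ 1ℚ ℚ.+ 1ℚ
  expand : ∀ a b → ℚ.∣ a ℚ.- b ∣ ℚ.* ℚ.∣ ℚ.∣ a ℚ.- b ∣ ∣ ≡ (a ℚ.+ b) ℚ.* (a ℚ.+ b) ℚ.- four ℚ.* (a ℚ.* b)
  expand a b = trans (cong (ℚ.∣ a ℚ.- b ∣ ℚ.*_) (ℚ.∣∣p∣∣≡∣p∣ (a ℚ.- b))) (trans (∣a∣*∣a∣≡a*a (a ℚ.- b))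
    (solve 2 (λ a b → (a :- b) :* (a :- b) := (a :+ b) :* (a :+ b) :- con four :* (a :* b)) refl a b))
  drop-zero : ∀ t → t ℚ.- four ℚ.* 0ℚ ≡ t
  drop-zero = solve 1 (λ t → t :- con four :* con 0ℚ := t) refl
  square : signedSquare ∣ a - b ∣ ≅ s * s
  square = ≅-trans {signedSquare ∣ a - b ∣} {s * s - fromℚ four * (a * b)} {s * s}
    (pointwise {signedSquare ∣ a - b ∣} {s * s - fromℚ four * (a * b)} λ n → expand (seq a n) (seq b n))
    (≅-trans {s * s - fromℚ four * (a * b)} {s * s - fromℚ four * 0ℝ} {s * s}
      (minus-cong {s * s} {s * s} {fromℚ four * (a * b)} {fromℚ four * 0ℝ} (≅-refl {s * s})
        (*-cong {fromℚ four} {fromℚ four} {a * b} {0ℝ} (≅-refl {fromℚ four}) ab≅0))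
      (pointwise {s * s - fromℚ four * 0ℝ} {s * s} λ n → drop-zero (seq s n ℚ.* seq s n)))

signedRoot² : ∀ x → signedRoot x * signedRoot x ≅ ∣ x ∣
signedRoot² x = ≅-trans {signedRoot x * signedRoot x} {∣ signedSquare (signedRoot x) ∣} {∣ x ∣}
  (≅-sym {∣ signedSquare (signedRoot x) ∣} {signedRoot x * signedRoot x} (∣signedSquare∣ (signedRoot x)))
  (abs-cong {signedSquare (signedRoot x)} {x} (signedSquare-signedRoot x))

½*[s+d] : ∀ a b → ½ ℚ.* ((a ℚ.+ b) ℚ.+ (a ℚ.- b)) ≡ a
½*[s+d] = solve 2 (λ a b → con ½ :* ((a :+ b) :+ (a :- b)) := a) refl
  where open +-*-Solver

½*[s-d] : ∀ a b → ½ ℚ.* ((a ℚ.+ b) ℚ.- (a ℚ.- b)) ≡ b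
½*[s-d] = solve 2 (λ a b → con ½ :* ((a :+ b) :- (a :- b)) := b) refl
  where open +-*-Solver

-- Since |a - b| = a + b for orthogonal non-negative reals, half the sum of |a - b| and a - b is a.
-- The difference alone thus determines both numbers.
positivePart-difference : ∀ {a b} → NonNeg a → NonNeg b → a * b ≅ 0ℝ → positivePart (a - b) ≅ a
positivePart-difference {a} {b} 0≤a 0≤b ab≅0 =
  ≅-trans {positivePart (a - b)} {fromℚ ½ * ((a + b) + (a - b))} {a}
    (*-cong {fromℚ ½} {fromℚ ½} {∣ a - b ∣ + (a - b)} {(a + b) + (a - b)} (≅-refl {fromℚ ½})
      (+-cong {∣ a - b ∣} {a + b} {a - b} {a - b} (∣a-b∣≅a+b {a} {b} 0≤a 0≤b ab≅0) (≅-refl {a - b})))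
    (pointwise {fromℚ ½ * ((a + b) + (a - b))} {a} λ n → ½*[s+d] (seq a n) (seq b n))

negativePart-difference : ∀ {a b} → NonNeg a → NonNeg b → a * b ≅ 0ℝ → negativePart (a - b) ≅ b
negativePart-difference {a} {b} 0≤a 0≤b ab≅0 =
  ≅-trans {negativePart (a - b)} {fromℚ ½ * ((a + b) - (a - b))} {b}
    (*-cong {fromℚ ½} {fromℚ ½} {∣ a - b ∣ - (a - b)} {(a + b) - (a - b)} (≅-refl {fromℚ ½})
      (minus-cong {∣ a - b ∣} {a + b} {a - b} {a - b} (∣a-b∣≅a+b {a} {b} 0≤a 0≤b ab≅0) (≅-refl {a - b})))
    (pointwise {fromℚ ½ * ((a + b) - (a - b))} {b} λ n → ½*[s-d] (seq a n) (seq b n))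

-- Continuous functionals

-- Stated for an arbitrary operation, as unfolding a sum of reals by one term
-- makes the type checker compare Cauchy proofs.
foldr-closed : {A J : Set} (_∙_ : A → A → A) (e : A) (P : (J → A) → Set) → P (λ _ → e) →
  (∀ φ ψ → P φ → P ψ → P (λ p → φ p ∙ ψ p)) →
  ∀ n (φ : Fin n → J → A) → (∀ i → P (φ i)) → P (λ p → foldr _∙_ e (λ i → φ i p))
foldr-closed _∙_ e P P-e P-∙ 0       φ Pφ = P-e
foldr-closed _∙_ e P P-e P-∙ (suc n) φ Pφ =
  P-∙ (φ zero) _ (Pφ zero) (foldr-closed _∙_ e P P-e P-∙ n (φ ∘ suc) (Pφ ∘ suc))

Functional : Set → Set
Functional I = (I → ℝ) → ℝ

-- Points range over all of ℝ^I rather than over a subspace, so that functionals compose without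
-- membership proofs; rational tolerances avoid choosing a rational below a real one at every step.
record IsContinuous {I : Set} (φ : Functional I) : Set where
  constructor continuous
  field modulus : ∀ p ε → 0ℚ ℚ.< ε → ∃ λ δ → 0ℚ ℚ.< δ ×
                  (∀ q → (∀ i → Close δ (p i) (q i)) → Close ε (φ p) (φ q))
open IsContinuous

module _ {I : Set} where

  const-continuous : ∀ c → IsContinuous {I} (λ _ → c)
  const-continuous c = continuous λ p ε 0<ε → 1ℚ , ℚ.positive⁻¹ 1ℚ , λ q _ → ≅⇒≈ (≅-refl {c}) ε 0<ε

  coordinate-continuous : ∀ i → IsContinuous {I} (λ p → p i)
  coordinate-continuous i = continuous λ p ε 0<ε → ε , 0<ε , λ q close → close i

  map-continuous : {f : ℝ → ℝ} →
    (∀ x ε → 0ℚ ℚ.< ε → ∃ λ δ → 0ℚ ℚ.< δ × (∀ y → Close δ x y → Close ε (f x) (f y))) →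
    {φ : Functional I} → IsContinuous φ → IsContinuous (λ p → f (φ p))
  map-continuous f-cont {φ} φ-cont = continuous λ p ε 0<ε →
    let δ , 0<δ , f-close = f-cont (φ p) ε 0<ε
        γ , 0<γ , φ-close = modulus φ-cont p δ 0<δ
    in γ , 0<γ , λ q close → f-close (φ q) (φ-close q close)

  map₂-continuous : {f : ℝ → ℝ → ℝ} →
    (∀ x u ε → 0ℚ ℚ.< ε → ∃ λ δ → 0ℚ ℚ.< δ × (∀ y v → Close δ x y → Close δ u v → Close ε (f x u) (f y v))) →
    {φ ψ : Functional I} → IsContinuous φ → IsContinuous ψ → IsContinuous (λ p → f (φ p) (ψ p))
  map₂-continuous f-cont {φ} {ψ} φ-cont ψ-cont = continuous λ p ε 0<ε →
    let δ , 0<δ , f-close = f-cont (φ p) (ψ p) ε 0<ε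
        γ₁ , 0<γ₁ , φ-close = modulus φ-cont p δ 0<δ
        γ₂ , 0<γ₂ , ψ-close = modulus ψ-cont p δ 0<δ
        γ , 0<γ , γ≤γ₁ , γ≤γ₂ = common-bound 0<γ₁ 0<γ₂
    in γ , 0<γ , λ q close → f-close (φ q) (ψ q)
      (φ-close q (λ i → Close-mono {x = p i} {q i} γ≤γ₁ (close i)))
      (ψ-close q (λ i → Close-mono {x = p i} {q i} γ≤γ₂ (close i)))

  module _ {φ ψ : Functional I} (φ-cont : IsContinuous φ) (ψ-cont : IsContinuous ψ) where

    +-continuous : IsContinuous (λ p → φ p + ψ p)
    +-continuous = map₂-continuous {_+_} (λ x u ε 0<ε → ½ ℚ.* ε , half-pos 0<ε ,
      λ y v → close-+ 0<ε {x} {y} {u} {v}) {φ} {ψ} φ-cont ψ-cont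

    *-continuous : IsContinuous (λ p → φ p * ψ p)
    *-continuous = map₂-continuous {_*_} (λ x u ε 0<ε → close-* {ε} 0<ε x u) {φ} {ψ} φ-cont ψ-cont

  module _ {φ : Functional I} (φ-cont : IsContinuous φ) where

    neg-continuous : IsContinuous (λ p → - φ p)
    neg-continuous = map-continuous {f = -_} (λ x ε 0<ε → ε , 0<ε , λ y → close-neg {ε} {x} {y}) φ-cont

    abs-continuous : IsContinuous (λ p → ∣ φ p ∣)
    abs-continuous = map-continuous {∣_∣} (λ x ε 0<ε → ε , 0<ε , λ y → close-abs {ε} {x} {y}) φ-cont

    -- The modulus δ = ε²/8 is uniform in x. Signed squares may differ by η = ε²/2; half of η and a
    -- quarter of it absorb the exchange of each signed square for its argument, which leaves a
    -- quarter for x and y.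
    signedRoot-continuous : IsContinuous (λ p → signedRoot (φ p))
    signedRoot-continuous = map-continuous {signedRoot} root-modulus φ-cont
      where
      root-modulus : ∀ x ε → 0ℚ ℚ.< ε → ∃ λ δ → 0ℚ ℚ.< δ ×
        (∀ y → Close δ x y → Close ε (signedRoot x) (signedRoot y))
      root-modulus x ε 0<ε = ½ ℚ.* (½ ℚ.* η) , half-pos (half-pos 0<η) , λ y close →
        Eventually-map (λ n → signedSquareℚ-modulus 0<ε (seq (signedRoot x) n) (seq (signedRoot y) n))
          (close-trans {η} {signedSquare (signedRoot x)} {x} {signedSquare (signedRoot y)}
            (≅⇒≈ (signedSquare-signedRoot x) (½ ℚ.* η) (half-pos 0<η))
            (close-trans {½ ℚ.* η} {x} {y} {signedSquare (signedRoot y)} close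
              (≅⇒≈ (≅-sym (signedSquare-signedRoot y)) (½ ℚ.* (½ ℚ.* η)) (half-pos (half-pos 0<η)))))
        where
        η : ℚ
        η = ½ ℚ.* (ε ℚ.* ε)
        0<η : 0ℚ ℚ.< η
        0<η = half-pos (ℚ.positive⁻¹ (ε ℚ.* ε) {{ℚ.pos*pos⇒pos ε {{ℚ.positive 0<ε}} ε {{ℚ.positive 0<ε}}}})

  minus-continuous : {φ ψ : Functional I} → IsContinuous φ → IsContinuous ψ → IsContinuous (λ p → φ p - ψ p)
  minus-continuous {φ} {ψ} φ-cont ψ-cont = +-continuous {φ} {λ p → - ψ p} φ-cont (neg-continuous ψ-cont)

  scale-continuous : {φ : Functional I} (c : ℝ) → IsContinuous φ → IsContinuous (λ p → c * φ p)
  scale-continuous {φ} c φ-cont = *-continuous {λ _ → c} {φ} (const-continuous c) φ-cont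

  clamp-continuous : {φ : Functional I} → IsContinuous φ → IsContinuous (λ p → clamp (φ p))
  clamp-continuous {φ} φ-cont = scale-continuous {λ p → (∣ φ p ∣ - ∣ φ p - 1ℝ ∣) + 1ℝ} (fromℚ ½)
    (+-continuous {λ p → ∣ φ p ∣ - ∣ φ p - 1ℝ ∣} {λ _ → 1ℝ}
      (minus-continuous {λ p → ∣ φ p ∣} {λ p → ∣ φ p - 1ℝ ∣} (abs-continuous φ-cont)
        (abs-continuous {λ p → φ p - 1ℝ} (minus-continuous {φ} {λ _ → 1ℝ} φ-cont (const-continuous 1ℝ))))
      (const-continuous 1ℝ))

  positivePart-continuous : {φ : Functional I} → IsContinuous φ → IsContinuous (λ p → positivePart (φ p))
  positivePart-continuous {φ} φ-cont = scale-continuous {λ p → ∣ φ p ∣ + φ p} (fromℚ ½)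
    (+-continuous {λ p → ∣ φ p ∣} {φ} (abs-continuous φ-cont) φ-cont)

  negativePart-continuous : {φ : Functional I} → IsContinuous φ → IsContinuous (λ p → negativePart (φ p))
  negativePart-continuous {φ} φ-cont = scale-continuous {λ p → ∣ φ p ∣ - φ p} (fromℚ ½)
    (minus-continuous {λ p → ∣ φ p ∣} {φ} (abs-continuous φ-cont) φ-cont)

  signedSquare-continuous : {φ : Functional I} → IsContinuous φ → IsContinuous (λ p → signedSquare (φ p))
  signedSquare-continuous {φ} φ-cont = *-continuous {φ} {λ p → ∣ φ p ∣} φ-cont (abs-continuous φ-cont)

  ∑-continuous : ∀ n (φ : Fin n → Functional I) → (∀ i → IsContinuous (φ i)) →
    IsContinuous (λ p → ∑ (λ i → φ i p))
  ∑-continuous = foldr-closed _+_ 0ℝ IsContinuous (const-continuous 0ℝ)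
    (λ φ ψ → +-continuous {φ} {ψ})

  ∑[]-continuous : ∀ {A} (F : Finite A) {φ : A → Functional I} → (∀ a → IsContinuous (φ a)) →
    IsContinuous (λ p → ∑[ F ] (λ a → φ a p))
  ∑[]-continuous (n , A↔Fin) {φ} φ-cont =
    ∑-continuous n (λ i → φ (Inverse.from A↔Fin i)) (λ i → φ-cont (Inverse.from A↔Fin i))

-- From continuous coordinates to maps of spaces

uniform-modulus : ∀ n (P : Fin n → ℚ → Set) → (∀ i {γ δ} → γ ℚ.≤ δ → P i δ → P i γ) →
  (∀ i → ∃ λ δ → 0ℚ ℚ.< δ × P i δ) → ∃ λ δ → 0ℚ ℚ.< δ × (∀ i → P i δ)
uniform-modulus 0 P anti each = 1ℚ , ℚ.positive⁻¹ 1ℚ , λ ()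
uniform-modulus (suc n) P anti each =
  let δ₀ , 0<δ₀ , P₀ = each zero
      δ₁ , 0<δ₁ , P₁ = uniform-modulus n (P ∘ suc) (anti ∘ suc) (each ∘ suc)
      δ , 0<δ , δ≤δ₀ , δ≤δ₁ = common-bound 0<δ₀ 0<δ₁
  in δ , 0<δ , λ where
    zero    → anti zero δ≤δ₀ P₀
    (suc i) → anti (suc i) δ≤δ₁ (P₁ i)

<⇒close : ∀ {x y δ} → ∣ x - y ∣ < fromℚ δ → Close δ x y
<⇒close {x} {y} {δ} (ε , 0<ε , ev) = Eventually-map
  (λ n lt → ℚ.<-trans (subst (ℚ._< z n ℚ.+ ε) (ℚ.+-identityʳ (z n)) (ℚ.+-monoʳ-< (z n) 0<ε)) lt) ev
  where
  z : ℕ → ℚ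
  z n = ℚ.∣ seq x n ℚ.- seq y n ∣

close⇒< : ∀ {x y ε₀ ε} → 0ℚ ℚ.< ε₀ → Eventually (λ n → 0ℚ ℚ.+ ε₀ ℚ.< seq ε n) →
  Close (½ ℚ.* ε₀) x y → ∣ x - y ∣ < ε
close⇒< {x} {y} {ε₀} {ε} 0<ε₀ ε₀<ε close = ½ ℚ.* ε₀ , half-pos 0<ε₀ , Eventually-map
  (λ n (lt , cl) → ℚ.<-trans
    (subst (ℚ.∣ seq x n ℚ.- seq y n ∣ ℚ.+ ½ ℚ.* ε₀ ℚ.<_)
      (trans (half+half ε₀) (sym (ℚ.+-identityˡ ε₀))) (ℚ.+-monoˡ-< (½ ℚ.* ε₀) cl)) lt)
  (Eventually-× ε₀<ε close)

module _ (X Y : Space) where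
  private
    module X = Space X
    module Y = Space Y

  -- The real tolerance ε is replaced by a rational ε₀ below it, and half of ε₀ leaves the gap that
  -- strict inequality demands. As the target has finitely many coordinates, the least of their
  -- moduli works for all.
  mkMap : (F : (X.Index → ℝ) → (Y.Index → ℝ)) → (∀ p → X.Member p → Y.Member (F p)) →
    (∀ j → IsContinuous (λ p → F p j)) → Map X Y
  mkMap F F-member F-cont = f , f-continuous
    where
    f : Point X → Point Y
    f (p , p∈X) = F p , F-member p p∈X
    f-continuous : Continuous {X} {Y} f
    f-continuous (p , _) ε (ε₀ , 0<ε₀ , ε₀<ε) =
      let n , Y↔Fin = Y.finite
          δ , 0<δ , near = uniform-modulus n
            (λ k δ → ∀ q → (∀ i → Close δ (p i) (q i)) →
              Close (½ ℚ.* ε₀) (F p (Inverse.from Y↔Fin k)) (F q (Inverse.from Y↔Fin k)))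
            (λ k γ≤δ near q close → near q (λ i → Close-mono {x = p i} {q i} γ≤δ (close i)))
            (λ k → modulus (F-cont (Inverse.from Y↔Fin k)) p (½ ℚ.* ε₀) (half-pos 0<ε₀))
      in fromℚ δ , (½ ℚ.* δ , half-pos 0<δ , 0 , λ _ _ → half<whole δ 0<δ) , λ (q , _) p≋q j →
        close⇒< {F p j} {F q j} {ε₀} {ε} 0<ε₀ ε₀<ε
          (subst (λ j → Close (½ ℚ.* ε₀) (F p j) (F q j)) (Inverse.strictlyInverseʳ Y↔Fin j)
            (near (Inverse.to Y↔Fin j) q (λ i → <⇒close {p i} {q i} (p≋q i))))
      where
      half<whole : ∀ δ → 0ℚ ℚ.< δ → 0ℚ ℚ.+ ½ ℚ.* δ ℚ.< δ
      half<whole δ 0<δ = subst (0ℚ ℚ.+ ½ ℚ.* δ ℚ.<_) (half+half δ) (ℚ.+-monoˡ-< (½ ℚ.* δ) (half-pos 0<δ))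

-- Pushing weights forward along a map of finite sets

-- The operations are separate parameters so that those of the reals are
-- recognised without unfolding a bundle.
module Pushforward {C : Set} (_≈ᶜ_ : C → C → Set) (_⊕_ _⊗_ : C → C → C) (0# 1# : C)
  (isCommutativeSemiring : IsCommutativeSemiring _≈ᶜ_ _⊕_ _⊗_ 0# 1#) where

  private
    commutativeSemiring : CommutativeSemiring 0ℓ 0ℓ
    commutativeSemiring = record { isCommutativeSemiring = isCommutativeSemiring }
    module R = CommutativeSemiring commutativeSemiring
    module ∑ₘ = CommutativeMonoidSum R.+-commutativeMonoid

  sum : ∀ {n} → (Fin n → C) → C
  sum = foldr _⊕_ 0#

  sum[_] : ∀ {A} → Finite A → (A → C) → C
  sum[ n , A↔Fin ] x = sum (x ∘ Inverse.from A↔Fin)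

  sum-cong : ∀ {n} {x y : Fin n → C} → (∀ i → x i ≈ᶜ y i) → sum x ≈ᶜ sum y
  sum-cong x≈y = ∑ₘ.sum-cong-≋ x≈y

  sum-zero : ∀ {n} (x : Fin n → C) → (∀ i → x i ≈ᶜ 0#) → sum x ≈ᶜ 0#
  sum-zero {n} x x≈0 = R.trans (∑ₘ.sum-cong-≋ x≈0) (∑ₘ.sum-replicate-zero n)

  sum-single : ∀ {n} (x : Fin n → C) k → (∀ i → i ≢ k → x i ≈ᶜ 0#) → sum x ≈ᶜ x k
  sum-single {suc n} x zero x≈0 =
    R.trans (R.+-congˡ (sum-zero (x ∘ suc) λ i → x≈0 (suc i) λ ())) (R.+-identityʳ (x zero))
  sum-single {suc n} x (suc k) x≈0 =
    R.trans (R.+-cong (x≈0 zero λ ()) (sum-single (x ∘ suc) k λ i i≢k → x≈0 (suc i) (i≢k ∘ Fin.suc-injective)))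
            (R.+-identityˡ (x (suc k)))

  sum-closed : (P : C → Set) → P 0# → (∀ {c d} → P c → P d → P (c ⊕ d)) →
    ∀ {n} (x : Fin n → C) → (∀ i → P (x i)) → P (sum x)
  sum-closed P P0 P+ {0}     x Px = P0
  sum-closed P P0 P+ {suc n} x Px = P+ (Px zero) (sum-closed P P0 P+ (x ∘ suc) (Px ∘ suc))

  module _ {A : Set} (F : Finite A) where
    private
      from : Fin (proj₁ F) → A
      from = Inverse.from (proj₂ F)

    sum[]-cong : ∀ {x y : A → C} → (∀ a → x a ≈ᶜ y a) → sum[ F ] x ≈ᶜ sum[ F ] y
    sum[]-cong x≈y = ∑ₘ.sum-cong-≋ (x≈y ∘ from)

    sum[]-zero : ∀ {x : A → C} → (∀ a → x a ≈ᶜ 0#) → sum[ F ] x ≈ᶜ 0#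
    sum[]-zero {x} x≈0 = sum-zero (x ∘ from) (x≈0 ∘ from)

    sum[]-+ : ∀ (x y : A → C) → sum[ F ] (λ a → x a ⊕ y a) ≈ᶜ (sum[ F ] x ⊕ sum[ F ] y)
    sum[]-+ x y = ∑ₘ.∑-distrib-+ (x ∘ from) (y ∘ from)

    sum[]-closed : (P : C → Set) → P 0# → (∀ {c d} → P c → P d → P (c ⊕ d)) →
      (x : A → C) → (∀ a → P (x a)) → P (sum[ F ] x)
    sum[]-closed P P0 P+ x Px = sum-closed P P0 P+ (x ∘ from) (Px ∘ from)

    sum[]-single : ∀ (x : A → C) b → (∀ a → a ≢ b → x a ≈ᶜ 0#) → sum[ F ] x ≈ᶜ x b
    sum[]-single x b x≈0 = R.trans
      (sum-single (x ∘ from) (Inverse.to (proj₂ F) b)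
        λ i i≢b → x≈0 (from i) λ i≡b →
          i≢b (trans (sym (Inverse.strictlyInverseˡ (proj₂ F) i)) (cong (Inverse.to (proj₂ F)) i≡b)))
      (R.reflexive (cong x (Inverse.strictlyInverseʳ (proj₂ F) b)))

  sum[]-comm : ∀ {A B} (F : Finite A) (G : Finite B) (x : A → B → C) →
    sum[ F ] (λ a → sum[ G ] (x a)) ≈ᶜ sum[ G ] (λ b → sum[ F ] (λ a → x a b))
  sum[]-comm F G x = ∑ₘ.∑-comm λ i j → x (Inverse.from (proj₂ F) i) (Inverse.from (proj₂ G) j)

  indicator : ∀ {P : Set} → Dec P → C → C
  indicator (yes _) c = c
  indicator (no  _) c = 0#

  indicator-cong : ∀ {P : Set} (d : Dec P) {x y} → (P → x ≈ᶜ y) → indicator d x ≈ᶜ indicator d y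
  indicator-cong (yes p) x≈y = x≈y p
  indicator-cong (no  _) x≈y = R.refl

  indicator-yes : ∀ {P : Set} (d : Dec P) {x} → P → indicator d x ≈ᶜ x
  indicator-yes (yes _) p = R.refl
  indicator-yes (no ¬p) p = ⊥-elim (¬p p)

  indicator-no : ∀ {P : Set} (d : Dec P) {x} → ¬ P → indicator d x ≈ᶜ 0#
  indicator-no (yes p) ¬p = ⊥-elim (¬p p)
  indicator-no (no _)  ¬p = R.refl

  indicator-zero : ∀ {P : Set} (d : Dec P) {x} → (P → x ≈ᶜ 0#) → indicator d x ≈ᶜ 0#
  indicator-zero (yes p) x≈0 = x≈0 p
  indicator-zero (no _)  x≈0 = R.refl

  indicator-complement : ∀ {P Q : Set} (d : Dec P) (d′ : Dec Q) → (P → ¬ Q) → (¬ P → Q) →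
    ∀ c → (indicator d c ⊕ indicator d′ c) ≈ᶜ c
  indicator-complement (yes p) d′ P⇒¬Q ¬P⇒Q c = R.trans (R.+-congˡ (indicator-no d′ (P⇒¬Q p))) (R.+-identityʳ c)
  indicator-complement (no ¬p) d′ P⇒¬Q ¬P⇒Q c = R.trans (R.+-congˡ (indicator-yes d′ (¬P⇒Q ¬p))) (R.+-identityˡ c)

  indicator-closed : ∀ (Q : C → Set) → Q 0# → ∀ {P : Set} (d : Dec P) {x} → Q x → Q (indicator d x)
  indicator-closed Q Q0 (yes _) Qx = Qx
  indicator-closed Q Q0 (no _)  Qx = Q0

  indicator-absorbʳ : ∀ {P : Set} (d : Dec P) {b c} → (P → c ≈ᶜ 0#) → (¬ P → b ≈ᶜ 0#) → indicator d (b ⊕ c) ≈ᶜ b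
  indicator-absorbʳ (yes p) {b} c≈0 b≈0 = R.trans (R.+-congˡ (c≈0 p)) (R.+-identityʳ b)
  indicator-absorbʳ (no ¬p)     c≈0 b≈0 = R.sym (b≈0 ¬p)

  indicator-absorbˡ : ∀ {P : Set} (d : Dec P) {b c} → (P → b ≈ᶜ 0#) → (¬ P → c ≈ᶜ 0#) → indicator d (b ⊕ c) ≈ᶜ c
  indicator-absorbˡ (yes p) {b} {c} b≈0 c≈0 = R.trans (R.+-congʳ (b≈0 p)) (R.+-identityˡ c)
  indicator-absorbˡ (no ¬p)         b≈0 c≈0 = R.sym (c≈0 ¬p)

  sum-join : ∀ {A n} (F : Finite A) {x y : A → C} {u v : Fin n → C} → sum[ F ] x ≈ᶜ sum u → sum[ F ] y ≈ᶜ sum v →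
    sum[ F ] (λ a → x a ⊕ y a) ≈ᶜ sum (λ i → u i ⊕ v i)
  sum-join F {x} {y} {u} {v} x≈u y≈v = R.trans (sum[]-+ F x y) (R.trans (R.+-cong x≈u y≈v) (R.sym (∑ₘ.∑-distrib-+ u v)))

  restrict : ∀ {A : Set} {P : A → Set} → (∀ a → Dec (P a)) → (A → C) → A → C
  restrict P? x a = indicator (P? a) (x a)

  restrict-complement : ∀ {A : Set} {P Q : A → Set} (P? : ∀ a → Dec (P a)) (Q? : ∀ a → Dec (Q a)) →
    (∀ a → P a → ¬ Q a) → (∀ a → ¬ P a → Q a) → ∀ x a → (restrict P? x a ⊕ restrict Q? x a) ≈ᶜ x a
  restrict-complement P? Q? P⇒¬Q ¬P⇒Q x a = indicator-complement (P? a) (Q? a) (P⇒¬Q a) (¬P⇒Q a) (x a)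

  indicator-sum : ∀ {P A : Set} (F : Finite A) (d : Dec P) (x : A → C) →
    indicator d (sum[ F ] x) ≈ᶜ sum[ F ] (λ a → indicator d (x a))
  indicator-sum F (yes _) x = R.refl
  indicator-sum F (no _)  x = R.sym (sum[]-zero F λ _ → R.refl)

  module _ {A B : Set} (F : Finite A) (_≟_ : DecidableEquality B) (φ : A → B) where

    push : (A → C) → B → C
    push x b = sum[ F ] λ a → indicator (φ a ≟ b) (x a)

    push-cong : ∀ {x y} → (∀ a → x a ≈ᶜ y a) → ∀ b → push x b ≈ᶜ push y b
    push-cong x≈y b = sum[]-cong F λ a → indicator-cong (φ a ≟ b) λ _ → x≈y a

    push-zero : ∀ {x} b → (∀ a → φ a ≡ b → x a ≈ᶜ 0#) → push x b ≈ᶜ 0#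
    push-zero b x≈0 = sum[]-zero F λ a → indicator-zero (φ a ≟ b) (x≈0 a)

    push-closed : (P : C → Set) → P 0# → (∀ {c d} → P c → P d → P (c ⊕ d)) →
      ∀ {x} → (∀ a → P (x a)) → ∀ b → P (push x b)
    push-closed P P0 P+ {x} Px b = sum[]-closed F P P0 P+ (λ a → indicator (φ a ≟ b) (x a))
      λ a → indicator-closed P P0 (φ a ≟ b) (Px a)

    push-total : (G : Finite B) (x : A → C) → sum[ G ] (push x) ≈ᶜ sum[ F ] x
    push-total G x = R.trans (sum[]-comm G F λ b a → indicator (φ a ≟ b) (x a))
      (sum[]-cong F λ a → R.trans
        (sum[]-single G (λ b → indicator (φ a ≟ b) (x a)) (φ a)
          λ b b≢φa → indicator-no (φ a ≟ b) (b≢φa ∘ sym))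
        (indicator-yes (φ a ≟ φ a) refl))

  -- Orthogonality is a parameter with only the closure properties used here, so that it can later
  -- be instantiated by an opaque relation on the reals.
  push-⟂ : ∀ {A B} (F : Finite A) (_≟_ : DecidableEquality B) (φ : A → B)
    (_⟂_ : C → C → Set) → (∀ c → 0# ⟂ c) → (∀ {c d k} → c ⟂ k → d ⟂ k → (c ⊕ d) ⟂ k) →
    ∀ x b k → (∀ a → φ a ≡ b → x a ⟂ k) → push F _≟_ φ x b ⟂ k
  push-⟂ F _≟_ φ _⟂_ 0-⟂ +-⟂ x b k x⟂k = sum[]-closed F (_⟂ k) (0-⟂ k) +-⟂ (λ a → indicator (φ a ≟ b) (x a))
    λ a → term a (φ a ≟ b)
    where
    term : ∀ a (d : Dec (φ a ≡ b)) → indicator d (x a) ⟂ k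
    term a (yes φa≡b) = x⟂k a φa≡b
    term a (no _)     = 0-⟂ k

  push-∘ : ∀ {A B D} (F : Finite A) (G : Finite B)
    (_≟₁_ : DecidableEquality B) (_≟₂_ : DecidableEquality D) (φ : A → B) (ψ : B → D) (x : A → C) →
    ∀ d → push G _≟₂_ ψ (push F _≟₁_ φ x) d ≈ᶜ push F _≟₂_ (ψ ∘ φ) x d
  push-∘ F G _≟₁_ _≟₂_ φ ψ x d = R.trans
    (sum[]-cong G λ b → indicator-sum F (ψ b ≟₂ d) λ a → indicator (φ a ≟₁ b) (x a))
    (R.trans (sum[]-comm G F λ b a → indicator (ψ b ≟₂ d) (indicator (φ a ≟₁ b) (x a)))
      (sum[]-cong F λ a → R.trans
        (sum[]-single G (λ b → indicator (ψ b ≟₂ d) (indicator (φ a ≟₁ b) (x a))) (φ a)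
          λ b b≢φa → indicator-zero (ψ b ≟₂ d) λ _ → indicator-no (φ a ≟₁ b) (b≢φa ∘ sym))
        (indicator-cong (ψ (φ a) ≟₂ d) λ _ → indicator-yes (φ a ≟₁ φ a) refl)))

  push-agree : ∀ {A B} (F : Finite A) (_≟_ : DecidableEquality B) (φ ψ : A → B) (x : A → C) →
    (∀ a → φ a ≡ ψ a ⊎ x a ≈ᶜ 0#) → ∀ b → push F _≟_ φ x b ≈ᶜ push F _≟_ ψ x b
  push-agree F _≟_ φ ψ x agree b = sum[]-cong F λ a → term a (agree a)
    where
    term : ∀ a → φ a ≡ ψ a ⊎ x a ≈ᶜ 0# → indicator (φ a ≟ b) (x a) ≈ᶜ indicator (ψ a ≟ b) (x a)
    term a (inj₁ φa≡ψa) = R.reflexive (cong (λ c → indicator (c ≟ b) (x a)) φa≡ψa)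
    term a (inj₂ xa≈0)  = R.trans (indicator-zero (φ a ≟ b) λ _ → xa≈0) (R.sym (indicator-zero (ψ a ≟ b) λ _ → xa≈0))

  push-id : ∀ {A} (F : Finite A) (_≟_ : DecidableEquality A) x a → push F _≟_ id x a ≈ᶜ x a
  push-id F _≟_ x a = R.trans
    (sum[]-single F (λ b → indicator (b ≟ a) (x b)) a λ b b≢a → indicator-no (b ≟ a) b≢a)
    (indicator-yes (a ≟ a) refl)

  push-+ : ∀ {A B} (F : Finite A) (_≟_ : DecidableEquality B) (φ : A → B) (x y : A → C) →
    ∀ b → push F _≟_ φ (λ a → x a ⊕ y a) b ≈ᶜ (push F _≟_ φ x b ⊕ push F _≟_ φ y b)
  push-+ F _≟_ φ x y b = R.trans
    (sum[]-cong F λ a → term a (φ a ≟ b))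
    (sum[]-+ F (λ a → indicator (φ a ≟ b) (x a)) (λ a → indicator (φ a ≟ b) (y a)))
    where
    term : ∀ a {P : Set} (d : Dec P) → indicator d (x a ⊕ y a) ≈ᶜ (indicator d (x a) ⊕ indicator d (y a))
    term a (yes _) = R.refl
    term a (no _)  = R.sym (R.+-identityˡ 0#)

  +-zero : ∀ {p q r} → (p ⊗ r) ≈ᶜ 0# → (q ⊗ r) ≈ᶜ 0# → ((p ⊕ q) ⊗ r) ≈ᶜ 0#
  +-zero {p} {q} {r} pr≈0 qr≈0 =
    R.trans (R.distribʳ r p q) (R.trans (R.+-cong pr≈0 qr≈0) (R.+-identityˡ 0#))

  outer-zero : ∀ {k l} c d → (k ⊗ l) ≈ᶜ 0# → ((k ⊗ c) ⊗ (l ⊗ d)) ≈ᶜ 0#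
  outer-zero {k} {l} c d kl≈0 = begin
    (k ⊗ c) ⊗ (l ⊗ d) ≈⟨ interchange k c l d ⟩
    (k ⊗ l) ⊗ (c ⊗ d) ≈⟨ R.*-congʳ kl≈0 ⟩
    0# ⊗ (c ⊗ d)      ≈⟨ R.zeroˡ (c ⊗ d) ⟩
    0#                ∎
    where
    open SetoidReasoning R.setoid
    open CommutativeSemigroupProperties R.*-commutativeSemigroup using (interchange)

  inner-zero : ∀ k l {c d} → (c ⊗ d) ≈ᶜ 0# → ((k ⊗ c) ⊗ (l ⊗ d)) ≈ᶜ 0#
  inner-zero k l {c} {d} cd≈0 = R.trans (R.*-cong (R.*-comm k c) (R.*-comm l d)) (outer-zero k l cd≈0)

  push-restrict-complement : ∀ {A B : Set} {P Q : A → Set} (F : Finite A) (_≟_ : DecidableEquality B) (φ : A → B)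
    (P? : ∀ a → Dec (P a)) (Q? : ∀ a → Dec (Q a)) → (∀ a → P a → ¬ Q a) → (∀ a → ¬ P a → Q a) →
    ∀ x b {c d} → c ≈ᶜ push F _≟_ φ (restrict P? x) b → d ≈ᶜ push F _≟_ φ (restrict Q? x) b →
    (c ⊕ d) ≈ᶜ push F _≟_ φ x b
  push-restrict-complement F _≟_ φ P? Q? P⇒¬Q ¬P⇒Q x b c≈ d≈ = R.trans (R.+-cong c≈ d≈) (R.trans
    (R.sym (push-+ F _≟_ φ (restrict P? x) (restrict Q? x) b))
    (push-cong F _≟_ φ (restrict-complement P? Q? P⇒¬Q ¬P⇒Q x) b))

  module _ {A : Set} (F : Finite A) (_≟_ : DecidableEquality A) (ρ : A → A) (stay move : A → C) where

    flow : (A → C) → A → C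
    flow x a = (stay a ⊗ x a) ⊕ push F _≟_ ρ (λ b → move b ⊗ x b) a

    flow-total : (∀ a → (stay a ⊕ move a) ≈ᶜ 1#) → ∀ x → sum[ F ] (flow x) ≈ᶜ sum[ F ] x
    flow-total split x = begin
      sum[ F ] (flow x)
        ≈⟨ sum[]-+ F (λ a → stay a ⊗ x a) (push F _≟_ ρ (λ b → move b ⊗ x b)) ⟩
      sum[ F ] (λ a → stay a ⊗ x a) ⊕ sum[ F ] (push F _≟_ ρ (λ b → move b ⊗ x b))
        ≈⟨ R.+-congˡ (push-total F _≟_ ρ F (λ b → move b ⊗ x b)) ⟩
      sum[ F ] (λ a → stay a ⊗ x a) ⊕ sum[ F ] (λ b → move b ⊗ x b)
        ≈⟨ sum[]-+ F (λ a → stay a ⊗ x a) (λ b → move b ⊗ x b) ⟨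
      sum[ F ] (λ a → (stay a ⊗ x a) ⊕ (move a ⊗ x a))
        ≈⟨ sum[]-cong F (λ a → R.trans (R.sym (R.distribʳ (x a) (stay a) (move a)))
             (R.trans (R.*-congʳ (split a)) (R.*-identityˡ (x a)))) ⟩
      sum[ F ] x ∎
      where open SetoidReasoning R.setoid

    flow-closed : (P : C → Set) → P 0# → (∀ {c d} → P c → P d → P (c ⊕ d)) →
      (∀ {c d} → P c → P d → P (c ⊗ d)) → (∀ a → P (stay a)) → (∀ a → P (move a)) →
      ∀ {x} → (∀ a → P (x a)) → ∀ a → P (flow x a)
    flow-closed P P0 P+ P* P-stay P-move Px a =
      P+ (P* (P-stay a) (Px a)) (push-closed F _≟_ ρ P P0 P+ (λ b → P* (P-move b) (Px b)) a)

    -- Expanding two new masses yields four kinds of products: of two masses that stay, of two that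
    -- move, and mixed ones. Weights can be ignored except in the mixed products, where the
    -- hypothesis retains them because it may hold only thanks to their being orthogonal.
    flow-⟂ : (_⟂_ : C → C → Set) → (∀ {c d} → c ⟂ d → d ⟂ c) → (∀ c → 0# ⟂ c) →
      (∀ {c d k} → c ⟂ k → d ⟂ k → (c ⊕ d) ⟂ k) → (∀ k l {c d} → c ⟂ d → (k ⊗ c) ⟂ (l ⊗ d)) →
      (Clash : A → A → Set) → (∀ {a b} → Clash a b → Clash b a) → ∀ x →
      (∀ a b → Clash a b → x a ⟂ x b) →
      (∀ a b → Clash (ρ a) (ρ b) → x a ⟂ x b) →
      (∀ a b → Clash a (ρ b) → (stay a ⊗ x a) ⟂ (move b ⊗ x b)) →
      ∀ a b → Clash a b → flow x a ⟂ flow x b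
    flow-⟂ _⟂_ ⟂-sym 0-⟂ +-⟂ *-⟂ Clash clash-sym x xx ρρ xρ a b clash =
      +-⟂ (⟂-sym (+-⟂ (⟂-sym p⟂r) (⟂-sym p⟂s))) (⟂-sym (+-⟂ (⟂-sym q⟂r) (⟂-sym q⟂s)))
      where
      moved : A → C
      moved c = move c ⊗ x c
      pushed-⟂ : ∀ k a → (∀ c → ρ c ≡ a → moved c ⟂ k) → push F _≟_ ρ moved a ⟂ k
      pushed-⟂ k a = push-⟂ F _≟_ ρ _⟂_ 0-⟂ +-⟂ moved a k
      p⟂r : (stay a ⊗ x a) ⟂ (stay b ⊗ x b)
      p⟂r = *-⟂ (stay a) (stay b) (xx a b clash)
      p⟂s : (stay a ⊗ x a) ⟂ push F _≟_ ρ moved b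
      p⟂s = ⟂-sym (pushed-⟂ (stay a ⊗ x a) b λ c ρc≡b →
        ⟂-sym (xρ a c (subst (Clash a) (sym ρc≡b) clash)))
      q⟂r : push F _≟_ ρ moved a ⟂ (stay b ⊗ x b)
      q⟂r = pushed-⟂ (stay b ⊗ x b) a λ c ρc≡a →
        ⟂-sym (xρ b c (subst (Clash b) (sym ρc≡a) (clash-sym clash)))
      q⟂s : push F _≟_ ρ moved a ⟂ push F _≟_ ρ moved b
      q⟂s = pushed-⟂ (push F _≟_ ρ moved b) a λ c ρc≡a → ⟂-sym (pushed-⟂ (moved c) b λ d ρd≡b →
        *-⟂ (move d) (move c) (ρρ d c (subst₂ Clash (sym ρd≡b) (sym ρc≡a) (clash-sym clash))))

    -- A vertex outside the image of ρ receives nothing, so only the share that stays there matters.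
    flow-⟂-unhit : (_⟂_ : C → C → Set) → (∀ c → 0# ⟂ c) → (∀ {c d k} → c ⟂ k → d ⟂ k → (c ⊕ d) ⟂ k) →
      ∀ x a k → (∀ b → ρ b ≢ a) → (stay a ⊗ x a) ⟂ k → flow x a ⟂ k
    flow-⟂-unhit _⟂_ 0-⟂ +-⟂ x a k ρ≢a stayed = +-⟂ stayed
      (push-⟂ F _≟_ ρ _⟂_ 0-⟂ +-⟂ (λ b → move b ⊗ x b) a k λ b ρb≡a → ⊥-elim (ρ≢a b ρb≡a))

    flow-start : (∀ a → stay a ≈ᶜ 1#) → (∀ a → move a ≈ᶜ 0#) → ∀ x a → flow x a ≈ᶜ x a
    flow-start stay≈1 move≈0 x a = R.trans
      (R.+-cong (R.trans (R.*-congʳ (stay≈1 a)) (R.*-identityˡ (x a)))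
        (push-zero F _≟_ ρ a λ b _ → R.trans (R.*-congʳ (move≈0 b)) (R.zeroˡ (x b))))
      (R.+-identityʳ (x a))

    flow-end : (∀ a → stay a ≈ᶜ 0#) → (∀ a → move a ≈ᶜ 1#) →
      ∀ x a → flow x a ≈ᶜ push F _≟_ ρ x a
    flow-end stay≈0 move≈1 x a = R.trans
      (R.+-cong (R.trans (R.*-congʳ (stay≈0 a)) (R.zeroˡ (x a)))
        (push-cong F _≟_ ρ (λ b → R.trans (R.*-congʳ (move≈1 b)) (R.*-identityˡ (x b))) a))
      (R.+-identityˡ _)

-- Tiles

-- A tile forgets the row of a horizontal edge: V j is the vertical edge in
-- column j, and H i either of the two edges joining columns i and i + 1.
data Tile : Set where
  V H : ℕ → Tile

Covers : Tile → ℕ → Set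
Covers (V j) c = c ≡ j
Covers (H i) c = c ≡ i ⊎ c ≡ suc i

-- Overlap of distinct tiles. Equal tiles do not clash: two different edges with the same tile H i
-- lie in different rows and belong together in a perfect matching.
Clash : Tile → Tile → Set
Clash (V _) (V _) = ⊥
Clash (V j) (H i) = Covers (H i) j
Clash (H i) (V j) = Covers (H i) j
Clash (H i) (H j) = i ≡ suc j ⊎ j ≡ suc i

Clash-sym : ∀ s t → Clash s t → Clash t s
Clash-sym (V _) (H _) c        = c
Clash-sym (H _) (V _) c        = c
Clash-sym (H _) (H _) (inj₁ e) = inj₂ e
Clash-sym (H _) (H _) (inj₂ e) = inj₁ e

overlap⇒≡⊎Clash : ∀ s t {c} → Covers s c → Covers t c → s ≡ t ⊎ Clash s t
overlap⇒≡⊎Clash (V _) (V _) refl     refl     = inj₁ refl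
overlap⇒≡⊎Clash (V _) (H _) refl     q        = inj₂ q
overlap⇒≡⊎Clash (H _) (V _) p        refl     = inj₂ p
overlap⇒≡⊎Clash (H _) (H _) (inj₁ p) (inj₁ q) = inj₁ (cong H (trans (sym p) q))
overlap⇒≡⊎Clash (H _) (H _) (inj₁ p) (inj₂ q) = inj₂ (inj₁ (trans (sym p) q))
overlap⇒≡⊎Clash (H _) (H _) (inj₂ p) (inj₁ q) = inj₂ (inj₂ (trans (sym q) p))
overlap⇒≡⊎Clash (H _) (H _) (inj₂ p) (inj₂ q) = inj₁ (cong H (ℕ.suc-injective (trans (sym p) q)))

-- Recursion by twos lets the indices of `Parity` and the size of the grid reduce by computation,
-- which 2 * b would not.
double : ℕ → ℕ
double zero    = zero
double (suc b) = suc (suc (double b))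

double-injective : ∀ {a b} → double a ≡ double b → a ≡ b
double-injective {zero}  {zero}  _ = refl
double-injective {suc a} {suc b} p = cong suc (double-injective (ℕ.suc-injective (ℕ.suc-injective p)))

double≢1+double : ∀ a b → double a ≢ suc (double b)
double≢1+double (suc a) (suc b) p = double≢1+double a b (ℕ.suc-injective (ℕ.suc-injective p))

⌊double/2⌋ : ∀ b → ⌊ double b /2⌋ ≡ b
⌊double/2⌋ zero    = refl
⌊double/2⌋ (suc b) = cong suc (⌊double/2⌋ b)

⌊1+double/2⌋ : ∀ b → ⌊ suc (double b) /2⌋ ≡ b
⌊1+double/2⌋ zero    = refl
⌊1+double/2⌋ (suc b) = cong suc (⌊1+double/2⌋ b)

data Parity : ℕ → Set where
  even : ∀ b → Parity (double b)
  odd  : ∀ b → Parity (suc (double b))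

parity : ∀ n → Parity n
parity zero          = even zero
parity (suc zero)    = odd zero
parity (suc (suc n)) = step (parity n)
  where
  step : ∀ {n} → Parity n → Parity (suc (suc n))
  step (even b) = even (suc b)
  step (odd b)  = odd (suc b)

block : Tile → ℕ
block (V j) = ⌊ j /2⌋
block (H i) = ⌊ i /2⌋

-- Folds b positive s t: the tile s of block b is moved to t, a vertex of the
-- cross-polytope on V (2b) (positive) and H (2b) (negative).
data Folds : ℕ → Bool → Tile → Tile → Set where
  V-even : ∀ b → Folds b true  (V (double b))       (V (double b))
  V-odd  : ∀ b → Folds b true  (V (suc (double b))) (V (double b))
  H-even : ∀ b → Folds b false (H (double b))       (H (double b))
  H-odd  : ∀ b → Folds b true  (H (suc (double b))) (V (double b))

-- H (2b) covers the columns 2b and 2b + 1, and each tile folded onto V (2b) covers one of them.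
Folds-opposite : ∀ {b s s′ t t′} → Folds b true s s′ → Folds b false t t′ → Clash s t
Folds-opposite (V-even b) (H-even .b) = inj₁ refl
Folds-opposite (V-odd b)  (H-even .b) = inj₂ refl
Folds-opposite (H-odd b)  (H-even .b) = inj₁ refl

Folds-positive : ∀ {b s t} → Folds b true s t → t ≡ V (double b)
Folds-positive (V-even b) = refl
Folds-positive (V-odd b)  = refl
Folds-positive (H-odd b)  = refl

Folds-negative : ∀ {b s t} → Folds b false s t → t ≡ H (double b)
Folds-negative (H-even b) = refl

Folds-Clash-opposite : ∀ {a b s s′ t t′} → Folds a true s s′ → Folds b false t t′ → Clash s′ t′ → Clash s t
Folds-Clash-opposite {a} {b} p q c = Folds-opposite (subst (λ x → Folds x true _ _)
  (same (subst₂ Clash (Folds-positive p) (Folds-negative q) c)) p) q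
  where
  same : Clash (V (double a)) (H (double b)) → a ≡ b
  same (inj₁ e) = double-injective e
  same (inj₂ e) = ⊥-elim (double≢1+double a b e)

-- The only images that clash are V (2b) and H (2b) of one block, and everything folded onto the
-- first clashes with everything folded onto the second. In other words, the folding is simplicial.
Folds-reflects-Clash : ∀ {a b g h s s′ t t′} → Folds a g s s′ → Folds b h t t′ → Clash s′ t′ → Clash s t
Folds-reflects-Clash {g = true}  {true}  p q c = ⊥-elim (subst₂ Clash (Folds-positive p) (Folds-positive q) c)
Folds-reflects-Clash {g = true}  {false} p q c = Folds-Clash-opposite p q c
Folds-reflects-Clash {g = false} {true} {s} {s′} {t} {t′} p q c =
  Clash-sym t s (Folds-Clash-opposite q p (Clash-sym s′ t′ c))
Folds-reflects-Clash {g = false} {false} (H-even a) (H-even b) (inj₁ e) = ⊥-elim (double≢1+double a b e)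
Folds-reflects-Clash {g = false} {false} (H-even a) (H-even b) (inj₂ e) = ⊥-elim (double≢1+double b a e)

double≡1+⇒⌊/2⌋< : ∀ {b i} → double b ≡ suc i → ⌊ i /2⌋ ℕ.< b
double≡1+⇒⌊/2⌋< {suc b} refl = ℕ.s≤s (ℕ.≤-reflexive (⌊1+double/2⌋ b))

-- Whatever clashes with the image of a tile clashes with the tile itself, unless
-- it lies in an earlier block and has therefore been moved before.
Folds-Clash : ∀ {b g t t′} s → Folds b g t t′ → Clash s t′ → Clash s t ⊎ block s ℕ.< b
Folds-Clash (V _) (H-even b) c        = inj₁ c
Folds-Clash (H _) (H-even b) c        = inj₁ c
Folds-Clash (H _) (V-even b) c        = inj₁ c
-- A horizontal tile meeting column 2b is H (2b), which meets column 2b + 1 as well, or H (2b - 1),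
-- which belongs to the previous block.
Folds-Clash (H _) (V-odd b)  (inj₁ e) = inj₁ (inj₂ (cong suc e))
Folds-Clash (H _) (V-odd b)  (inj₂ e) = inj₂ (double≡1+⇒⌊/2⌋< e)
Folds-Clash (H _) (H-odd b)  (inj₁ e) = inj₁ (inj₂ (cong suc e))
Folds-Clash (H _) (H-odd b)  (inj₂ e) = inj₂ (double≡1+⇒⌊/2⌋< e)

Folds-V⇒positive : ∀ {b g j t} → Folds b g (V j) t → g ≡ true
Folds-V⇒positive (V-even b) = refl
Folds-V⇒positive (V-odd b)  = refl

Folds-H-double⇒negative : ∀ {b g c s t} → s ≡ H (double c) → Folds b g s t → g ≡ false
Folds-H-double⇒negative {c = c} p (H-odd b)  = ⊥-elim (double≢1+double c b (sym (H-injective p)))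
  where
  H-injective : ∀ {i j} → H i ≡ H j → i ≡ j
  H-injective refl = refl
Folds-H-double⇒negative p (H-even b) = refl

Folds-onto-H : ∀ {b g s i} → Folds b g s (H i) → i ≡ double b
Folds-onto-H (H-even b) = refl

double-mono-≤ : ∀ {a b} → a ℕ.≤ b → double a ℕ.≤ double b
double-mono-≤ ℕ.z≤n       = ℕ.z≤n
double-mono-≤ (ℕ.s≤s a≤b) = ℕ.s≤s (ℕ.s≤s (double-mono-≤ a≤b))

double≡*2 : ∀ b → double b ≡ b ℕ.* 2
double≡*2 zero    = refl
double≡*2 (suc b) = cong (2 ℕ.+_) (double≡*2 b)

≤double⇒⌊/2⌋≤ : ∀ {n k} → n ℕ.≤ double k → ⌊ n /2⌋ ℕ.≤ k
≤double⇒⌊/2⌋≤ {n} {k} n≤2k = subst (⌊ n /2⌋ ℕ.≤_) (⌊double/2⌋ k) (ℕ.⌊n/2⌋-mono n≤2k)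

≤1+double⇒⌊/2⌋≤ : ∀ {n k} → n ℕ.≤ suc (double k) → ⌊ n /2⌋ ℕ.≤ k
≤1+double⇒⌊/2⌋≤ {n} {k} n≤1+2k = subst (⌊ n /2⌋ ℕ.≤_) (⌊1+double/2⌋ k) (ℕ.⌊n/2⌋-mono n≤1+2k)

-- Perfect matchings of the 2 × n grid

abstract
  finite-≟ : ∀ {A} → Finite A → DecidableEquality A
  finite-≟ (_ , A↔Fin) a b = map′
    (λ p → trans (sym (Inverse.strictlyInverseʳ A↔Fin a)) (trans (cong (Inverse.from A↔Fin) p) (Inverse.strictlyInverseʳ A↔Fin b)))
    (cong (Inverse.to A↔Fin)) (Inverse.to A↔Fin a Fin.≟ Inverse.to A↔Fin b)

inject₁-or-suc : ∀ {m} (j : Fin (suc m)) (i : Fin m) → Covers (H (toℕ i)) (toℕ j) → j ≡ inject₁ i ⊎ j ≡ suc i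
inject₁-or-suc j i (inj₁ e) = inj₁ (Fin.toℕ-injective (trans e (sym (Fin.toℕ-inject₁ i))))
inject₁-or-suc j i (inj₂ e) = inj₂ (Fin.toℕ-injective e)

covers? : ∀ t c → Dec (Covers t c)
covers? (V j) c = c ℕ.≟ j
covers? (H i) c = (c ℕ.≟ i) ⊎-dec (c ℕ.≟ suc i)

-- With m + 1 columns, the positions of horizontal edges form `Fin m` and no predecessor remains in
-- the types.
module Strip (m : ℕ) where

  G : Graph
  G = Grid 2 (suc m)

  open Graph G using (Incident)

  E : Set
  E = Graph.Edge G

  K : SimplicialComplex
  K = perfectMatchingComplex G

  tile : E → Tile
  tile (inj₁ (_ , j)) = V (toℕ j)
  tile (inj₂ (_ , i)) = H (toℕ i)

  -- What a horizontal edge needs besides its tile to be determined. A vertical edge meets both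
  -- rows; zero is a default for it.
  row : E → Fin 2
  row (inj₁ _)       = zero
  row (inj₂ (r , _)) = r

  tile-row-injective : ∀ e f → tile e ≡ tile f → row e ≡ row f → e ≡ f
  tile-row-injective (inj₁ (zero , j)) (inj₁ (zero , i)) p _ = cong (λ j → inj₁ (zero , j)) (Fin.toℕ-injective (V-injective p))
    where
    V-injective : ∀ {a b} → V a ≡ V b → a ≡ b
    V-injective refl = refl
  tile-row-injective (inj₂ (r , j)) (inj₂ (.r , i)) p refl = cong (λ j → inj₂ (r , j)) (Fin.toℕ-injective (H-injective p))
    where
    H-injective : ∀ {a b} → H a ≡ H b → a ≡ b
    H-injective refl = refl

  Incident-covers : ∀ {r c} e → Incident (r , c) e → Covers (tile e) (toℕ c)
  Incident-covers (inj₁ (zero , _)) (inj₁ refl) = refl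
  Incident-covers (inj₁ (zero , _)) (inj₂ refl) = refl
  Incident-covers (inj₂ (_ , i))    (inj₁ refl) = inj₁ (Fin.toℕ-inject₁ i)
  Incident-covers (inj₂ (_ , i))    (inj₂ refl) = inj₂ refl

  Incident-horizontal : ∀ {r s c i} → Incident (r , c) (inj₂ (s , i)) → r ≡ s
  Incident-horizontal (inj₁ p) = ,-injectiveˡ p
  Incident-horizontal (inj₂ p) = ,-injectiveˡ p

  vertical-incident : ∀ r c → Incident (r , c) (inj₁ (zero , c))
  vertical-incident zero       c = inj₁ refl
  vertical-incident (suc zero) c = inj₂ refl

  horizontal-incident : ∀ r c i → Covers (H (toℕ i)) (toℕ c) → Incident (r , c) (inj₂ (r , i))
  horizontal-incident r c i p = incident (inject₁-or-suc c i p)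
    where
    incident : c ≡ inject₁ i ⊎ c ≡ suc i → Incident (r , c) (inj₂ (r , i))
    incident (inj₁ e) = inj₁ (cong (r ,_) e)
    incident (inj₂ e) = inj₂ (cong (r ,_) e)

  Incident-same-tile : ∀ v e f → Incident v e → Incident v f → tile e ≡ tile f → e ≡ f
  Incident-same-tile v e f p q t = tile-row-injective e f t (same-row e f p q t)
    where
    same-row : ∀ e f → Incident v e → Incident v f → tile e ≡ tile f → row e ≡ row f
    same-row (inj₁ _) (inj₁ _) p q t = refl
    same-row (inj₂ _) (inj₂ _) p q t = trans (sym (Incident-horizontal p)) (Incident-horizontal q)

  module _ {M : Subset E} (perfect : IsPerfectMatching G M) where
    private
      matching : IsMatching G M
      matching = proj₁ perfect

    vertical-horizontal-disjoint : ∀ r j i → inj₁ (zero , j) ∈ M → inj₂ (r , i) ∈ M → ¬ Covers (H (toℕ i)) (toℕ j)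
    vertical-horizontal-disjoint r j i v∈M h∈M p
      with () ← matching _ _ (r , j) v∈M h∈M (vertical-incident r j) (horizontal-incident r j i p)

    -- Reading columns from the left, the two horizontal edges of a column
    -- occur in a perfect matching only together.
    horizontal-twins : ∀ k i → toℕ i ℕ.< k → ∀ r s → inj₂ (r , i) ∈ M → inj₂ (s , i) ∈ M
    horizontal-twins (suc k) i (ℕ.s≤s i≤k) r s h∈M = cases (proj₂ perfect (s , inject₁ i))
      where
      cases : (∃ λ e → e ∈ M × Incident (s , inject₁ i) e) → inj₂ (s , i) ∈ M
      cases (inj₁ (zero , j) , e∈M , inc) = ⊥-elim
        (vertical-horizontal-disjoint r j i e∈M h∈M
          (inj₁ (trans (sym (Incident-covers (inj₁ (zero , j)) inc)) (Fin.toℕ-inject₁ i))))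
      cases (inj₂ (s′ , i′) , e∈M , inj₁ p) = subst (_∈ M) (sym (cong inj₂ (cong₂ _,_ (,-injectiveˡ p) (Fin.inject₁-injective (,-injectiveʳ p))))) e∈M
      -- An edge of row s ending in this column would, by induction, have its twin in row r. That
      -- twin shares a vertex with the given edge but lies one position to its left.
      cases (inj₂ (s′ , i′) , e∈M , inj₂ p) = ⊥-elim (ℕ.1+n≢n (trans (sym i≡1+i′) (cong toℕ i≡i′)))
        where
        i≡1+i′ : toℕ i ≡ suc (toℕ i′)
        i≡1+i′ = trans (sym (Fin.toℕ-inject₁ i)) (cong toℕ (,-injectiveʳ p))
        twin : inj₂ (r , i′) ∈ M
        twin = horizontal-twins k i′ (subst (ℕ._≤ k) i≡1+i′ i≤k) s′ r e∈M
        i≡i′ : i ≡ i′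
        i≡i′ = ,-injectiveʳ (inj₂-injective (matching _ _ (r , inject₁ i) h∈M twin (inj₁ refl)
          (inj₂ (cong (r ,_) (,-injectiveʳ p)))))

    horizontal-consecutive : ∀ r s i j → inj₂ (r , i) ∈ M → inj₂ (s , j) ∈ M → toℕ i ≢ suc (toℕ j)
    horizontal-consecutive r s i j hi∈M hj∈M p = ℕ.1+n≢n (trans (sym p) (cong toℕ i≡j))
      where
      i≡j : i ≡ j
      i≡j = ,-injectiveʳ (inj₂-injective (matching _ _ (r , suc j) hi∈M
        (horizontal-twins (suc (toℕ j)) j ℕ.≤-refl s r hj∈M)
        (horizontal-incident r (suc j) i (inj₁ (sym p))) (inj₂ refl)))

    perfect⇒¬Clash : ∀ e f → e ∈ M → f ∈ M → ¬ Clash (tile e) (tile f)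
    perfect⇒¬Clash (inj₁ (zero , j)) (inj₂ (r , i)) e∈M f∈M = vertical-horizontal-disjoint r j i e∈M f∈M
    perfect⇒¬Clash (inj₂ (r , i)) (inj₁ (zero , j)) e∈M f∈M = vertical-horizontal-disjoint r j i f∈M e∈M
    perfect⇒¬Clash (inj₂ (r , i)) (inj₂ (s , j)) e∈M f∈M (inj₁ p) = horizontal-consecutive r s i j e∈M f∈M p
    perfect⇒¬Clash (inj₂ (r , i)) (inj₂ (s , j)) e∈M f∈M (inj₂ p) = horizontal-consecutive s r j i f∈M e∈M p

  -- The non-trivial half of flagness. A set without clashes is completed by the missing twins of
  -- its horizontal edges and by the vertical edge of every column still uncovered.
  module Completion (σ : Subset E) (¬clash : ∀ e f → e ∈ σ → f ∈ σ → ¬ Clash (tile e) (tile f)) where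

    chosen : Fin m → Bool
    chosen i = σ (inj₂ (zero , i)) ∨ σ (inj₂ (suc zero , i))

    chosen⇒∈ : ∀ i → T (chosen i) → ∃ λ r → inj₂ (r , i) ∈ σ
    chosen⇒∈ i c = cases (Equivalence.to T-∨ c)
      where
      cases : _ → ∃ λ r → inj₂ (r , i) ∈ σ
      cases (inj₁ p) = zero , p
      cases (inj₂ p) = suc zero , p

    ∈⇒chosen : ∀ r i → inj₂ (r , i) ∈ σ → T (chosen i)
    ∈⇒chosen zero       i p = Equivalence.from T-∨ (inj₁ p)
    ∈⇒chosen (suc zero) i p = Equivalence.from T-∨ (inj₂ p)

    occupied? : ∀ c → Dec (∃ λ i → T (chosen i) × Covers (H (toℕ i)) (toℕ {suc m} c))
    occupied? c = Fin.any? λ i → T? (chosen i) ×-dec covers? (H (toℕ i)) (toℕ c)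

    M : Subset E
    M (inj₁ (_ , j)) = isYes (¬? (occupied? j))
    M (inj₂ (_ , i)) = chosen i

    M-free : ∀ j → inj₁ (zero , j) ∈ M → ¬ (∃ λ i → T (chosen i) × Covers (H (toℕ i)) (toℕ j))
    M-free j = toWitness {a? = ¬? (occupied? j)}

    M-¬Clash : ∀ e f → e ∈ M → f ∈ M → ¬ Clash (tile e) (tile f)
    M-¬Clash (inj₁ (zero , j)) (inj₂ (_ , i)) e∈M f∈M c = M-free j e∈M (i , f∈M , c)
    M-¬Clash (inj₂ (_ , i)) (inj₁ (zero , j)) e∈M f∈M c = M-free j f∈M (i , e∈M , c)
    M-¬Clash (inj₂ (_ , i)) (inj₂ (_ , j)) e∈M f∈M =
      ¬clash _ _ (proj₂ (chosen⇒∈ i e∈M)) (proj₂ (chosen⇒∈ j f∈M))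

    M-matching : IsMatching G M
    M-matching e f v e∈M f∈M p q = cases (overlap⇒≡⊎Clash (tile e) (tile f) (Incident-covers e p) (Incident-covers f q))
      where
      cases : tile e ≡ tile f ⊎ Clash (tile e) (tile f) → e ≡ f
      cases (inj₁ t) = Incident-same-tile v e f p q t
      cases (inj₂ c) = ⊥-elim (M-¬Clash e f e∈M f∈M c)

    M-covers : ∀ v → ∃ λ e → e ∈ M × Incident v e
    M-covers (r , c) = cases (occupied? c)
      where
      cases : Dec (∃ λ i → T (chosen i) × Covers (H (toℕ i)) (toℕ c)) → ∃ λ e → e ∈ M × Incident (r , c) e
      cases (yes (i , ch , p)) = inj₂ (r , i) , ch , horizontal-incident r c i p
      cases (no ¬p)            = inj₁ (zero , c) , fromWitness {a? = ¬? (occupied? c)} ¬p , vertical-incident r c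

    σ⊆M : σ ⊆ M
    σ⊆M (inj₁ (zero , j)) e∈σ = fromWitness {a? = ¬? (occupied? j)} λ (i , ch , p) →
      ¬clash _ _ e∈σ (proj₂ (chosen⇒∈ i ch)) p
    σ⊆M (inj₂ (r , i)) e∈σ = ∈⇒chosen r i e∈σ

  Face⇒¬Clash : ∀ σ → SimplicialComplex.Face K σ → ∀ e f → e ∈ σ → f ∈ σ → ¬ Clash (tile e) (tile f)
  Face⇒¬Clash σ (M , perfect , σ⊆M) e f e∈σ f∈σ = perfect⇒¬Clash perfect e f (σ⊆M e e∈σ) (σ⊆M f f∈σ)

  ¬Clash⇒Face : ∀ σ → (∀ e f → e ∈ σ → f ∈ σ → ¬ Clash (tile e) (tile f)) → SimplicialComplex.Face K σ
  ¬Clash⇒Face σ ¬clash = C.M , (C.M-matching , C.M-covers) , C.σ⊆M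
    where module C = Completion σ ¬clash

  -- The folding of the edges of the grid

  foldTo : ∀ {n} → Fin n → ∀ {k} → Parity k → Fin n
  foldTo j (even _) = j
  foldTo j (odd _)  = Fin.pred j

  -- Images in row zero, whatever the row of the argument, leave a single edge for each vertex of
  -- the cross-polytope.
  horizontalTo : Fin 2 × Fin m → ∀ {k} → Parity k → E
  horizontalTo (_ , i) (even _) = inj₂ (zero , i)
  horizontalTo (_ , i) (odd _)  = inj₁ (zero , inject₁ (Fin.pred i))

  isEven : ∀ {k} → Parity k → Bool
  isEven (even _) = true
  isEven (odd _)  = false

  ρ : E → E
  ρ (inj₁ (z , j)) = inj₁ (z , foldTo j (parity (toℕ j)))
  ρ (inj₂ (r , i)) = horizontalTo (r , i) (parity (toℕ i))

  positive : E → Bool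
  positive (inj₁ _)       = true
  positive (inj₂ (_ , i)) = not (isEven (parity (toℕ i)))

  toℕ-pred : ∀ {n} (j : Fin n) → toℕ (Fin.pred j) ≡ ℕ.pred (toℕ j)
  toℕ-pred zero    = refl
  toℕ-pred (suc j) = Fin.toℕ-inject₁ j

  ρ-Folds : ∀ e → Folds (block (tile e)) (positive e) (tile e) (tile (ρ e))
  ρ-Folds (inj₁ (_ , j)) = cases j (parity (toℕ j)) refl
    where
    -- The index k is detached from `toℕ j`, since matching on the parity would otherwise have to
    -- unify `toℕ j` with `double b`.
    cases : ∀ {n} (j : Fin n) {k} (p : Parity k) → toℕ j ≡ k → Folds ⌊ toℕ j /2⌋ true (V (toℕ j)) (V (toℕ (foldTo j p)))
    cases j (even b) eq = subst₂ (λ a c → Folds a true (V c) (V c)) (trans (sym (⌊double/2⌋ b)) (cong ⌊_/2⌋ (sym eq))) (sym eq) (V-even b)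
    cases j (odd b)  eq = subst₂ (λ x y → Folds ⌊ x /2⌋ true (V x) (V y)) (sym eq) (trans (cong ℕ.pred (sym eq)) (sym (toℕ-pred j)))
      (subst (λ a → Folds a true (V (suc (double b))) (V (double b))) (sym (⌊1+double/2⌋ b)) (V-odd b))
  ρ-Folds (inj₂ (r , i)) = cases i (parity (toℕ i)) refl
    where
    cases : ∀ (i : Fin m) {k} (p : Parity k) → toℕ i ≡ k →
      Folds ⌊ toℕ i /2⌋ (not (isEven p)) (H (toℕ i)) (tile (horizontalTo (r , i) p))
    cases i (even b) eq = subst₂ (λ a c → Folds a false (H c) (H c)) (trans (sym (⌊double/2⌋ b)) (cong ⌊_/2⌋ (sym eq))) (sym eq) (H-even b)
    cases i (odd b)  eq = subst₂ (λ x y → Folds ⌊ x /2⌋ true (H x) (V y)) (sym eq)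
      (trans (cong ℕ.pred (sym eq)) (sym (trans (Fin.toℕ-inject₁ (Fin.pred i)) (toℕ-pred i))))
      (subst (λ a → Folds a true (H (suc (double b))) (V (double b))) (sym (⌊1+double/2⌋ b)) (H-odd b))

  ρ-row : ∀ e → row (ρ e) ≡ zero
  ρ-row (inj₁ _)       = refl
  ρ-row (inj₂ (r , i)) = cases (parity (toℕ i))
    where
    cases : ∀ {k} (p : Parity k) → row (horizontalTo (r , i) p) ≡ zero
    cases (even _) = refl
    cases (odd _)  = refl

-- Folding a complex of tiles

open Pushforward _≅_ _+_ _*_ 0ℝ 1ℝ ℝ-isCommutativeSemiring

indicator-continuous : ∀ {I P : Set} (d : Dec P) {φ : Functional I} → IsContinuous φ →
  IsContinuous (λ q → indicator d (φ q))
indicator-continuous (yes _) φ-cont = φ-cont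
indicator-continuous (no _)  φ-cont = const-continuous 0ℝ

push-continuous : ∀ {I A B : Set} (F : Finite A) (_≟_ : DecidableEquality B) (φ : A → B) (x : (I → ℝ) → A → ℝ) →
  (∀ a → IsContinuous (λ q → x q a)) → ∀ b → IsContinuous (λ q → push F _≟_ φ (x q) b)
push-continuous F _≟_ φ x x-cont b =
  ∑[]-continuous F {λ a q → indicator (φ a ≟ b) (x q a)} λ a → indicator-continuous (φ a ≟ b) (x-cont a)

flow-continuous : ∀ {I A : Set} (F : Finite A) (_≟_ : DecidableEquality A) (ρ : A → A)
  (stay move x : (I → ℝ) → A → ℝ) → (∀ a → IsContinuous (λ q → stay q a)) →
  (∀ a → IsContinuous (λ q → move q a)) → (∀ a → IsContinuous (λ q → x q a)) →
  ∀ a → IsContinuous (λ q → flow F _≟_ ρ (stay q) (move q) (x q) a)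
flow-continuous F _≟_ ρ stay move x stay-cont move-cont x-cont a =
  +-continuous {φ = λ q → stay q a * x q a} {λ q → push F _≟_ ρ (λ b → move q b * x q b) a}
    (*-continuous {φ = λ q → stay q a} {λ q → x q a} (stay-cont a) (x-cont a))
    (push-continuous F _≟_ ρ (λ q b → move q b * x q b)
      (λ b → *-continuous {φ = λ q → move q b} {λ q → x q b} (move-cont b) (x-cont b)) a)

-- Opaque, so that products of reals are not compared by unfolding their Cauchy
-- proofs.
infix 4 _⟂_
abstract
  _⟂_ : ℝ → ℝ → Set
  x ⟂ y = x * y ≅ 0ℝ

  *≅0⇒⟂ : ∀ x y → x * y ≅ 0ℝ → x ⟂ y
  *≅0⇒⟂ x y p = p

  ⟂⇒*≅0 : ∀ x y → x ⟂ y → x * y ≅ 0ℝ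
  ⟂⇒*≅0 x y p = p

⟂-sym : ∀ {x y} → x ⟂ y → y ⟂ x
⟂-sym {x} {y} p = *≅0⇒⟂ y x (≅-trans {y * x} {x * y} {0ℝ} (*-comm y x) (⟂⇒*≅0 x y p))

0-⟂ : ∀ x → 0ℝ ⟂ x
0-⟂ x = *≅0⇒⟂ 0ℝ x (*-zeroˡ x)

+-⟂ : ∀ {x y z} → x ⟂ z → y ⟂ z → x + y ⟂ z
+-⟂ {x} {y} {z} p q = *≅0⇒⟂ (x + y) z (+-zero {x} {y} {z} (⟂⇒*≅0 x z p) (⟂⇒*≅0 y z q))

*-⟂-inner : ∀ k l {x y} → x ⟂ y → k * x ⟂ l * y
*-⟂-inner k l {x} {y} p = *≅0⇒⟂ (k * x) (l * y) (inner-zero k l {x} {y} (⟂⇒*≅0 x y p))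

*-⟂-outer : ∀ {k l} x y → k ⟂ l → k * x ⟂ l * y
*-⟂-outer {k} {l} x y p = *≅0⇒⟂ (k * x) (l * y) (outer-zero {k} {l} x y (⟂⇒*≅0 k l p))

⟂-resp-≅ : ∀ {x y z} → x ≅ y → x ⟂ z → y ⟂ z
⟂-resp-≅ {x} {y} {z} x≅y p = *≅0⇒⟂ y z
  (≅-trans {y * z} {x * z} {0ℝ} (*-cong {y} {x} {z} {z} (≅-sym x≅y) ≅-refl) (⟂⇒*≅0 x z p))

nonNeg-1 : NonNeg 1ℝ
nonNeg-1 = nonNeg-pointwise {1ℝ} λ _ → ℚ.nonNegative⁻¹ 1ℚ

nonNeg-0 : NonNeg 0ℝ
nonNeg-0 = nonNeg-pointwise {0ℝ} λ _ → ℚ.≤-refl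

1-cong : ∀ {x y} → x ≅ y → 1ℝ - x ≅ 1ℝ - y
1-cong {x} {y} p = minus-cong {1ℝ} {1ℝ} {x} {y} ≅-refl p

⟂-resp-≅₂ : ∀ {x y u v} → x ≅ y → u ≅ v → x ⟂ u → y ⟂ v
⟂-resp-≅₂ {x} {y} {u} {v} x≅y u≅v p = ⟂-resp-≅ {x} {y} {v} x≅y
  (⟂-sym {v} {x} (⟂-resp-≅ {u} {v} {x} u≅v (⟂-sym {x} {u} p)))

⟂-*ˡ : ∀ k {x y} → x ⟂ y → k * x ⟂ y
⟂-*ˡ k {x} {y} p = *≅0⇒⟂ (k * x) y (≅-trans {(k * x) * y} {k * (x * y)} {0ℝ}
  (pointwise {(k * x) * y} {k * (x * y)} λ n → ℚ.*-assoc (seq k n) (seq x n) (seq y n))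
  (≅-trans {k * (x * y)} {k * 0ℝ} {0ℝ} (*-cong {k} {k} {x * y} {0ℝ} (≅-refl {k}) (⟂⇒*≅0 x y p)) (*-zeroʳ k)))

-- The time schedule of the moves

-- It passes from 0 to 1 while M (1 - t) passes from b to b + 1, so that stages with consecutive b
-- occupy adjacent intervals of time.
stageArgument : ℕ → ℕ → ℝ → ℝ
stageArgument M b t = (fromℚ (fromℕ M) * (1ℝ - t)) - fromℚ (fromℕ b)

abstract
  -- The weight of stage b among stages 0, …, M − 1 run backwards in t: it
  -- falls from 1 to 0 on an interval of length 1/M, the stages with larger b
  -- first.
  stage : ℕ → ℕ → ℝ → ℝ
  stage M b t = clamp (stageArgument M b t)

  stage≅clamp : ∀ M b t → stage M b t ≅ clamp (stageArgument M b t)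
  stage≅clamp M b t = ≅-refl {clamp (stageArgument M b t)}

  stage-continuous : ∀ {I : Set} M b {φ : Functional I} → IsContinuous φ → IsContinuous (λ q → stage M b (φ q))
  stage-continuous M b {φ} φ-cont =
    clamp-continuous {φ = λ q → stageArgument M b (φ q)}
      (minus-continuous {φ = λ q → fromℚ (fromℕ M) * (1ℝ - φ q)} {λ _ → fromℚ (fromℕ b)}
        (scale-continuous {φ = λ q → 1ℝ - φ q} (fromℚ (fromℕ M))
          (minus-continuous {φ = λ _ → 1ℝ} {φ} (const-continuous 1ℝ) φ-cont))
        (const-continuous (fromℚ (fromℕ b))))

stage-start : ∀ {M b} → b ℕ.< M → stage M b 0ℝ ≅ 1ℝ
stage-start {M} {b} b<M = ≅-trans (stage≅clamp M b 0ℝ) (clamp-≥1 (stageArgument M b 0ℝ) λ _ → 1≤)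
  where
  open +-*-Solver
  1≤ : 1ℚ ℚ.≤ fromℕ M ℚ.* (1ℚ ℚ.- 0ℚ) ℚ.- fromℕ b
  1≤ = ≤-shift (solve 2 (λ m b → m :- (b :+ con 1ℚ) := (m :* (con 1ℚ :- con 0ℚ) :- b) :- con 1ℚ) refl (fromℕ M) (fromℕ b))
    (fromℕ-mono-< b<M)

stage-end : ∀ M b → stage M b 1ℝ ≅ 0ℝ
stage-end M b = ≅-trans (stage≅clamp M b 1ℝ) (clamp-≤0 (stageArgument M b 1ℝ) λ _ → ≤0)
  where
  open +-*-Solver
  ≤0 : fromℕ M ℚ.* (1ℚ ℚ.- 1ℚ) ℚ.- fromℕ b ℚ.≤ 0ℚ
  ≤0 = ≤-shift (solve 2 (λ m b → b :- con 0ℚ := con 0ℚ :- (m :* (con 1ℚ :- con 1ℚ) :- b)) refl (fromℕ M) (fromℕ b))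
    (0≤fromℕ b)

stageArgument-gap : ∀ M {b c} t → b ℕ.< c → ∀ n →
  seq (stageArgument M c t) n ℚ.+ 1ℚ ℚ.≤ seq (stageArgument M b t) n
stageArgument-gap M {b} {c} t b<c n = gap (fromℕ M ℚ.* (1ℚ ℚ.- seq t n)) (fromℕ b) (fromℕ c) (fromℕ-mono-< b<c)
  where
  open +-*-Solver
  gap : ∀ u b c → b ℚ.+ 1ℚ ℚ.≤ c → (u ℚ.- c) ℚ.+ 1ℚ ℚ.≤ u ℚ.- b
  gap u b c = ≤-shift (solve 3 (λ u b c → c :- (b :+ con 1ℚ) := (u :- b) :- ((u :- c) :+ con 1ℚ)) refl u b c)

-- The two arguments differ by at least 1: the stage c has not begun unless the stage b is complete.
stage-disjoint : ∀ M {b c} t → b ℕ.< c → 1ℝ - stage M b t ⟂ stage M c t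
stage-disjoint M {b} {c} t b<c = *≅0⇒⟂ (1ℝ - stage M b t) (stage M c t) (≅-trans {(1ℝ - stage M b t) * stage M c t}
  {(1ℝ - clamp (stageArgument M b t)) * clamp (stageArgument M c t)} {0ℝ}
  (*-cong {1ℝ - stage M b t} {1ℝ - clamp (stageArgument M b t)} {stage M c t} {clamp (stageArgument M c t)}
    (1-cong {stage M b t} {clamp (stageArgument M b t)} (stage≅clamp M b t)) (stage≅clamp M c t))
  ([1-clamp]*clamp (stageArgument M b t) (stageArgument M c t) (stageArgument-gap M t b<c)))

stage-nonNeg : ∀ M b t → NonNeg (stage M b t)
stage-nonNeg M b t = nonNeg-resp-≅ {clamp (stageArgument M b t)} {stage M b t} (≅-sym {stage M b t} {clamp (stageArgument M b t)} (stage≅clamp M b t)) (clamp-nonNeg (stageArgument M b t))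

1-stage-nonNeg : ∀ M b t → NonNeg (1ℝ - stage M b t)
1-stage-nonNeg M b t = nonNeg-resp-≅ {1ℝ - clamp (stageArgument M b t)} {1ℝ - stage M b t}
  (1-cong {clamp (stageArgument M b t)} {stage M b t} (≅-sym {stage M b t} {clamp (stageArgument M b t)} (stage≅clamp M b t))) (1-clamp-nonNeg (stageArgument M b t))

1-x+x≅1 : ∀ x → (1ℝ - x) + x ≅ 1ℝ
1-x+x≅1 x = pointwise {(1ℝ - x) + x} {1ℝ} λ n → solve 1 (λ a → (con 1ℚ :- a) :+ a := con 1ℚ) refl (seq x n)
  where open +-*-Solver

abstract
  kept : ℕ → ℕ → ℝ → ℝ
  kept M b t = 1ℝ - stage M b t

  kept≅ : ∀ M b t → kept M b t ≅ 1ℝ - stage M b t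
  kept≅ M b t = ≅-refl {1ℝ - stage M b t}

  kept-continuous : ∀ {I : Set} M b {φ : Functional I} → IsContinuous φ → IsContinuous (λ q → kept M b (φ q))
  kept-continuous M b {φ} φ-cont = minus-continuous {φ = λ _ → 1ℝ} {λ q → stage M b (φ q)} (const-continuous 1ℝ)
    (stage-continuous M b {φ} φ-cont)

kept+stage : ∀ M b t → kept M b t + stage M b t ≅ 1ℝ
kept+stage M b t = ≅-trans {kept M b t + stage M b t} {(1ℝ - stage M b t) + stage M b t} {1ℝ}
  (+-cong {kept M b t} {1ℝ - stage M b t} {stage M b t} {stage M b t} (kept≅ M b t) (≅-refl {stage M b t}))
  (1-x+x≅1 (stage M b t))

kept-start : ∀ {M b} → b ℕ.< M → kept M b 0ℝ ≅ 0ℝ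
kept-start {M} {b} b<M = ≅-trans {kept M b 0ℝ} {1ℝ - stage M b 0ℝ} {0ℝ} (kept≅ M b 0ℝ)
  (≅-trans {1ℝ - stage M b 0ℝ} {1ℝ - 1ℝ} {0ℝ} (1-cong {stage M b 0ℝ} {1ℝ} (stage-start b<M))
    (pointwise {1ℝ - 1ℝ} {0ℝ} λ _ → refl))

kept-end : ∀ M b → kept M b 1ℝ ≅ 1ℝ
kept-end M b = ≅-trans {kept M b 1ℝ} {1ℝ - stage M b 1ℝ} {1ℝ} (kept≅ M b 1ℝ)
  (≅-trans {1ℝ - stage M b 1ℝ} {1ℝ - 0ℝ} {1ℝ} (1-cong {stage M b 1ℝ} {0ℝ} (stage-end M b))
    (pointwise {1ℝ - 0ℝ} {1ℝ} λ _ → refl))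

kept-⟂ : ∀ M {b c} t → b ℕ.< c → kept M b t ⟂ stage M c t
kept-⟂ M {b} {c} t b<c = ⟂-resp-≅ {1ℝ - stage M b t} {kept M b t} {stage M c t}
  (≅-sym {kept M b t} {1ℝ - stage M b t} (kept≅ M b t)) (stage-disjoint M {b} {c} t b<c)

kept-nonNeg : ∀ M b t → NonNeg (kept M b t)
kept-nonNeg M b t = nonNeg-resp-≅ {1ℝ - stage M b t} {kept M b t}
  (≅-sym {kept M b t} {1ℝ - stage M b t} (kept≅ M b t)) (1-stage-nonNeg M b t)

-- `Sphere k` is `UnitSphere (suc k)` by computation. As long as the number of coordinates is a
-- variable, the sum of squares does not unfold.
UnitSphere : ℕ → Space
UnitSphere N = record
  { Index  = Fin N
  ; finite = N , ↔-id _
  ; Member = λ y → ∑ (λ i → y i * y i) ≈ 1ℝ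
  }

-- End points of a homotopy are compared by `_≋_` only, so the constant homotopy at the identity
-- suffices.
stationary-homotopic : ∀ Y (f : Point Y → Point Y) → (∀ p i → proj₁ (f p) i ≅ proj₁ p i) → Homotopic {Y} {Y} f id
stationary-homotopic Y f f≅id =
  mkMap (Y ×ₛ Interval) Y (λ q i → q (inj₁ i)) (λ q (q∈Y , _) → q∈Y) (λ i → coordinate-continuous (inj₁ i)) ,
  λ p → (λ i → ≅⇒≈ (≅-sym {proj₁ (f p) i} {proj₁ p i} (f≅id p i))) , (λ i → ≅⇒≈ (≅-refl {proj₁ p i}))

-- A flag complex whose minimal non-faces are the clashing pairs, with the
-- folding of its vertices.
record Folding {E : Set} (Face : Subset E → Set) : Set where
  field
    tile        : E → Tile
    Face⇒¬Clash : ∀ σ → Face σ → ∀ e f → e ∈ σ → f ∈ σ → ¬ Clash (tile e) (tile f)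
    ¬Clash⇒Face : ∀ σ → (∀ e f → e ∈ σ → f ∈ σ → ¬ Clash (tile e) (tile f)) → Face σ
    ρ           : E → E
    positive    : E → Bool
    ρ-Folds     : ∀ e → Folds (block (tile e)) (positive e) (tile e) (tile (ρ e))

-- The vertex set is a variable: were it to reduce, inferred and written
-- implicit arguments would differ and reals would be compared by unfolding.
module Realization {E : Set} (F : Finite E) (Face : Subset E → Set)
  (down : ∀ {σ τ} → σ ⊆ τ → Face τ → Face σ) (folding : Folding Face) where
  open Folding folding

  K : SimplicialComplex
  K = record { Vertex = E ; finite = F ; Face = Face ; down = down }

  _≟_ : DecidableEquality E
  _≟_ = finite-≟ F

  ∣K∣ : Space
  ∣K∣ = realization K

  -- Membership in the realization in equational form. Flagness replaces the condition on all
  -- subsets of the support by one on pairs.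
  Distribution : (E → ℝ) → Set
  Distribution x = (∀ e → NonNeg (x e)) × ∑[ F ] x ≅ 1ℝ ×
    (∀ e f → Clash (tile e) (tile f) → x e ⟂ x f)

  -- The face condition is applied to the decidable subset consisting of e and f alone: if both
  -- coordinates were positive, a clashing pair would be a face.
  member⇒distribution : ∀ x → Space.Member ∣K∣ x → Distribution x
  member⇒distribution x (0≤x , total , face) =
    (λ e → 0≤⇒nonNeg {x e} (0≤x e)) ,
    ≈⇒≅ total ,
    (λ e f clash → *≅0⇒⟂ (x e) (x f) (nonNeg-disjoint⇒*≅0 {x e} {x f} (0≤⇒nonNeg {x e} (0≤x e)) (0≤⇒nonNeg {x f} (0≤x f))
        λ (0<xe , 0<xf) → contradict e f clash 0<xe 0<xf))
    where
    contradict : ∀ e f → Clash (tile e) (tile f) → 0ℝ < x e → 0ℝ < x f → ⊥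
    contradict e f clash 0<xe 0<xf =
      Face⇒¬Clash σ (face σ λ v v∈σ → positive-on v (toWitness {a? = either? v} v∈σ)) e f
        (fromWitness {a? = either? e} (inj₁ refl)) (fromWitness {a? = either? f} (inj₂ refl)) clash
      where
      either? : ∀ v → Dec (v ≡ e ⊎ v ≡ f)
      either? v = (v ≟ e) ⊎-dec (v ≟ f)
      σ : Subset E
      σ v = isYes (either? v)
      positive-on : ∀ v → v ≡ e ⊎ v ≡ f → 0ℝ < x v
      positive-on v (inj₁ refl) = 0<xe
      positive-on v (inj₂ refl) = 0<xf

  distribution⇒member : ∀ x → Distribution x → Space.Member ∣K∣ x
  distribution⇒member x (nonNeg , total , disjoint) =
    (λ e → nonNeg⇒0≤ {x e} (nonNeg e)) , ≅⇒≈ total ,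
    λ σ pos → ¬Clash⇒Face σ λ e f e∈σ f∈σ clash →
      *≅0⇒disjoint {x e} {x f} (⟂⇒*≅0 (x e) (x f) (disjoint e f clash)) (pos e e∈σ , pos f f∈σ)

  flow-distribution : ∀ (r : E → E) (stay move x : E → ℝ) →
    (∀ e → NonNeg (stay e)) → (∀ e → NonNeg (move e)) → (∀ e → stay e + move e ≅ 1ℝ) →
    (∀ e f → Clash (tile (r e)) (tile (r f)) → x e ⟂ x f) →
    (∀ e f → Clash (tile e) (tile (r f)) → stay e * x e ⟂ move f * x f) →
    Distribution x → Distribution (flow F _≟_ r stay move x)
  flow-distribution r stay move x 0≤stay 0≤move split rr xr (nonNeg , total , disjoint) =
    flow-closed F _≟_ r stay move NonNeg nonNeg-0 (λ {c} {d} → nonNeg-+ {c} {d}) (λ {c} {d} → nonNeg-* {c} {d})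
      0≤stay 0≤move {x} nonNeg ,
    ≅-trans {∑[ F ] (flow F _≟_ r stay move x)} {∑[ F ] x} {1ℝ} (flow-total F _≟_ r stay move split x) total ,
    flow-⟂ F _≟_ r stay move _⟂_ ⟂-sym 0-⟂ +-⟂ *-⟂-inner (λ e f → Clash (tile e) (tile f))
      (λ {e} {f} → Clash-sym (tile e) (tile f)) x disjoint rr xr

  level : E → ℕ
  level e = block (tile e)

  foldFlow : ℕ → ℝ → (E → ℝ) → E → ℝ
  foldFlow M t = flow F _≟_ ρ (λ e → kept M (level e) t) (λ e → stage M (level e) t)

  foldFlow-distribution : ∀ M t x → Distribution x → Distribution (foldFlow M t x)
  foldFlow-distribution M t x d@(_ , _ , disjoint) =
    flow-distribution ρ (λ e → kept M (level e) t) (λ e → stage M (level e) t) x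
      (λ e → kept-nonNeg M (level e) t) (λ e → stage-nonNeg M (level e) t) (λ e → kept+stage M (level e) t)
      (λ e f clash → disjoint e f (Folds-reflects-Clash (ρ-Folds e) (ρ-Folds f) clash))
      (λ e f clash → separate e f (Folds-Clash (tile e) (ρ-Folds f) clash)) d
    where
    separate : ∀ e f → Clash (tile e) (tile f) ⊎ level e ℕ.< level f →
      kept M (level e) t * x e ⟂ stage M (level f) t * x f
    separate e f (inj₁ clash) = *-⟂-inner (kept M (level e) t) (stage M (level f) t) {x e} {x f} (disjoint e f clash)
    -- Here e lies in an earlier block, so its kept share is used up before f starts to move.
    separate e f (inj₂ later) = *-⟂-outer {kept M (level e) t} {stage M (level f) t} (x e) (x f) (kept-⟂ M t later)

  foldFlow-end : ∀ M x e → foldFlow M 1ℝ x e ≅ x e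
  foldFlow-end M x e = flow-start F _≟_ ρ (λ e → kept M (level e) 1ℝ) (λ e → stage M (level e) 1ℝ)
    (λ e → kept-end M (level e)) (λ e → stage-end M (level e)) x e

  -- Levels have to be below M, as only the stages 0, ..., M - 1 are complete at time 0.
  foldFlow-start : ∀ M → (∀ e → level e ℕ.< M) → ∀ x e → foldFlow M 0ℝ x e ≅ push F _≟_ ρ x e
  foldFlow-start M bound x e = flow-end F _≟_ ρ (λ e → kept M (level e) 0ℝ) (λ e → stage M (level e) 0ℝ)
    (λ e → kept-start (bound e)) (λ e → stage-start (bound e)) x e

  foldFlow-continuous : ∀ {I : Set} M (τ : Functional I) (x : (I → ℝ) → E → ℝ) →
    IsContinuous τ → (∀ e → IsContinuous (λ q → x q e)) → ∀ e → IsContinuous (λ q → foldFlow M (τ q) (x q) e)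
  foldFlow-continuous M τ x τ-cont x-cont = flow-continuous F _≟_ ρ
    (λ q e → kept M (level e) (τ q)) (λ q e → stage M (level e) (τ q)) x
    (λ e → kept-continuous M (level e) {τ} τ-cont) (λ e → stage-continuous M (level e) {τ} τ-cont) x-cont

  module _ (Φ : ℝ → (E → ℝ) → E → ℝ) (Φ-distribution : ∀ t x → Distribution x → Distribution (Φ t x))
    (Φ-continuous : ∀ e → IsContinuous {E ⊎ Fin 1} (λ q → Φ (q (inj₂ zero)) (λ e → q (inj₁ e)) e)) where

    homotopy : Map (∣K∣ ×ₛ Interval) ∣K∣
    homotopy = mkMap (∣K∣ ×ₛ Interval) ∣K∣ (λ q → Φ (q (inj₂ zero)) (λ e → q (inj₁ e)))
      (λ q (x∈K , _) → distribution⇒member (Φ (q (inj₂ zero)) (λ e → q (inj₁ e)))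
        (Φ-distribution (q (inj₂ zero)) (λ e → q (inj₁ e)) (member⇒distribution (λ e → q (inj₁ e)) x∈K)))
      Φ-continuous

    homotopic : (f g : Point ∣K∣ → Point ∣K∣) →
      (∀ p e → Φ 0ℝ (proj₁ p) e ≅ proj₁ (f p) e) → (∀ p e → Φ 1ℝ (proj₁ p) e ≅ proj₁ (g p) e) →
      Homotopic {∣K∣} {∣K∣} f g
    homotopic f g Φ-start Φ-end = homotopy , λ p → (λ e → ≅⇒≈ (Φ-start p e)) , (λ e → ≅⇒≈ (Φ-end p e))

  Clash-irrefl : ∀ t → ¬ Clash t t
  Clash-irrefl (H i) (inj₁ e) = ℕ.1+n≢n (sym e)
  Clash-irrefl (H i) (inj₂ e) = ℕ.1+n≢n (sym e)

  -- The complex folds onto a cone with the given apex.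
  module Cone (k : ℕ) (apex : E) (level<1+k : ∀ e → level e ℕ.< suc k)
    (level<k : ∀ e → Clash (tile e) (tile apex) → level e ℕ.< k)
    (∉image-ρ : ∀ e f → Clash (tile e) (tile apex) → ρ f ≢ e) where

    -- All mass heads for the apex during the last stage k. Tiles that clash with the apex have
    -- smaller level and have been emptied by the folding before.
    coneFlow : ℝ → (E → ℝ) → E → ℝ
    coneFlow t = flow F _≟_ (λ _ → apex) (λ _ → kept (suc k) k t) (λ _ → stage (suc k) k t)

    contraction : ℝ → (E → ℝ) → E → ℝ
    contraction t x = coneFlow t (foldFlow (suc k) t x)

    -- A tile clashing with the apex is no image of ρ, so it holds just its kept share of the
    -- original mass; having level below k, that share is orthogonal to the weight of stage k.
    coneFlow-⟂ : ∀ t x e → Clash (tile e) (tile apex) → ∀ z →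
      kept (suc k) k t * foldFlow (suc k) t x e ⟂ stage (suc k) k t * z
    coneFlow-⟂ t x e clash z = ⟂-*ˡ (kept (suc k) k t) {foldFlow (suc k) t x e} {stage (suc k) k t * z}
      (flow-⟂-unhit F _≟_ ρ (λ e → kept (suc k) (level e) t) (λ e → stage (suc k) (level e) t) _⟂_ 0-⟂ +-⟂
        x e (stage (suc k) k t * z) (λ f → ∉image-ρ e f clash)
        (*-⟂-outer {kept (suc k) (level e) t} {stage (suc k) k t} (x e) z (kept-⟂ (suc k) t (level<k e clash))))

    contraction-distribution : ∀ t x → Distribution x → Distribution (contraction t x)
    contraction-distribution t x d = flow-distribution (λ _ → apex) (λ _ → kept (suc k) k t) (λ _ → stage (suc k) k t)
      (foldFlow (suc k) t x) (λ _ → kept-nonNeg (suc k) k t) (λ _ → stage-nonNeg (suc k) k t) (λ _ → kept+stage (suc k) k t)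
      (λ e f clash → ⊥-elim (Clash-irrefl (tile apex) clash))
      (λ e f clash → coneFlow-⟂ t x e clash (foldFlow (suc k) t x f))
      (foldFlow-distribution (suc k) t x d)

    point : E → ℝ
    point e = indicator (apex ≟ e) 1ℝ

    point-distribution : Distribution point
    point-distribution =
      (λ e → indicator-closed NonNeg nonNeg-0 (apex ≟ e) {1ℝ} nonNeg-1) ,
      ≅-trans {∑[ F ] point} {point apex} {1ℝ}
        (sum[]-single F point apex λ e e≢apex → indicator-no (apex ≟ e) {1ℝ} (e≢apex ∘ sym))
        (indicator-yes (apex ≟ apex) {1ℝ} refl) ,
      λ e f clash → separate e f clash (apex ≟ e) (apex ≟ f)
      where
      separate : ∀ e f → Clash (tile e) (tile f) → (d : Dec (apex ≡ e)) (d′ : Dec (apex ≡ f)) → indicator d 1ℝ ⟂ indicator d′ 1ℝ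
      separate e f clash (no _)     d′         = 0-⟂ (indicator d′ 1ℝ)
      separate e f clash (yes _)    (no _)     = ⟂-sym {0ℝ} {1ℝ} (0-⟂ 1ℝ)
      separate e f clash (yes refl) (yes refl) = ⊥-elim (Clash-irrefl (tile apex) clash)

    contraction-start : ∀ x → Distribution x → ∀ e → contraction 0ℝ x e ≅ point e
    contraction-start x d e = ≅-trans {contraction 0ℝ x e} {push F _≟_ (λ _ → apex) (foldFlow (suc k) 0ℝ x) e} {point e}
      (flow-end F _≟_ (λ _ → apex) (λ _ → kept (suc k) k 0ℝ) (λ _ → stage (suc k) k 0ℝ)
        (λ _ → kept-start {suc k} {k} ℕ.≤-refl) (λ _ → stage-start {suc k} {k} ℕ.≤-refl) (foldFlow (suc k) 0ℝ x) e)
      (pushed≅point (foldFlow (suc k) 0ℝ x) (proj₁ (proj₂ (foldFlow-distribution (suc k) 0ℝ x d))))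
      where
      pushed≅point : ∀ y → ∑[ F ] y ≅ 1ℝ → push F _≟_ (λ _ → apex) y e ≅ point e
      pushed≅point y total =
        ≅-trans {push F _≟_ (λ _ → apex) y e} {indicator (apex ≟ e) (∑[ F ] y)} {point e}
          (≅-sym {indicator (apex ≟ e) (∑[ F ] y)} {push F _≟_ (λ _ → apex) y e} (indicator-sum F (apex ≟ e) y))
          (indicator-cong (apex ≟ e) {∑[ F ] y} {1ℝ} λ _ → total)

    contraction-end : ∀ x e → contraction 1ℝ x e ≅ x e
    contraction-end x e = ≅-trans {contraction 1ℝ x e} {foldFlow (suc k) 1ℝ x e} {x e}
      (flow-start F _≟_ (λ _ → apex) (λ _ → kept (suc k) k 1ℝ) (λ _ → stage (suc k) k 1ℝ)
        (λ _ → kept-end (suc k) k) (λ _ → stage-end (suc k) k) (foldFlow (suc k) 1ℝ x) e)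
      (foldFlow-end (suc k) x e)

    contraction-continuous : ∀ e → IsContinuous {E ⊎ Fin 1} (λ q → contraction (q (inj₂ zero)) (λ e → q (inj₁ e)) e)
    contraction-continuous = flow-continuous F _≟_ (λ _ → apex)
      (λ q _ → kept (suc k) k (q (inj₂ zero))) (λ q _ → stage (suc k) k (q (inj₂ zero)))
      (λ q → foldFlow (suc k) (q (inj₂ zero)) (λ e → q (inj₁ e)))
      (λ _ → kept-continuous (suc k) k {λ q → q (inj₂ zero)} time) (λ _ → stage-continuous (suc k) k {λ q → q (inj₂ zero)} time)
      (foldFlow-continuous (suc k) (λ q → q (inj₂ zero)) (λ q e → q (inj₁ e)) time λ e → coordinate-continuous (inj₁ e))
      where
      time : IsContinuous {E ⊎ Fin 1} (λ q → q (inj₂ zero))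
      time = coordinate-continuous (inj₂ zero)

    contractible : Contractible ∣K∣
    contractible = collapse , inclusion ,
      homotopic contraction contraction-distribution contraction-continuous (proj₁ inclusion ∘ proj₁ collapse) id
        (λ (x , x∈K) → contraction-start x (member⇒distribution x x∈K)) (λ (x , _) → contraction-end x) ,
      (mkMap (OnePoint ×ₛ Interval) OnePoint (λ _ ()) (λ _ _ → tt) (λ ()) , λ _ → (λ ()) , (λ ()))
      where
      collapse : Map ∣K∣ OnePoint
      collapse = mkMap ∣K∣ OnePoint (λ _ ()) (λ _ _ → tt) (λ ())
      inclusion : Map OnePoint ∣K∣
      inclusion = mkMap OnePoint ∣K∣ (λ _ → point) (λ _ _ → distribution⇒member point point-distribution)
        (λ e → const-continuous (point e))

  -- The complex folds onto a cross-polytope with N pairs of opposite vertices.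
  module CrossPolytope (N : ℕ) (top bottom : Fin N → E)
    (tile-top : ∀ j → tile (top j) ≡ V (double (toℕ j))) (tile-bottom : ∀ j → tile (bottom j) ≡ H (double (toℕ j)))
    (level<N : ∀ e → level e ℕ.< N)
    (ρ-positive : ∀ e j → positive e ≡ true → level e ≡ toℕ j → ρ e ≡ top j)
    (ρ-negative : ∀ e j → positive e ≡ false → level e ≡ toℕ j → ρ e ≡ bottom j) where

    indices : Finite (Fin N)
    indices = N , ↔-id _

    axis : E → Fin N
    axis e = fromℕ< (level<N e)

    toℕ-axis : ∀ e → toℕ (axis e) ≡ level e
    toℕ-axis e = Fin.toℕ-fromℕ< (level<N e)

    axis-top : ∀ j → axis (top j) ≡ j
    axis-top j = Fin.toℕ-injective (trans (toℕ-axis (top j)) (trans (cong block (tile-top j)) (⌊double/2⌋ (toℕ j))))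

    axis-bottom : ∀ j → axis (bottom j) ≡ j
    axis-bottom j = Fin.toℕ-injective (trans (toℕ-axis (bottom j)) (trans (cong block (tile-bottom j)) (⌊double/2⌋ (toℕ j))))

    positive-top : ∀ j → positive (top j) ≡ true
    positive-top j = Folds-V⇒positive (subst (λ t → Folds (level (top j)) (positive (top j)) t (tile (ρ (top j)))) (tile-top j) (ρ-Folds (top j)))

    positive-bottom : ∀ j → positive (bottom j) ≡ false
    positive-bottom j = Folds-H-double⇒negative (tile-bottom j) (ρ-Folds (bottom j))

    opposite-Clash : ∀ e f → positive e ≡ true → positive f ≡ false → level e ≡ level f → Clash (tile e) (tile f)
    opposite-Clash e f pe pf same = Folds-opposite
      (subst (λ g → Folds (level e) g (tile e) (tile (ρ e))) pe (ρ-Folds e))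
      (subst₂ (λ b g → Folds b g (tile f) (tile (ρ f))) (sym same) pf (ρ-Folds f))

    sign? : ∀ g e → Dec (positive e ≡ g)
    sign? g e = positive e Bool.≟ g

    true≢false : true ≢ false
    true≢false ()

    -- The mass on the positive (negative) side of each axis.
    abstract
      side : Bool → (E → ℝ) → Fin N → ℝ
      side g x j = push F Fin._≟_ axis (restrict (sign? g) x) j

      side≅push : ∀ g x j → side g x j ≅ push F Fin._≟_ axis (restrict (sign? g) x) j
      side≅push g x j = ≅-refl {push F Fin._≟_ axis (restrict (sign? g) x) j}

      side-continuous : ∀ {I : Set} g (x : (I → ℝ) → E → ℝ) → (∀ e → IsContinuous (λ q → x q e)) →
        ∀ j → IsContinuous (λ q → side g (x q) j)
      side-continuous g x x-cont j = push-continuous F Fin._≟_ axis (λ q → restrict (sign? g) (x q))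
        (λ e → indicator-continuous (sign? g e) (x-cont e)) j

    side-nonNeg : ∀ g x → (∀ e → NonNeg (x e)) → ∀ j → NonNeg (side g x j)
    side-nonNeg g x 0≤x j = nonNeg-resp-≅ {push F Fin._≟_ axis (restrict (sign? g) x) j} {side g x j}
      (≅-sym {side g x j} {push F Fin._≟_ axis (restrict (sign? g) x) j} (side≅push g x j))
      (push-closed F Fin._≟_ axis NonNeg nonNeg-0 (λ {c} {d} → nonNeg-+ {c} {d})
        {restrict (sign? g) x} (λ e → indicator-closed NonNeg nonNeg-0 (sign? g e) {x e} (0≤x e)) j)

    -- Every positive tile of a block clashes with every negative one, so all products of a mass
    -- from one side with a mass from the other vanish.
    side-⟂ : ∀ x → Distribution x → ∀ j → side true x j ⟂ side false x j
    side-⟂ x (_ , _ , disjoint) j =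
      ⟂-resp-≅₂ {push F Fin._≟_ axis (restrict (sign? true) x) j} {side true x j}
        {push F Fin._≟_ axis (restrict (sign? false) x) j} {side false x j}
        (≅-sym {side true x j} {push F Fin._≟_ axis (restrict (sign? true) x) j} (side≅push true x j))
        (≅-sym {side false x j} {push F Fin._≟_ axis (restrict (sign? false) x) j} (side≅push false x j))
        (push-⟂ F Fin._≟_ axis _⟂_ 0-⟂ +-⟂ (restrict (sign? true) x) j (push F Fin._≟_ axis (restrict (sign? false) x) j) λ e axis-e →
          ⟂-sym {push F Fin._≟_ axis (restrict (sign? false) x) j} {restrict (sign? true) x e}
            (push-⟂ F Fin._≟_ axis _⟂_ 0-⟂ +-⟂ (restrict (sign? false) x) j (restrict (sign? true) x e) λ f axis-f →
              term e f (sign? true e) (sign? false f)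
                (trans (sym (toℕ-axis e)) (trans (cong toℕ (trans axis-e (sym axis-f))) (toℕ-axis f)))))
      where
      term : ∀ e f (d : Dec (positive e ≡ true)) (d′ : Dec (positive f ≡ false)) → level e ≡ level f →
        indicator d′ (x f) ⟂ indicator d (x e)
      term e f d        (no _)   same = 0-⟂ (indicator d (x e))
      term e f (no _)   (yes pf) same = ⟂-sym {0ℝ} {x f} (0-⟂ (x f))
      term e f (yes pe) (yes pf) same = ⟂-sym {x e} {x f} (disjoint e f (opposite-Clash e f pe pf same))

    side-sum : ∀ x j → side true x j + side false x j ≅ push F Fin._≟_ axis x j
    side-sum x j = push-restrict-complement F Fin._≟_ axis (sign? true) (sign? false)
      (λ _ p q → true≢false (trans (sym p) q)) (λ _ → Bool.¬-not) x j {side true x j} {side false x j}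
      (side≅push true x j) (side≅push false x j)

    axis-total : ∀ x → Distribution x → ∑ (push F Fin._≟_ axis x) ≅ 1ℝ
    axis-total x (_ , total , _) = ≅-trans {∑ (push F Fin._≟_ axis x)} {∑[ F ] x} {1ℝ} (push-total F Fin._≟_ axis indices x) total

    abstract
      lift : (Fin N → E) → (Fin N → ℝ) → E → ℝ
      lift ι u e = push indices _≟_ ι u e

      lift≅push : ∀ ι u e → lift ι u e ≅ push indices _≟_ ι u e
      lift≅push ι u e = ≅-refl {push indices _≟_ ι u e}

      lift-continuous : ∀ {I : Set} ι (u : (I → ℝ) → Fin N → ℝ) → (∀ j → IsContinuous (λ q → u q j)) →
        ∀ e → IsContinuous (λ q → lift ι (u q) e)
      lift-continuous ι u u-cont e = push-continuous indices _≟_ ι u u-cont e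

    lift-nonNeg : ∀ ι u → (∀ j → NonNeg (u j)) → ∀ e → NonNeg (lift ι u e)
    lift-nonNeg ι u 0≤u e = nonNeg-resp-≅ {push indices _≟_ ι u e} {lift ι u e}
      (≅-sym {lift ι u e} {push indices _≟_ ι u e} (lift≅push ι u e))
      (push-closed indices _≟_ ι NonNeg nonNeg-0 (λ {c} {d} → nonNeg-+ {c} {d}) {u} 0≤u e)

    lift-zero : ∀ ι u e → (∀ j → ι j ≢ e) → lift ι u e ≅ 0ℝ
    lift-zero ι u e ι≢e = ≅-trans {lift ι u e} {push indices _≟_ ι u e} {0ℝ} (lift≅push ι u e)
      (push-zero indices _≟_ ι {u} e λ j ιj≡e → ⊥-elim (ι≢e j ιj≡e))

    lift-total : ∀ ι u → ∑[ F ] (lift ι u) ≅ ∑ u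
    lift-total ι u = ≅-trans {∑[ F ] (lift ι u)} {∑[ F ] (push indices _≟_ ι u)} {∑ u}
      (sum[]-cong F {lift ι u} {push indices _≟_ ι u} (lift≅push ι u)) (push-total indices _≟_ ι F u)

    lift-⟂ˡ : ∀ ι u e k → (∀ j → ι j ≡ e → u j ⟂ k) → lift ι u e ⟂ k
    lift-⟂ˡ ι u e k u⟂k = ⟂-resp-≅ {push indices _≟_ ι u e} {lift ι u e} {k}
      (≅-sym {lift ι u e} {push indices _≟_ ι u e} (lift≅push ι u e))
      (push-⟂ indices _≟_ ι _⟂_ 0-⟂ +-⟂ u e k u⟂k)

    lift-⟂ : ∀ ι κ u v e f → (∀ i j → ι i ≡ e → κ j ≡ f → u i ⟂ v j) → lift ι u e ⟂ lift κ v f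
    lift-⟂ ι κ u v e f u⟂v = lift-⟂ˡ ι u e (lift κ v f) λ i ιi≡e →
      ⟂-sym {lift κ v f} {u i} (lift-⟂ˡ κ v f (u i) λ j κj≡f → ⟂-sym {u i} {v j} (u⟂v i j ιi≡e κj≡f))

    -- Barycentric coordinates on the vertices of the cross-polytope, extended by 0 to all other
    -- edges.
    span : (Fin N → ℝ) → (Fin N → ℝ) → E → ℝ
    span u v e = lift top u e + lift bottom v e

    -- Among the chosen vertices only `top j` and `bottom j` with the same j clash, and for these
    -- the orthogonality is assumed.
    span-distribution : ∀ u v → (∀ j → NonNeg (u j)) → (∀ j → NonNeg (v j)) → (∀ j → u j ⟂ v j) →
      ∑ (λ j → u j + v j) ≅ 1ℝ → Distribution (span u v)
    span-distribution u v 0≤u 0≤v u⟂v total =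
      (λ e → nonNeg-+ {lift top u e} {lift bottom v e} (lift-nonNeg top u 0≤u e) (lift-nonNeg bottom v 0≤v e)) ,
      ≅-trans {∑[ F ] (span u v)} {∑ (λ j → u j + v j)} {1ℝ}
        (sum-join F {lift top u} {lift bottom v} {u} {v} (lift-total top u) (lift-total bottom v)) total ,
      λ e f clash → +-⟂ {lift top u e} {lift bottom v e} {span u v f}
        (⟂-sym {span u v f} {lift top u e} (+-⟂ {lift top u f} {lift bottom v f} {lift top u e}
          (lift-⟂ top top u u f e λ i j p q → ⊥-elim (top-top i j (clash-at f e i j top top p q (Clash-sym (tile e) (tile f) clash))))
          (lift-⟂ bottom top v u f e λ i j p q → subst (λ i → v i ⟂ u j)
            (top-bottom j i (Clash-sym (tile (bottom i)) (tile (top j)) (clash-at f e i j bottom top p q (Clash-sym (tile e) (tile f) clash))))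
            (⟂-sym {u j} {v j} (u⟂v j)))))
        (⟂-sym {span u v f} {lift bottom v e} (+-⟂ {lift top u f} {lift bottom v f} {lift bottom v e}
          (lift-⟂ top bottom u v f e λ i j p q → subst (λ j → u i ⟂ v j)
            (top-bottom i j (clash-at f e i j top bottom p q (Clash-sym (tile e) (tile f) clash))) (u⟂v i))
          (lift-⟂ bottom bottom v v f e λ i j p q → ⊥-elim (bottom-bottom i j (clash-at f e i j bottom bottom p q (Clash-sym (tile e) (tile f) clash))))))
      where
      clash-at : ∀ e f i j (ι κ : Fin N → E) → ι i ≡ e → κ j ≡ f → Clash (tile e) (tile f) → Clash (tile (ι i)) (tile (κ j))
      clash-at e f i j ι κ refl refl clash = clash
      top-top : ∀ i j → ¬ Clash (tile (top i)) (tile (top j))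
      top-top i j clash = subst₂ Clash (tile-top i) (tile-top j) clash
      top-bottom : ∀ i j → Clash (tile (top i)) (tile (bottom j)) → i ≡ j
      top-bottom i j clash = same (subst₂ Clash (tile-top i) (tile-bottom j) clash)
        where
        same : Clash (V (double (toℕ i))) (H (double (toℕ j))) → i ≡ j
        same (inj₁ p) = Fin.toℕ-injective (double-injective p)
        same (inj₂ p) = ⊥-elim (double≢1+double (toℕ i) (toℕ j) p)
      bottom-bottom : ∀ i j → ¬ Clash (tile (bottom i)) (tile (bottom j))
      bottom-bottom i j clash = differ (subst₂ Clash (tile-bottom i) (tile-bottom j) clash)
        where
        differ : ¬ Clash (H (double (toℕ i))) (H (double (toℕ j)))
        differ (inj₁ p) = double≢1+double (toℕ i) (toℕ j) p
        differ (inj₂ p) = double≢1+double (toℕ j) (toℕ i) p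

    abstract
      upper lower : (Fin N → ℝ) → Fin N → ℝ
      upper z j = positivePart (signedSquare (z j))
      lower z j = negativePart (signedSquare (z j))

      upper≅ : ∀ z j → upper z j ≅ positivePart (signedSquare (z j))
      upper≅ z j = ≅-refl {positivePart (signedSquare (z j))}

      lower≅ : ∀ z j → lower z j ≅ negativePart (signedSquare (z j))
      lower≅ z j = ≅-refl {negativePart (signedSquare (z j))}

      upper-continuous : ∀ j → IsContinuous (λ z → upper z j)
      upper-continuous j = positivePart-continuous {φ = λ z → signedSquare (z j)}
        (signedSquare-continuous {φ = λ z → z j} (coordinate-continuous j))

      lower-continuous : ∀ j → IsContinuous (λ z → lower z j)
      lower-continuous j = negativePart-continuous {φ = λ z → signedSquare (z j)}
        (signedSquare-continuous {φ = λ z → z j} (coordinate-continuous j))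

      toSphere : (E → ℝ) → Fin N → ℝ
      toSphere x j = signedRoot (side true x j - side false x j)

      toSphere≅ : ∀ x j → toSphere x j ≅ signedRoot (side true x j - side false x j)
      toSphere≅ x j = ≅-refl {signedRoot (side true x j - side false x j)}

      toSphere-continuous : ∀ j → IsContinuous (λ x → toSphere x j)
      toSphere-continuous j = signedRoot-continuous {φ = λ x → side true x j - side false x j}
        (minus-continuous {φ = λ x → side true x j} {λ x → side false x j}
          (side-continuous true (λ x → x) coordinate-continuous j) (side-continuous false (λ x → x) coordinate-continuous j))

    upper-nonNeg : ∀ z j → NonNeg (upper z j)
    upper-nonNeg z j = nonNeg-resp-≅ {positivePart (signedSquare (z j))} {upper z j}
      (≅-sym {upper z j} {positivePart (signedSquare (z j))} (upper≅ z j)) (positivePart-nonNeg (signedSquare (z j)))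

    lower-nonNeg : ∀ z j → NonNeg (lower z j)
    lower-nonNeg z j = nonNeg-resp-≅ {negativePart (signedSquare (z j))} {lower z j}
      (≅-sym {lower z j} {negativePart (signedSquare (z j))} (lower≅ z j)) (negativePart-nonNeg (signedSquare (z j)))

    upper-⟂-lower : ∀ z j → upper z j ⟂ lower z j
    upper-⟂-lower z j = ⟂-resp-≅₂ {positivePart (signedSquare (z j))} {upper z j} {negativePart (signedSquare (z j))} {lower z j}
      (≅-sym {upper z j} {positivePart (signedSquare (z j))} (upper≅ z j)) (≅-sym {lower z j} {negativePart (signedSquare (z j))} (lower≅ z j))
      (*≅0⇒⟂ (positivePart (signedSquare (z j))) (negativePart (signedSquare (z j))) (positivePart*negativePart (signedSquare (z j))))

    upper+lower : ∀ z j → upper z j + lower z j ≅ z j * z j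
    upper+lower z j = ≅-trans {upper z j + lower z j} {positivePart (signedSquare (z j)) + negativePart (signedSquare (z j))} {z j * z j}
      (+-cong {upper z j} {positivePart (signedSquare (z j))} {lower z j} {negativePart (signedSquare (z j))} (upper≅ z j) (lower≅ z j))
      (≅-trans {positivePart (signedSquare (z j)) + negativePart (signedSquare (z j))} {∣ signedSquare (z j) ∣} {z j * z j}
        (positivePart+negativePart (signedSquare (z j))) (∣signedSquare∣ (z j)))

    upper-lower : ∀ z j → upper z j - lower z j ≅ signedSquare (z j)
    upper-lower z j = ≅-trans {upper z j - lower z j} {positivePart (signedSquare (z j)) - negativePart (signedSquare (z j))} {signedSquare (z j)}
      (minus-cong {upper z j} {positivePart (signedSquare (z j))} {lower z j} {negativePart (signedSquare (z j))} (upper≅ z j) (lower≅ z j))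
      (positivePart-negativePart (signedSquare (z j)))

    abstract
      fromSphere : (Fin N → ℝ) → E → ℝ
      fromSphere z = span (upper z) (lower z)

      fromSphere≡span : ∀ z → fromSphere z ≡ span (upper z) (lower z)
      fromSphere≡span z = refl

      fromSphere-continuous : ∀ e → IsContinuous (λ z → fromSphere z e)
      fromSphere-continuous e = +-continuous {φ = λ z → lift top (upper z) e} {λ z → lift bottom (lower z) e}
        (lift-continuous top upper upper-continuous e) (lift-continuous bottom lower lower-continuous e)

    fromSphere-distribution : ∀ z → ∑ (λ j → z j * z j) ≅ 1ℝ → Distribution (fromSphere z)
    fromSphere-distribution z unit = subst Distribution (sym (fromSphere≡span z))
      (span-distribution (upper z) (lower z) (upper-nonNeg z) (lower-nonNeg z) (upper-⟂-lower z)
        (≅-trans {∑ (λ j → upper z j + lower z j)} {∑ (λ j → z j * z j)} {1ℝ}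
          (sum-cong {N} {λ j → upper z j + lower z j} {λ j → z j * z j} (upper+lower z)) unit))

    side-*≅0 : ∀ x → Distribution x → ∀ j → side true x j * side false x j ≅ 0ℝ
    side-*≅0 x d j = ⟂⇒*≅0 (side true x j) (side false x j) (side-⟂ x d j)

    -- The square of the signed root is the absolute difference of the two sides, which by
    -- orthogonality is their sum. Total mass 1 thus becomes Euclidean norm 1.
    toSphere² : ∀ x → Distribution x → ∀ j → toSphere x j * toSphere x j ≅ push F Fin._≟_ axis x j
    toSphere² x d@(0≤x , _ , _) j =
      ≅-trans {toSphere x j * toSphere x j} {signedRoot (side true x j - side false x j) * signedRoot (side true x j - side false x j)} {push F Fin._≟_ axis x j}
        (*-cong {toSphere x j} {signedRoot (side true x j - side false x j)} {toSphere x j} {signedRoot (side true x j - side false x j)} (toSphere≅ x j) (toSphere≅ x j))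
        (≅-trans {signedRoot (side true x j - side false x j) * signedRoot (side true x j - side false x j)} {∣ side true x j - side false x j ∣} {push F Fin._≟_ axis x j} (signedRoot² (side true x j - side false x j))
          (≅-trans {∣ side true x j - side false x j ∣} {side true x j + side false x j} {push F Fin._≟_ axis x j}
            (∣a-b∣≅a+b {side true x j} {side false x j} (side-nonNeg true x 0≤x j) (side-nonNeg false x 0≤x j) (side-*≅0 x d j))
            (side-sum x j)))

    toSphere-unit : ∀ x → Distribution x → ∑ (λ j → toSphere x j * toSphere x j) ≅ 1ℝ
    toSphere-unit x d = ≅-trans {∑ (λ j → toSphere x j * toSphere x j)} {∑ (push F Fin._≟_ axis x)} {1ℝ}
      (sum-cong {N} {λ j → toSphere x j * toSphere x j} {push F Fin._≟_ axis x} (toSphere² x d)) (axis-total x d)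

    -- Restriction to positive edges removes the `bottom` part; what remains is pushed along
    -- `axis ∘ top`, which is the identity.
    side-span-top : ∀ u v j → side true (span u v) j ≅ u j
    side-span-top u v j =
      ≅-trans {side true (span u v) j} {push F Fin._≟_ axis (restrict (sign? true) (span u v)) j} {u j} (side≅push true (span u v) j)
      (≅-trans {push F Fin._≟_ axis (restrict (sign? true) (span u v)) j} {push F Fin._≟_ axis (push indices _≟_ top u) j} {u j}
        (push-cong F Fin._≟_ axis {restrict (sign? true) (span u v)} {push indices _≟_ top u} supported j)
      (≅-trans {push F Fin._≟_ axis (push indices _≟_ top u) j} {push indices Fin._≟_ (axis ∘ top) u j} {u j}
        (push-∘ indices F _≟_ Fin._≟_ top axis u j)
      (≅-trans {push indices Fin._≟_ (axis ∘ top) u j} {push indices Fin._≟_ id u j} {u j}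
        (push-agree indices Fin._≟_ (axis ∘ top) id u (λ i → inj₁ (axis-top i)) j)
        (push-id indices Fin._≟_ u j))))
      where
      supported : ∀ e → restrict (sign? true) (span u v) e ≅ push indices _≟_ top u e
      supported e = ≅-trans {restrict (sign? true) (span u v) e} {lift top u e} {push indices _≟_ top u e}
        (indicator-absorbʳ (sign? true e) {lift top u e} {lift bottom v e}
          (λ pe → lift-zero bottom v e λ i p → true≢false (trans (sym pe) (trans (cong positive (sym p)) (positive-bottom i))))
          (λ ¬pe → lift-zero top u e λ i p → ¬pe (trans (cong positive (sym p)) (positive-top i))))
        (lift≅push top u e)

    side-span-bottom : ∀ u v j → side false (span u v) j ≅ v j
    side-span-bottom u v j =
      ≅-trans {side false (span u v) j} {push F Fin._≟_ axis (restrict (sign? false) (span u v)) j} {v j} (side≅push false (span u v) j)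
      (≅-trans {push F Fin._≟_ axis (restrict (sign? false) (span u v)) j} {push F Fin._≟_ axis (push indices _≟_ bottom v) j} {v j}
        (push-cong F Fin._≟_ axis {restrict (sign? false) (span u v)} {push indices _≟_ bottom v} supported j)
      (≅-trans {push F Fin._≟_ axis (push indices _≟_ bottom v) j} {push indices Fin._≟_ (axis ∘ bottom) v j} {v j}
        (push-∘ indices F _≟_ Fin._≟_ bottom axis v j)
      (≅-trans {push indices Fin._≟_ (axis ∘ bottom) v j} {push indices Fin._≟_ id v j} {v j}
        (push-agree indices Fin._≟_ (axis ∘ bottom) id v (λ i → inj₁ (axis-bottom i)) j)
        (push-id indices Fin._≟_ v j))))
      where
      supported : ∀ e → restrict (sign? false) (span u v) e ≅ push indices _≟_ bottom v e
      supported e = ≅-trans {restrict (sign? false) (span u v) e} {lift bottom v e} {push indices _≟_ bottom v e}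
        (indicator-absorbˡ (sign? false e) {lift top u e} {lift bottom v e}
          (λ pe → lift-zero top u e λ i p → true≢false (trans (sym (positive-top i)) (trans (cong positive p) pe)))
          (λ ¬pe → lift-zero bottom v e λ i p → ¬pe (trans (cong positive (sym p)) (positive-bottom i))))
        (lift≅push bottom v e)

    toSphere-fromSphere : ∀ z j → toSphere (fromSphere z) j ≅ z j
    toSphere-fromSphere z j =
      ≅-trans {toSphere (fromSphere z) j} {signedRoot (side true (fromSphere z) j - side false (fromSphere z) j)} {z j} (toSphere≅ (fromSphere z) j)
      (≅-trans {signedRoot (side true (fromSphere z) j - side false (fromSphere z) j)} {signedRoot (signedSquare (z j))} {z j}
        (signedRoot-cong {side true (fromSphere z) j - side false (fromSphere z) j} {signedSquare (z j)}
          (≅-trans {side true (fromSphere z) j - side false (fromSphere z) j} {upper z j - lower z j} {signedSquare (z j)}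
            (minus-cong {side true (fromSphere z) j} {upper z j} {side false (fromSphere z) j} {lower z j}
              (subst (λ x → side true x j ≅ upper z j) (sym (fromSphere≡span z)) (side-span-top (upper z) (lower z) j))
              (subst (λ x → side false x j ≅ lower z j) (sym (fromSphere≡span z)) (side-span-bottom (upper z) (lower z) j)))
            (upper-lower z j)))
        (signedRoot-signedSquare (z j)))

    signedSquare-toSphere : ∀ x j → signedSquare (toSphere x j) ≅ side true x j - side false x j
    signedSquare-toSphere x j =
      ≅-trans {signedSquare (toSphere x j)} {signedSquare (signedRoot (side true x j - side false x j))} {side true x j - side false x j}
        (signedSquare-cong {toSphere x j} {signedRoot (side true x j - side false x j)} (toSphere≅ x j))
        (signedSquare-signedRoot (side true x j - side false x j))

    upper-toSphere : ∀ x → Distribution x → ∀ j → upper (toSphere x) j ≅ side true x j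
    upper-toSphere x d@(0≤x , _ , _) j =
      ≅-trans {upper (toSphere x) j} {positivePart (signedSquare (toSphere x j))} {side true x j} (upper≅ (toSphere x) j)
      (≅-trans {positivePart (signedSquare (toSphere x j))} {positivePart (side true x j - side false x j)} {side true x j}
        (positivePart-cong {signedSquare (toSphere x j)} {side true x j - side false x j} (signedSquare-toSphere x j))
        (positivePart-difference {side true x j} {side false x j} (side-nonNeg true x 0≤x j) (side-nonNeg false x 0≤x j) (side-*≅0 x d j)))

    lower-toSphere : ∀ x → Distribution x → ∀ j → lower (toSphere x) j ≅ side false x j
    lower-toSphere x d@(0≤x , _ , _) j =
      ≅-trans {lower (toSphere x) j} {negativePart (signedSquare (toSphere x j))} {side false x j} (lower≅ (toSphere x) j)
      (≅-trans {negativePart (signedSquare (toSphere x j))} {negativePart (side true x j - side false x j)} {side false x j}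
        (negativePart-cong {signedSquare (toSphere x j)} {side true x j - side false x j} (signedSquare-toSphere x j))
        (negativePart-difference {side true x j} {side false x j} (side-nonNeg true x 0≤x j) (side-nonNeg false x 0≤x j) (side-*≅0 x d j)))

    lift-side : ∀ g ι x u → (∀ j → u j ≅ side g x j) → (∀ e → positive e ≡ g → ι (axis e) ≡ ρ e) →
      ∀ e → lift ι u e ≅ push F _≟_ ρ (restrict (sign? g) x) e
    lift-side g ι x u u≅side ι-axis e =
      ≅-trans {lift ι u e} {push indices _≟_ ι u e} {push F _≟_ ρ (restrict (sign? g) x) e} (lift≅push ι u e)
      (≅-trans {push indices _≟_ ι u e} {push indices _≟_ ι (push F Fin._≟_ axis (restrict (sign? g) x)) e} {push F _≟_ ρ (restrict (sign? g) x) e}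
        (push-cong indices _≟_ ι {u} {push F Fin._≟_ axis (restrict (sign? g) x)}
          (λ j → ≅-trans {u j} {side g x j} {push F Fin._≟_ axis (restrict (sign? g) x) j} (u≅side j) (side≅push g x j)) e)
      (≅-trans {push indices _≟_ ι (push F Fin._≟_ axis (restrict (sign? g) x)) e} {push F _≟_ (ι ∘ axis) (restrict (sign? g) x) e} {push F _≟_ ρ (restrict (sign? g) x) e}
        (push-∘ F indices Fin._≟_ _≟_ axis ι (restrict (sign? g) x) e)
        (push-agree F _≟_ (ι ∘ axis) ρ (restrict (sign? g) x) (λ f → agree f (sign? g f)) e)))
      where
      agree : ∀ f (d : Dec (positive f ≡ g)) → ι (axis f) ≡ ρ f ⊎ indicator d (x f) ≅ 0ℝ
      agree f (yes p) = inj₁ (ι-axis f p)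
      agree f (no ¬p) = inj₂ (≅-refl {0ℝ})

    -- Collecting the mass of each side of an axis and putting it on one vertex amounts to pushing
    -- along ρ, because ρ e depends only on the axis and the sign of e. The composite is thus the
    -- end result of the folding.
    fromSphere-toSphere : ∀ x → Distribution x → ∀ e → fromSphere (toSphere x) e ≅ push F _≟_ ρ x e
    fromSphere-toSphere x d e = subst (λ y → y e ≅ push F _≟_ ρ x e) (sym (fromSphere≡span (toSphere x)))
      (push-restrict-complement F _≟_ ρ (sign? true) (sign? false)
        (λ _ p q → true≢false (trans (sym p) q)) (λ _ → Bool.¬-not) x e
        {lift top (upper (toSphere x)) e} {lift bottom (lower (toSphere x)) e}
        (lift-side true top x (upper (toSphere x)) (upper-toSphere x d)
          (λ f p → sym (ρ-positive f (axis f) p (sym (toℕ-axis f)))) e)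
        (lift-side false bottom x (lower (toSphere x)) (lower-toSphere x d)
          (λ f p → sym (ρ-negative f (axis f) p (sym (toℕ-axis f)))) e))

    ∣K∣→Sphere : Map ∣K∣ (UnitSphere N)
    ∣K∣→Sphere = mkMap ∣K∣ (UnitSphere N) toSphere
      (λ x x∈K → ≅⇒≈ (toSphere-unit x (member⇒distribution x x∈K))) toSphere-continuous

    Sphere→∣K∣ : Map (UnitSphere N) ∣K∣
    Sphere→∣K∣ = mkMap (UnitSphere N) ∣K∣ fromSphere
      (λ z unit → distribution⇒member (fromSphere z) (fromSphere-distribution z (≈⇒≅ unit)))
      fromSphere-continuous

    folding-continuous : ∀ e → IsContinuous {E ⊎ Fin 1} (λ q → foldFlow N (q (inj₂ zero)) (λ e → q (inj₁ e)) e)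
    folding-continuous = foldFlow-continuous N (λ q → q (inj₂ zero)) (λ q e → q (inj₁ e))
      (coordinate-continuous (inj₂ zero)) λ e → coordinate-continuous (inj₁ e)

    folding-start : ∀ x → Distribution x → ∀ e → foldFlow N 0ℝ x e ≅ fromSphere (toSphere x) e
    folding-start x d e = ≅-trans {foldFlow N 0ℝ x e} {push F _≟_ ρ x e} {fromSphere (toSphere x) e}
      (foldFlow-start N level<N x e)
      (≅-sym {fromSphere (toSphere x) e} {push F _≟_ ρ x e} (fromSphere-toSphere x d e))

    ∣K∣≃Sphere : ∣K∣ ≃ UnitSphere N
    ∣K∣≃Sphere = ∣K∣→Sphere , Sphere→∣K∣ ,
      homotopic (foldFlow N) (foldFlow-distribution N) folding-continuous (proj₁ Sphere→∣K∣ ∘ proj₁ ∣K∣→Sphere) id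
        (λ (x , x∈K) → folding-start x (member⇒distribution x x∈K)) (λ (x , _) → foldFlow-end N x) ,
      stationary-homotopic (UnitSphere N) (proj₁ ∣K∣→Sphere ∘ proj₁ Sphere→∣K∣) (λ (z , _) → toSphere-fromSphere z)

-- The grid

strip-folding : ∀ m → Folding (SimplicialComplex.Face (Strip.K m))
strip-folding m = record
  { tile = tile ; Face⇒¬Clash = Face⇒¬Clash ; ¬Clash⇒Face = ¬Clash⇒Face
  ; ρ = ρ ; positive = positive ; ρ-Folds = ρ-Folds }
  where open Strip m

module StripRealization (m : ℕ) = Realization (SimplicialComplex.finite (Strip.K m)) (SimplicialComplex.Face (Strip.K m))
  (SimplicialComplex.down (Strip.K m)) (strip-folding m)

-- Record eta identifies the complex rebuilt from its fields with the original; results are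
-- transported along this equation.
realization-η : ∀ m → StripRealization.K m ≡ Strip.K m
realization-η m = refl

strip-contractible : ∀ k → Contractible (realization (Strip.K (double k)))
strip-contractible k = subst (λ K → Contractible (realization K)) (realization-η (double k))
  (StripRealization.Cone.contractible (double k) k apex level<1+k level<k ∉image-ρ)
  where
  open Strip (double k)
  apex : E
  apex = inj₁ (zero , Fin.fromℕ (double k))

  level<1+k : ∀ e → block (tile e) ℕ.< suc k
  level<1+k (inj₁ (_ , j)) = ℕ.s≤s (≤double⇒⌊/2⌋≤ (ℕ.≤-pred (Fin.toℕ<n j)))
  level<1+k (inj₂ (_ , i)) = ℕ.s≤s (≤double⇒⌊/2⌋≤ (ℕ.<⇒≤ (Fin.toℕ<n i)))

  -- The last column is 2k and horizontal positions stop at 2k - 1, so only H (2k - 1) meets the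
  -- apex.
  clash-apex : ∀ i → Covers (H (toℕ i)) (toℕ (Fin.fromℕ (double k))) → double k ≡ suc (toℕ {double k} i)
  clash-apex i (inj₁ p) = ⊥-elim (ℕ.<⇒≢ (Fin.toℕ<n i) (trans (sym p) (Fin.toℕ-fromℕ (double k))))
  clash-apex i (inj₂ p) = trans (sym (Fin.toℕ-fromℕ (double k))) p

  level<k : ∀ e → Clash (tile e) (tile apex) → block (tile e) ℕ.< k
  level<k (inj₂ (_ , i)) clash = double≡1+⇒⌊/2⌋< (clash-apex i clash)

  -- Horizontal images of ρ have even position, whereas a tile clashing with the apex is at the odd
  -- position 2k - 1.
  ∉image-ρ : ∀ e f → Clash (tile e) (tile apex) → ρ f ≢ e
  ∉image-ρ (inj₂ (_ , i)) f clash ρf≡e = double≢1+double k (block (tile f))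
    (trans (clash-apex i clash) (cong suc (Folds-onto-H
      (subst (Folds (block (tile f)) (positive f) (tile f)) (cong tile ρf≡e) (ρ-Folds f)))))

-- The 2k + 2 columns form k + 1 full blocks, each of which contributes one coordinate of the
-- ambient space of the sphere.
strip-≃-Sphere : ∀ k → realization (Strip.K (suc (double k))) ≃ Sphere k
strip-≃-Sphere k = subst (λ K → realization K ≃ Sphere k) (realization-η (suc (double k)))
  (StripRealization.CrossPolytope.∣K∣≃Sphere (suc (double k)) (suc k) top bottom tile-top tile-bottom level<1+k
    ρ-positive ρ-negative)
  where
  open Strip (suc (double k))

  double<1+double : ∀ (j : Fin (suc k)) → double (toℕ j) ℕ.< suc (double k)
  double<1+double j = ℕ.s≤s (double-mono-≤ (ℕ.≤-pred (Fin.toℕ<n j)))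

  top bottom : Fin (suc k) → E
  top j    = inj₁ (zero , fromℕ< (ℕ.m<n⇒m<1+n (double<1+double j)))
  bottom j = inj₂ (zero , fromℕ< (double<1+double j))

  tile-top : ∀ j → tile (top j) ≡ V (double (toℕ j))
  tile-top j = cong V (Fin.toℕ-fromℕ< (ℕ.m<n⇒m<1+n (double<1+double j)))

  tile-bottom : ∀ j → tile (bottom j) ≡ H (double (toℕ j))
  tile-bottom j = cong H (Fin.toℕ-fromℕ< (double<1+double j))

  level<1+k : ∀ e → block (tile e) ℕ.< suc k
  level<1+k (inj₁ (_ , j)) = ℕ.s≤s (≤1+double⇒⌊/2⌋≤ (ℕ.≤-pred (Fin.toℕ<n j)))
  level<1+k (inj₂ (_ , i)) = ℕ.s≤s (≤1+double⇒⌊/2⌋≤ (ℕ.<⇒≤ (Fin.toℕ<n i)))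

  ρ-positive : ∀ e j → positive e ≡ true → block (tile e) ≡ toℕ j → ρ e ≡ top j
  ρ-positive e j p q = tile-row-injective (ρ e) (top j)
    (trans (Folds-positive (subst₂ (λ b g → Folds b g (tile e) (tile (ρ e))) q p (ρ-Folds e))) (sym (tile-top j))) (ρ-row e)

  ρ-negative : ∀ e j → positive e ≡ false → block (tile e) ≡ toℕ j → ρ e ≡ bottom j
  ρ-negative e j p q = tile-row-injective (ρ e) (bottom j)
    (trans (Folds-negative (subst₂ (λ b g → Folds b g (tile e) (tile (ρ e))) q p (ρ-Folds e))) (sym (tile-bottom j))) (ρ-row e)

theorem3p1 : (n : ℕ) → n ℕ.≥ 1 →
    (¬ (2 ∣ n) → Contractible (realization (perfectMatchingComplex (Grid 2 n)))) ×
    ((k : ℕ) → 2 ∣ n → n ≡ 2 ℕ.* k ℕ.+ 2 →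
    realization (perfectMatchingComplex (Grid 2 n)) ≃ Sphere k)
theorem3p1 n _ = odd-case (parity n) , even-case
  where
  odd-case : ∀ {n} → Parity n → ¬ (2 ∣ n) → Contractible (realization (perfectMatchingComplex (Grid 2 n)))
  odd-case (even b) ¬2∣n = ⊥-elim (¬2∣n (divides b (double≡*2 b)))
  odd-case (odd b)  _    = strip-contractible b
  even-case : ∀ k → 2 ∣ n → n ≡ 2 ℕ.* k ℕ.+ 2 → realization (perfectMatchingComplex (Grid 2 n)) ≃ Sphere k
  even-case k _ n≡2k+2 = subst (λ n → realization (perfectMatchingComplex (Grid 2 n)) ≃ Sphere k)
    (sym (trans n≡2k+2 (trans (ℕ.+-comm (2 ℕ.* k) 2) (cong (2 ℕ.+_) (trans (ℕ.*-comm 2 k) (sym (double≡*2 k)))))))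
    (strip-≃-Sphere k)
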